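{- Let $B\in\mathbb{R}_{+}$, $F\in\mathbb{N}$, $L\in[1,\infty)$ and $k\in\{0\}\cup\mathbb{N}$. Then there exist constants $K,K'\in(0,1]$ (depending only on $B,F,L,k$) such that the following holds. Let $R$ be a commutative ring, let $d\ge k+2$, let $(X,w)$ be a properly weighted $R$-oriented $d$-poset of lower irregularity $L(X)\le L$ and such that $F^{\max}_{i,j}(X)\le F$ for all $-1\le i\le j\le k+2$, let $\mathcal{P}$ be a $k$-intersection profile for $X$ and let $\mathcal{P}'$ be a $(k+1)$-intersection profile for $X$. Let $\mathcal{F}$ be an $R$-sheaf on $X$, let $\varepsilon\in(0,1]$ and $B'\in[1,\infty)$, and suppose that: (1a) $\mathrm{cbe}_{k-\dim u-1}(X_u,w_u,\mathcal{F}_u)\ge\varepsilon$ for every $u\in X(0)\cup\dots\cup X(k)$; (1b) $\mathrm{cbe}_{k-\dim u}(X_u,w_u,\mathcal{F}_u)\ge\varepsilon$ for every $u\in X(0)\cup\dots\cup X(k+1)$; (2a) for every $(t,\ell,r,b)\in\mathcal{P}\cup\mathcal{P}'$ with $b>-1$ and every $u\in X(b)$, the related weighted hypergraph $\mathrm{NIH}^{\ell,r,t}_u(X,w)$ is a $\big((K\varepsilon)^{2^{k+1-r}},\,B(K\varepsilon)^{ -2^{k+1-r}(2^{(r-1)-b}-1)}\big)$-skeleton expander; (2b) for every $(t,\ell,r,b)\in\mathcal{P}\cup\mathcal{P}'$ with $b=-1$, the related weighted hypergraph $\mathrm{NIH}^{\ell,r,t}(X,w)$ is a $\big((K\varepsilon)^{2^{k+1-r}},\,B'B(K\varepsilon)^{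 -2^{k+1-r}(2^{r}-1)}\big)$-skeleton expander. Then $$\mathrm{cse}_k(X,w,\mathcal{F})\ge B'^{ -1}K'(K\varepsilon)^{2^{k+2}-1}\qquad\text{and}\qquad \mathrm{ccd}_k(X,w,\mathcal{F})\ge B'^{ -1}K'(K\varepsilon)^{2^{k+1}-1}.$$ Moreover, if $f\in C^k=C^k(X,\mathcal{F})$ satisfies $\mathrm{dist}_w(f,Z^k)<B'^{ -1}K'(K\varepsilon)^{2^{k+2}-1}$, then applying the Correction Algorithm to $f$ with parameter $q=K(K\varepsilon)^{2^{k+1}-1}$ returns $f'\in Z^k$ such that $\mathrm{dist}_w(f,f')\le K'^{ -1}(K\varepsilon)^{ -2^{k+1}}\mathrm{dist}_w(f,Z^k)$.
   Context: **Posets.** All posets are finite; $x\lhd y$ means $x<y$ with no element strictly between. A graded poset is a poset $X$ with $\dim:X\to\mathbb{Z}$ such that $x\le y$ implies $\dim x\le\dim y$ and $x\lhd y$ implies $\dim y=\dim x+1$. Put $X(i)=\{x\in X:\dim x=i\}$ ($i$-faces), $x(i)=\{y\in X(i):y\le x\}$, and $A_x=\{a\in A:a\ge x\}$ for $A\subseteq X$. A $d$-poset ($d\ge 0$) is a nonempty graded poset in which every face is $\le$ some $d$-face and which has a face $\emptyset_X$ with $\dim\emptyset_X=-1$ and $\emptyset_X\le x$ for all $x$. For a subset $A$ of a $d$-poset, $\mathrm{Inf}\,A$ is the set of maximal lower bounds of $A$. **Face counts.** For $i\le j\le k$, $F^{\max}_{i,j,k}(X)$ (resp. $F^{\min}_{i,j,k}(X)$)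 is the maximal (resp. minimal) number of $y\in X(j)$ with $x\le y\le z$, over all $x\in X(i)$, $z\in X(k)$ with $x\le z$. Write $F^{\max}_{j,k}=F^{\max}_{ -1,j,k}$, $F^{\min}_{j,k}=F^{\min}_{ -1,j,k}$, $L_{i,j,k}=F^{\max}_{i,j,k}/F^{\min}_{i,j,k}$ and $L(X)=\max_{ -1\le i\le j\le k\le d}L_{i,j,k}$ (lower irregularity). **Weights and links.** A proper weight function on a $d$-poset $X$ is $w:X\to\mathbb{R}_+$ (positive reals) with $\sum_{y\in X(d)}w(y)=1$ and $w(x)=\sum_{y\in X(d),\,y\ge x}w(y)/|y(i)|$ for all $x\in X(i)$ and all $i$; $(X,w)$ is then a properly weighted $d$-poset. For $A\subseteq X$, $w(A)=\sum_{a\in A}w(a)$. For $z\in X$ the link is $X_z=\{x\in X:x\ge z\}$ with $\dim_{X_z}x=\dim x-\dim z-1$; it is a $(d-\dim z-1)$-poset, given the proper weight function $w_z(x)=\frac{1}{w(X(d)_z)}\sum_{y\in X(d)_x}\frac{w(y)}{\#\{x'\in X(\dim x):z\le x'\le y\}}$. **Orientation, sheaves, cohomology.** An $R$-orientation ($R$ a commutative ring) on $X$ assigns $[y:x]\in R^\times$ to each $x\lhd y$ so that $\sum_{y:x<y<z}[z:y][y:x]=0$ whenever $x\le z$ and $\dim z=\dim x+2$; links carry the restricted orientation. An $R$-sheaf $\mathcal{F}$ on $X$ consists of $R$-modules $\mathcal{F}(x)$ ($x\in X$) and $R$-linear maps $\mathrm{res}_{y\leftarrow x}:\mathcal{F}(x)\to\mathcal{F}(y)$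 ($x<y$) with $\mathrm{res}_{z\leftarrow y}\circ\mathrm{res}_{y\leftarrow x}=\mathrm{res}_{z\leftarrow x}$ for $x<y<z$. $\mathcal{F}_z$ is the restriction of $\mathcal{F}$ to $X_z$. $C^i=C^i(X,\mathcal{F})=\prod_{x\in X(i)}\mathcal{F}(x)$; $d=d_i:C^i\to C^{i+1}$ is $(d_if)(y)=\sum_{x\in y(i)}[y:x]\,\mathrm{res}_{y\leftarrow x}f(x)$; $Z^i=\ker d_i$, $B^i=\mathrm{im}\,d_{i-1}$. **Expansion.** For $f,g\in C^i$: $\|f\|_w=w(\{x:f(x)\ne0\})$, $\mathrm{dist}_w(f,g)=\|f-g\|_w$. $\mathrm{cse}_i(X,w,\mathcal{F})$ is the supremum of the $\mu\ge0$ with $\|df\|_w\ge\mu\,\mathrm{dist}_w(f,Z^i)$ for all $f\in C^i$; $\mathrm{cbe}_i(X,w,\mathcal{F})$ is the supremum of the $\mu\ge 0$ with $\|df\|_w\ge\mu\,\mathrm{dist}_w(f,B^i)$ for all $f\in C^i$; $\mathrm{ccd}_i(X,w,\mathcal{F})=\inf\{\|f\|_w:f\in Z^i\setminus B^i\}$. **No-intersection hypergraphs, skeleton expansion.** For a weighted $d$-poset $(X,w)$ and $i,j,k\in\{0,\dots,d\}$ with $i,j<k$, $\mathrm{NIH}^{i,j,k}(X,w)$ is the hypergraph with vertex set $X(i)\cup X(j)$ and hyperedge set $X(k)$ (incidence from $X$), with weights: $w(z)$ for a hyperedge $z$; for a vertex $x$, $w(x)$ if $i=j$ and $\frac12w(x)$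 if $i\ne j$; and with relation on vertices: $x\sim y$ iff some $z\in X(k)$ has $x,y\le z$, $\mathrm{Inf}\{x,y\}=\{\emptyset_X\}$ and $(\dim x,\dim y)\in\{(i,j),(j,i)\}$. A related weighted hypergraph $(H,w_H,\sim)$ is an $(\alpha,\beta)$-skeleton expander if for every set $A$ of vertices $w_H(E_2(A))\le\alpha w_H(A)+\beta w_H(A)^2$, where $E_2(A)$ is the set of hyperedges $e$ containing two distinct $u,v\in A$ with $u\sim v$. For $z\in X$ with $b=\dim z<i,j$, $\mathrm{NIH}^{i,j,k}_z(X,w)=\mathrm{NIH}^{i-b-1,j-b-1,k-b-1}(X_z,w_z)$. **Intersection profiles.** An abstract $k$-intersection profile $\mathcal{P}$ is a set of integer quadruples $(t,\ell,r,b)$ with $k+1\ge t>\ell\ge r>b\ge-1$, together with a set $\mathrm{Ad}(\mathcal{P})$ of integer pairs $(i,j)$ with $k+1\ge i>j\ge-1$, such that: (i) for $(t,\ell,r,b)\in\mathcal{P}$, $(t,\ell),(t,r),(\ell,b),(r,b)\in\mathrm{Ad}(\mathcal{P})$; (ii) if $t>\ell\ge r>-1$ and $(t,r),(t,\ell)\in\mathrm{Ad}(\mathcal{P})$, then $\mathcal{P}$ contains a quadruple $(t,\ell,r,*)$; (iii) if $t>\ell>r\ge-1$ and $(t,\ell),(t,r)\in\mathrm{Ad}(\mathcal{P})$, then $(\ell,r)\in\mathrm{Ad}(\mathcal{P})$; (iv) $(k+1,k)$ and $(k+1,-1),(k,-1),\dots,(0,-1)$ are in $\mathrm{Ad}(\mathcal{P})$.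 A pair of faces $(x,y)$ is $\mathcal{P}$-admissible if $x>y$ and $(\dim x,\dim y)\in\mathrm{Ad}(\mathcal{P})$. $\mathcal{P}$ is a $k$-intersection profile for $X$ if whenever $(x,y),(x,z)$ are $\mathcal{P}$-admissible with $\dim y\ge\dim z$, either $y\ge z$ or $(\dim x,\dim y,\dim z,\dim u)\in\mathcal{P}$ for every $u\in\mathrm{Inf}\{y,z\}$. **Correction Algorithm.** For $u\in X$ and $g\in C^{k-\dim u-1}(X_u,\mathcal{F}_u)$, let $g^u\in C^k(X,\mathcal{F})$ be $g^u(x)=g(x)$ if $x\ge u$ and $0$ otherwise. Input: $f\in C^k(X,\mathcal{F})$ and a real $q\ge0$. Set $f_0=f$, $i=0$. While there exist $u\in X(0)\cup\dots\cup X(k)$ and $g\in C^{k-\dim u-1}(X_u,\mathcal{F}_u)$ with $\|df_i+d(g^u)\|_w<\|df_i\|_w-q\,w(u)$, choose such a pair, set $f_{i+1}=f_i+g^u$ and increase $i$ by $1$. Output the last $f_i$. -}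

module Defs where

open import Algebra.Bundles using (CommutativeMonoid; CommutativeRing)
import Algebra.Definitions.RawMonoid as RawMonoidOps
open import Algebra.Module.Bundles using (Module)
open import Algebra.Module.Morphism.Structures using (IsModuleHomomorphism)
import Algebra.Properties.Semiring.Exp as Exp
import Algebra.Properties.Semiring.Mult as Mult
open import Axiom.ExcludedMiddle using (ExcludedMiddle)
open import Data.Bool.Base using (if_then_else_)
open import Data.Empty using (⊥-elim-irr)
open import Data.Integer.Base using (ℤ; +_; -1ℤ; 0ℤ; 1ℤ)
import Data.Integer.Base as ℤ
import Data.Integer.Properties as ℤ
open import Data.Integer.Tactic.RingSolver using (solve-∀)
open import Data.Irrelevant using ([_])
open import Data.List.Base using (List; []; _∷_; length; lookup; map; concatMap; filter; upTo)
import Data.List.Extrema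
import Data.List.Extrema.Nat as ℕExtrema
open import Data.List.Membership.Propositional using (_∈_)
open import Data.List.Relation.Unary.All as All using (All; []; _∷_)
open import Data.List.Relation.Unary.AllPairs using ([]; _∷_)
open import Data.List.Relation.Unary.Any using (here; there)
open import Data.List.Relation.Unary.Unique.Propositional using (Unique)
open import Data.Nat.Base using (ℕ)
import Data.Nat.Base as ℕ
open import Data.Product.Base using (∃; ∃₂; _×_; _,_)
open import Data.Refinement using (Refinement; value; value-injective; _,_)
open import Data.Sum.Base using (_⊎_)
open import Function.Base using (_∘_; _∘′_; flip)
open import Induction.WellFounded using (Acc)
open import Level using (Level; _⊔_; suc)
open import Relation.Binary.Bundles using (TotalOrder)
open import Relation.Binary.Construct.Closure.ReflexiveTransitive using (Star)
import Relation.Binary.Construct.NonStrictToStrict as ToStrict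
open import Relation.Binary.Core using (Rel)
open import Relation.Binary.Rewriting using (IsNormalForm)
open import Relation.Binary.PropositionalEquality
  using (_≡_; _≢_; refl; sym; trans; cong; isEquivalence)
open import Relation.Binary.Structures using (IsPartialOrder; IsTotalOrder)
open import Relation.Nullary.Decidable.Core using (yes; no; does; _⊎-dec_)
open import Relation.Nullary.Negation.Core using (¬_)
open import Relation.Unary using (Pred; Decidable; _∪_; ｛_｝; _≐_)

private
  variable
    a ℓ p : Level

-- The real numbers, given by their characterisation (unique up to
-- isomorphism) as the Dedekind-complete ordered field.  The value 0# ⁻¹
-- is unconstrained.

record Reals ℓ : Set (suc ℓ) where
  infix  4 _≤_ _<_
  infix  8 _⁻¹
  infixl 7 _/_
  infixr 8 _^_

  field
    commutativeRing : CommutativeRing ℓ ℓ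

  open CommutativeRing commutativeRing public

  field
    _≤_          : Rel Carrier ℓ
    isTotalOrder : IsTotalOrder _≈_ _≤_
    +-monoˡ-≤    : ∀ z {x y} → x ≤ y → x + z ≤ y + z
    *-nonNeg     : ∀ {x y} → 0# ≤ x → 0# ≤ y → 0# ≤ x * y
    0#≉1#        : ¬ 0# ≈ 1#
    _⁻¹          : Carrier → Carrier
    ⁻¹-cong      : ∀ {x y} → x ≈ y → x ⁻¹ ≈ y ⁻¹
    *-inverseʳ   : ∀ x → ¬ x ≈ 0# → x * x ⁻¹ ≈ 1#

  UpperBound : Pred Carrier ℓ → Pred Carrier ℓ
  UpperBound S u = ∀ s → S s → s ≤ u

  LowerBound : Pred Carrier ℓ → Pred Carrier ℓ
  LowerBound S l = ∀ s → S s → l ≤ s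

  field
    complete : ∀ (S : Pred Carrier ℓ) → ∃ S → ∃ (UpperBound S) →
               ∃ λ u → UpperBound S u × LowerBound (UpperBound S) u

  totalOrder : TotalOrder ℓ ℓ ℓ
  totalOrder = record { isTotalOrder = isTotalOrder }

  _<_ : Rel Carrier ℓ
  _<_ = ToStrict._<_ _≈_ _≤_

  _/_ : Carrier → Carrier → Carrier
  x / y = x * y ⁻¹

  _^_ : Carrier → ℕ → Carrier
  _^_ = Exp._^_ semiring

  fromℕ : ℕ → Carrier
  fromℕ n = Mult._×_ semiring n 1#

  -- c ≤ sup S and c ≤ inf S for extended-real suprema and infima: the
  -- supremum of an unbounded set is ∞, and so is the infimum of ∅.

  _≤sup_ _≤inf_ : Carrier → Pred Carrier ℓ → Set ℓ
  c ≤sup S = LowerBound (UpperBound S) c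
  c ≤inf S = LowerBound S c

record FiniteSet ℓ : Set (suc ℓ) where
  field
    Carrier  : Set ℓ
    elements : List Carrier
    unique   : Unique elements
    complete : ∀ x → x ∈ elements

card : FiniteSet ℓ → ℕ
card S = length (FiniteSet.elements S)

∑ : ∀ {m} (M : CommutativeMonoid m m) (S : FiniteSet a) →
    (FiniteSet.Carrier S → CommutativeMonoid.Carrier M) →
    CommutativeMonoid.Carrier M
∑ M S f = RawMonoidOps.sum (CommutativeMonoid.rawMonoid M) (f ∘′ lookup (FiniteSet.elements S))

module _ {A : Set a} {P : Pred A p} (P? : Decidable P) where

  refineAll : List A → List (Refinement A P)
  refineAll [] = []
  refineAll (x ∷ xs) with P? x
  ... | yes px = (x , [ px ]) ∷ refineAll xs
  ... | no  _  = refineAll xs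

  refineAll-fresh : ∀ {x} {y : Refinement A P} → value y ≡ x →
                    ∀ {xs} → All (x ≢_) xs → All (y ≢_) (refineAll xs)
  refineAll-fresh eq [] = []
  refineAll-fresh eq {z ∷ _} (x≢z ∷ x∉xs) with P? z
  ... | yes _ = (λ y≡z → x≢z (trans (sym eq) (cong value y≡z))) ∷ refineAll-fresh eq x∉xs
  ... | no  _ = refineAll-fresh eq x∉xs

  refineAll-unique : ∀ {xs} → Unique xs → Unique (refineAll xs)
  refineAll-unique [] = []
  refineAll-unique {x ∷ _} (x∉xs ∷ xs!) with P? x
  ... | yes _ = refineAll-fresh refl x∉xs ∷ refineAll-unique xs!
  ... | no  _ = refineAll-unique xs!

  refineAll-complete : ∀ {xs} (y : Refinement A P) → value y ∈ xs → y ∈ refineAll xs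
  refineAll-complete (x , [ px ]) (here refl) with P? x
  ... | yes _  = here refl
  ... | no ¬px = ⊥-elim-irr (¬px px)
  refineAll-complete {z ∷ _} y (there y∈xs) with P? z
  ... | yes _ = there (refineAll-complete y y∈xs)
  ... | no  _ = refineAll-complete y y∈xs

infixl 6 _↾_

_↾_ : (S : FiniteSet a) {P : Pred (FiniteSet.Carrier S) p} → Decidable P → FiniteSet (a ⊔ p)
S ↾ P? = record
  { Carrier  = Refinement S.Carrier _
  ; elements = refineAll P? S.elements
  ; unique   = refineAll-unique P? S.unique
  ; complete = λ y → refineAll-complete P? y (S.complete (value y))
  }
  where module S = FiniteSet S

record GradedPoset ℓ : Set (suc ℓ) where
  infix 4 _≤_ _<_ _⋖_

  field
    faces : FiniteSet ℓ

  open FiniteSet faces public renaming (Carrier to Face)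

  field
    _≤_            : Rel Face ℓ
    isPartialOrder : IsPartialOrder _≡_ _≤_
    dim            : Face → ℤ

  _<_ : Rel Face ℓ
  _<_ = ToStrict._<_ _≡_ _≤_

  _⋖_ : Rel Face ℓ
  x ⋖ y = x < y × ¬ (∃ λ z → x < z × z < y)

  field
    dim-mono : ∀ {x y} → x ≤ y → dim x ℤ.≤ dim y
    dim-⋖    : ∀ {x y} → x ⋖ y → dim y ≡ dim x ℤ.+ 1ℤ

  facesOfDim : ℤ → FiniteSet ℓ
  facesOfDim i = faces ↾ (λ x → dim x ℤ.≟ i)

  -- In a d-poset there is exactly one such face.
  IsEmptyFace : Pred Face ℓ
  IsEmptyFace v = dim v ≡ -1ℤ × (∀ x → v ≤ x)

  Inf : Pred Face ℓ → Pred Face ℓ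
  Inf A u = LB u × (∀ v → LB v → u ≤ v → u ≡ v)
    where
    LB : Pred Face ℓ
    LB v = ∀ x → A x → v ≤ x

record IsDPoset (d : ℕ) (X : GradedPoset ℓ) : Set ℓ where
  open GradedPoset X
  field
    below-d-face : ∀ x → ∃ λ y → dim y ≡ + d × x ≤ y
    emptyFace    : ∃ IsEmptyFace

record AbstractIntersectionProfile ℓ (k : ℕ) : Set (suc ℓ) where
  field
    Quad : ℤ → ℤ → ℤ → ℤ → Set ℓ
    Ad   : ℤ → ℤ → Set ℓ

    Quad-range : ∀ {t l r b} → Quad t l r b →
                 t ℤ.≤ + k ℤ.+ 1ℤ × l ℤ.< t × r ℤ.≤ l × b ℤ.< r × -1ℤ ℤ.≤ b
    Ad-range   : ∀ {i j} → Ad i j → i ℤ.≤ + k ℤ.+ 1ℤ × j ℤ.< i × -1ℤ ℤ.≤ j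

    Quad⇒Ad    : ∀ {t l r b} → Quad t l r b → Ad t l × Ad t r × Ad l b × Ad r b
    Ad⇒Quad    : ∀ {t l r} → l ℤ.< t → r ℤ.≤ l → -1ℤ ℤ.< r →
                 Ad t r → Ad t l → ∃ λ b → Quad t l r b
    Ad-descend : ∀ {t l r} → l ℤ.< t → r ℤ.< l → -1ℤ ℤ.≤ r →
                 Ad t l → Ad t r → Ad l r
    Ad-top     : Ad (+ k ℤ.+ 1ℤ) (+ k)
    Ad-bottom  : ∀ {i} → 0ℤ ℤ.≤ i → i ℤ.≤ + k ℤ.+ 1ℤ → Ad i -1ℤ

_IsProfileFor_ : ∀ {k} → AbstractIntersectionProfile ℓ k → GradedPoset ℓ → Set ℓ
𝒫 IsProfileFor X =
  ∀ x y z → Admissible x y → Admissible x z → dim z ℤ.≤ dim y →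
  z ≤ y ⊎ (∀ u → Inf (｛ y ｝ ∪ ｛ z ｝) u → Quad (dim x) (dim y) (dim z) (dim u))
  where
  open GradedPoset X
  open AbstractIntersectionProfile 𝒫
  Admissible : Rel Face _
  Admissible x y = y < x × Ad (dim x) (dim y)

record Sheaf (R : CommutativeRing ℓ ℓ) (X : GradedPoset ℓ) : Set (suc ℓ) where
  open GradedPoset X
  field
    stalk : Face → Module R ℓ ℓ

  module Stalk (x : Face) = Module (stalk x)

  field
    res     : ∀ {x y} → .(x < y) → Stalk.Carrierᴹ x → Stalk.Carrierᴹ y
    res-hom : ∀ {x y} .(x<y : x < y) →
              IsModuleHomomorphism (Stalk.rawModule x) (Stalk.rawModule y) (res x<y)
    res-∘   : ∀ {x y z} .(x<y : x < y) .(y<z : y < z) .(x<z : x < z) m →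
              Stalk._≈ᴹ_ z (res y<z (res x<y m)) (res x<z m)

-- Excluded middle is used to decide membership in subsets.

module Theory {ℓ} (em : ExcludedMiddle ℓ) (ℝ : Reals ℓ) where

  open Reals ℝ using (0#; 1#; _⁻¹; _/_; fromℕ; _≤sup_; _≤inf_)
    renaming (Carrier to Real)
  private
    module ℝ = Reals ℝ

  infixl 6 _∣_

  _∣_ : (S : FiniteSet ℓ) → Pred (FiniteSet.Carrier S) ℓ → FiniteSet ℓ
  S ∣ P = S ↾ (λ x → em {P x})

  ∑ℝ : (S : FiniteSet ℓ) → (FiniteSet.Carrier S → Real) → Real
  ∑ℝ = ∑ ℝ.+-commutativeMonoid

  -- The infimum as a total function, with value 0# where there is none.
  inf : Pred Real ℓ → Real
  inf S with em {∃ λ m → ℝ.LowerBound S m × ℝ.UpperBound (ℝ.LowerBound S) m}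
  ... | yes (m , _) = m
  ... | no  _       = 0#

  Weight : GradedPoset ℓ → Set ℓ
  Weight X = GradedPoset.Face X → Real

  link : (X : GradedPoset ℓ) → GradedPoset.Face X → GradedPoset ℓ
  link X z = record
    { faces          = faces ∣ (z ≤_)
    ; _≤_            = λ x y → value x ≤ value y
    ; isPartialOrder = record
      { isPreorder = record
        { isEquivalence = isEquivalence
        ; reflexive     = λ eq → reflexive (cong value eq)
        ; trans         = ≤-trans
        }
      ; antisym    = λ x≤y y≤x → value-injective (antisym x≤y y≤x)
      }
    ; dim            = λ x → dim (value x) ℤ.- dim z ℤ.- 1ℤ
    ; dim-mono       = λ x≤y → ℤ.+-monoˡ-≤ (ℤ.- 1ℤ) (ℤ.+-monoˡ-≤ (ℤ.- dim z) (dim-mono x≤y))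
    ; dim-⋖          = λ {x} {y} x⋖y →
        trans (cong (λ n → n ℤ.- dim z ℤ.- 1ℤ) (dim-⋖ (⋖-value {x} {y} x⋖y)))
              (shift (dim (value x)) (dim z))
    }
    where
    open GradedPoset X
    open IsPartialOrder isPartialOrder using (reflexive; antisym) renaming (trans to ≤-trans)

    LinkFace : Set ℓ
    LinkFace = Refinement Face (z ≤_)

    open ToStrict {A = LinkFace} _≡_ (λ x y → value x ≤ value y)
      using () renaming (_<_ to _<ᴸ_)

    ⋖-value : ∀ {x y : LinkFace} → x <ᴸ y × ¬ (∃ λ v → x <ᴸ v × v <ᴸ y) → value x ⋖ value y
    ⋖-value {x , [ z≤x ]} ((x≤y , x≢y) , none) =
      (x≤y , λ eq → x≢y (value-injective eq)) ,
      λ { (v , (x≤v , x≢v) , (v≤y , v≢y)) →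
          none ((v , [ ≤-trans z≤x x≤v ])
               , (x≤v , λ eq → x≢v (cong value eq))
               , (v≤y , λ eq → v≢y (cong value eq))) }

    shift : ∀ m n → (m ℤ.+ 1ℤ) ℤ.- n ℤ.- 1ℤ ≡ (m ℤ.- n ℤ.- 1ℤ) ℤ.+ 1ℤ
    shift = solve-∀

  linkSheaf : ∀ {R X} → Sheaf R X → (z : GradedPoset.Face X) → Sheaf R (link X z)
  linkSheaf {R} {X} ℱ z = record
    { stalk   = λ x → stalk (value x)
    ; res     = λ {x} {y} x<y → res (<-value {x} {y} x<y)
    ; res-hom = λ {x} {y} x<y → res-hom (<-value {x} {y} x<y)
    ; res-∘   = λ {x} {y} {v} x<y y<v x<v →
        res-∘ (<-value {x} {y} x<y) (<-value {y} {v} y<v) (<-value {x} {v} x<v)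
    }
    where
    open Sheaf ℱ
    open GradedPoset X using (_<_)
    open GradedPoset (link X z) using () renaming (Face to Faceᴸ; _<_ to _<ᴸ_)

    <-value : ∀ {x y : Faceᴸ} → x <ᴸ y → value x < value y
    <-value (x≤y , x≢y) = x≤y , λ eq → x≢y (value-injective eq)

  module _ (X : GradedPoset ℓ) where
    open GradedPoset X

    between : Face → ℤ → Face → FiniteSet ℓ
    between x j z = facesOfDim j ∣ (λ y → x ≤ value y × value y ≤ z)

    faceCounts : ℤ → ℤ → ℤ → List ℕ
    faceCounts i j k =
      concatMap (λ x → map (λ z → card (between (value x) j (value (value z))))
                           (FiniteSet.elements (facesOfDim k ∣ (λ z → value x ≤ value z))))
                (FiniteSet.elements (facesOfDim i))

    Fmax Fmin : ℤ → ℤ → ℤ → ℕ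
    Fmax i j k = ℕExtrema.max 0 (faceCounts i j k)
    -- The first argument of min is only a cap for the empty list.
    Fmin i j k = ℕExtrema.min (Fmax i j k) (faceCounts i j k)

    lowerIrregularity : ℕ → Real
    lowerIrregularity d =
      Data.List.Extrema.max ℝ.totalOrder 0#
        (concatMap (λ k →
          concatMap (λ j →
            map (λ i → fromℕ (Fmax i j k) / fromℕ (Fmin i j k))
                (filter (ℤ._≤? j) dims))
            (filter (ℤ._≤? k) dims))
          dims)
      where
      dims : List ℤ
      dims = map (λ n → + n ℤ.- 1ℤ) (upTo (d ℕ.+ 2))

    record IsProperWeight (d : ℕ) (w : Weight X) : Set ℓ where
      field
        positive   : ∀ x → 0# ℝ.< w x
        normalised : ∑ℝ (facesOfDim (+ d)) (w ∘ value) ℝ.≈ 1#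
        induced    : ∀ x → w x ℝ.≈
          ∑ℝ (facesOfDim (+ d) ∣ (λ y → x ≤ value y)) λ y →
            w (value (value y)) /
            fromℕ (card (facesOfDim (dim x) ∣ (λ x′ → value x′ ≤ value (value y))))

    linkWeight : (d : ℕ) → Weight X → (z : Face) → Weight (link X z)
    linkWeight d w z (x , _) =
      ∑ℝ (facesOfDim (+ d) ∣ (λ y → z ≤ value y)) (λ y → w (value (value y))) ⁻¹ ℝ.*
      ∑ℝ (facesOfDim (+ d) ∣ (λ y → x ≤ value y)) (λ y →
        w (value (value y)) / fromℕ (card (between z (dim x) (value (value y)))))

  -- The value [ y ∶ x ] is meaningful only for x ⋖ y.

  record Orientation (R : CommutativeRing ℓ ℓ) (X : GradedPoset ℓ) : Set ℓ where
    open GradedPoset X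
    open CommutativeRing R using (_≈_; _*_; +-commutativeMonoid)
      renaming (Carrier to Rᶜ; 0# to 0ᴿ; 1# to 1ᴿ)
    field
      [_∶_]  : Face → Face → Rᶜ
      unit   : ∀ {x y} → x ⋖ y → ∃ λ r → [ y ∶ x ] * r ≈ 1ᴿ
      cancel : ∀ {x z} → x ≤ z → dim z ≡ dim x ℤ.+ (+ 2) →
               ∑ +-commutativeMonoid (faces ∣ (λ y → x < y × y < z))
                 (λ y → [ z ∶ value y ] * [ value y ∶ x ]) ≈ 0ᴿ

  -- The incidence coefficients are an arbitrary function here, so that
  -- everything applies to X and to its links alike.

  module Cochains {R : CommutativeRing ℓ ℓ} (X : GradedPoset ℓ) (w : Weight X)
                  ([_∶_] : GradedPoset.Face X → GradedPoset.Face X → CommutativeRing.Carrier R)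
                  (ℱ : Sheaf R X) where
    open GradedPoset X
    open Sheaf ℱ

    C : ℤ → Set ℓ
    C i = (x : FiniteSet.Carrier (facesOfDim i)) → Stalk.Carrierᴹ (value x)

    infix  4 _≋_
    infixl 6 _⊕_ _⊖_

    _≋_ : ∀ {i} → Rel (C i) ℓ
    f ≋ g = ∀ x → Stalk._≈ᴹ_ (value x) (f x) (g x)

    𝟎 : ∀ {i} → C i
    𝟎 x = Stalk.0ᴹ (value x)

    _⊕_ _⊖_ : ∀ {i} → C i → C i → C i
    (f ⊕ g) x = Stalk._+ᴹ_ (value x) (f x) (g x)
    (f ⊖ g) x = Stalk._+ᴹ_ (value x) (f x) (Stalk.-ᴹ_ (value x) (g x))

    ‖_‖ : ∀ {i} → C i → Real
    ‖_‖ {i} f = ∑ℝ (facesOfDim i ∣ (λ x → ¬ Stalk._≈ᴹ_ (value x) (f x) (Stalk.0ᴹ (value x))))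
                   (λ x → w (value (value x)))

    dist : ∀ {i} → C i → C i → Real
    dist f g = ‖ f ⊖ g ‖

    distTo : ∀ {i} → C i → Pred (C i) ℓ → Real
    distTo f S = inf (λ r → ∃ λ g → S g × r ℝ.≈ dist f g)

    facet-< : ∀ {x y i} → dim x ≡ i → dim y ≡ i ℤ.+ 1ℤ → x ≤ y → x < y
    facet-< {i = i} dim-x dim-y x≤y = x≤y , λ x≡y →
      ℤ.i≢suc[i] (trans (sym dim-x) (trans (cong dim x≡y) (trans dim-y (ℤ.+-comm i 1ℤ))))

    -- The coboundary is indexed by i and j = i + 1 separately, so that
    -- δ also maps C (i - 1) to C i.
    module _ {i j : ℤ} .(j≡i+1 : j ≡ i ℤ.+ 1ℤ) (f : C i) where

      term : (y : FiniteSet.Carrier (facesOfDim j)) →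
             FiniteSet.Carrier (facesOfDim i ∣ (λ x → value x ≤ value y)) →
             Stalk.Carrierᴹ (value y)
      term (y , [ dim-y ]) ((x , [ dim-x ]) , [ x≤y ]) =
        Stalk._*ₗ_ y [ y ∶ x ] (res (facet-< dim-x (trans dim-y j≡i+1) x≤y) (f (x , [ dim-x ])))

      δ : C j
      δ y = ∑ (Stalk.+ᴹ-commutativeMonoid (value y))
              (facesOfDim i ∣ (λ x → value x ≤ value y)) (term y)

    d : ∀ {i} → C i → C (i ℤ.+ 1ℤ)
    d = δ refl

    Z B : ∀ {i} → Pred (C i) ℓ
    Z f = d f ≋ 𝟎
    B {i} f = ∃ λ (g : C (i ℤ.- 1ℤ)) → f ≋ δ (i≡i-1+1 i) g
      where
      i≡i-1+1 : ∀ i → i ≡ i ℤ.- 1ℤ ℤ.+ 1ℤ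
      i≡i-1+1 = solve-∀

    -- c ≤cse i, c ≤cbe i and c ≤ccd i say that c is at most
    -- cse_i(X,w,ℱ), cbe_i(X,w,ℱ) and ccd_i(X,w,ℱ), which are extended reals.

    _≤cse_ _≤cbe_ _≤ccd_ : Real → ℤ → Set ℓ
    c ≤cse i = c ≤sup λ μ → 0# ℝ.≤ μ × (∀ (f : C i) → μ ℝ.* distTo f Z ℝ.≤ ‖ d f ‖)
    c ≤cbe i = c ≤sup λ μ → 0# ℝ.≤ μ × (∀ (f : C i) → μ ℝ.* distTo f B ℝ.≤ ‖ d f ‖)
    c ≤ccd i = c ≤inf λ r → ∃ λ (f : C i) → Z f × ¬ B f × r ℝ.≈ ‖ f ‖

  record RelatedWeightedHypergraph : Set (suc ℓ) where
    field
      vertices hyperedges : FiniteSet ℓ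

    open FiniteSet vertices public using () renaming (Carrier to Vertex)
    open FiniteSet hyperedges public using () renaming (Carrier to Hyperedge)

    field
      _∈ᴴ_ : Vertex → Hyperedge → Set ℓ
      wⱽ   : Vertex → Real
      wᴱ   : Hyperedge → Real
      _∼_  : Rel Vertex ℓ

    E₂ : Pred Vertex ℓ → Pred Hyperedge ℓ
    E₂ A e = ∃₂ λ u v → A u × A v × u ∈ᴴ e × v ∈ᴴ e × u ≢ v × u ∼ v

    IsSkeletonExpander : Real → Real → Set (suc ℓ)
    IsSkeletonExpander α β = ∀ (A : Pred Vertex ℓ) →
      let wA = ∑ℝ (vertices ∣ A) (wⱽ ∘ value) in
      ∑ℝ (hyperedges ∣ E₂ A) (wᴱ ∘ value) ℝ.≤ α ℝ.* wA ℝ.+ β ℝ.* (wA ℝ.* wA)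

  open RelatedWeightedHypergraph public using (IsSkeletonExpander)

  NIH : (i j k : ℤ) (X : GradedPoset ℓ) → Weight X → RelatedWeightedHypergraph
  NIH i j k X w = record
    { vertices   = faces ↾ (λ x → (dim x ℤ.≟ i) ⊎-dec (dim x ℤ.≟ j))
    ; hyperedges = facesOfDim k
    ; _∈ᴴ_       = λ x z → value x ≤ value z
    ; wⱽ         = λ x → if does (i ℤ.≟ j) then w (value x) else (1# / fromℕ 2) ℝ.* w (value x)
    ; wᴱ         = λ z → w (value z)
    ; _∼_        = λ (x , _) (y , _) →
        (∃ λ (z : FiniteSet.Carrier (facesOfDim k)) → x ≤ value z × y ≤ value z) ×
        Inf (｛ x ｝ ∪ ｛ y ｝) ≐ IsEmptyFace ×
        ((dim x ≡ i × dim y ≡ j) ⊎ (dim x ≡ j × dim y ≡ i))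
    }
    where open GradedPoset X

  module WeightedSheaf {R : CommutativeRing ℓ ℓ} (dimX : ℕ) (X : GradedPoset ℓ) (w : Weight X)
                       (orientation : Orientation R X) (ℱ : Sheaf R X) where
    open GradedPoset X
    open Orientation orientation
    open Sheaf ℱ using (module Stalk)
    open Cochains X w [_∶_] ℱ public

    module Link (u : Face) =
      Cochains (link X u) (linkWeight X dimX w u) (λ y x → [ value y ∶ value x ]) (linkSheaf ℱ u)

    _≤cbe[_]_ : Real → Face → ℤ → Set ℓ
    c ≤cbe[ u ] i = Link._≤cbe_ u c i

    NIHᴸ : (u : Face) (i j k : ℤ) → RelatedWeightedHypergraph
    NIHᴸ u i j k =
      NIH (i ℤ.- dim u ℤ.- 1ℤ) (j ℤ.- dim u ℤ.- 1ℤ) (k ℤ.- dim u ℤ.- 1ℤ)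
          (link X u) (linkWeight X dimX w u)

    extend : ∀ {k} (u : Face) → Link.C u (k ℤ.- dim u ℤ.- 1ℤ) → C k
    extend u g (x , [ dim-x ]) with em {u ≤ x}
    ... | yes u≤x = g ((x , [ u≤x ]) , [ cong (λ n → n ℤ.- dim u ℤ.- 1ℤ) dim-x ])
    ... | no  _   = Stalk.0ᴹ x

    CorrectionStep : ∀ {k} → Real → Rel (C k) ℓ
    CorrectionStep {k} q f f′ =
      ∃ λ u → 0ℤ ℤ.≤ dim u × dim u ℤ.≤ k ×
      ∃ λ (g : Link.C u (k ℤ.- dim u ℤ.- 1ℤ)) →
        ‖ d f ⊕ d (extend {k} u g) ‖ ℝ.< ‖ d f ‖ ℝ.- q ℝ.* w u × f′ ≋ f ⊕ extend u g

    -- Whatever choices are made, the Correction Algorithm applied to f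
    -- halts, and its output satisfies Q.
    CorrectionReturns : ∀ {k} → Real → C k → Pred (C k) ℓ → Set ℓ
    CorrectionReturns q f Q =
      Acc (flip (CorrectionStep q)) f ×
      (∀ f′ → Star (CorrectionStep q) f f′ → IsNormalForm (CorrectionStep q) f′ → Q f′)

{-# OPTIONS --safe #-}

-- Let f be a cocycle of degree n that is locally minimal, and let A be its support.  An n-face is heavy
-- if it lies in A; descending to dimension 0, a face v is heavy if the heavy faces above it have total
-- p-weight at least p v, where p x = η ^ (2 ^ (n - dim x) - 1) * w x and η = K ε.  The heavy faces have
-- total p-weight O(w A), so for small w A the empty face would not be heavy either.  An (n + 1)-face is
-- bad if two heavy faces inside it meet, within a quadruple of the profile, in a face that is not heavy;
-- skeleton expansion bounds the weight of the bad faces by O(η * w A).  Below an (n + 1)-face that is not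
-- bad, the steps from a face to a smaller admissible heavy face are locally confluent, which is what the
-- axioms of intersection profiles are for.  By Newman's lemma all faces of A inside it thus descend to
-- the same terminal heavy face u, so the part of f that descends to u has its coboundary supported on
-- bad faces.  That part is locally minimal too, and coboundary expansion in the link of u bounds ε times
-- its weight by the weight of the bad faces above u.  Summing over u gives w A ≤ O(K) * w A, hence f = 0
-- if K is small.
--
-- With f of least weight in its class (n = k) this bounds ccd.  With f the coboundary of an output of the
-- Correction Algorithm (n = k + 1) it shows that the output is a cocycle; its distance to the input is
-- at most a constant multiple of the decrease of the weight of the coboundary, divided by q.

module Submission where

open import Algebra.Bundles using (CommutativeRing; CommutativeMonoid)
open import Algebra.Definitions.RawMonoid using (sum)
open import Algebra.Module.Bundles using (Module)
open import Algebra.Module.Morphism.Structures using (IsModuleHomomorphism)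
import Algebra.Properties.Group as GroupProperties
import Algebra.Properties.Ring as RingProperties
import Algebra.Properties.Semiring.Exp as Exp
import Algebra.Solver.Ring.NaturalCoefficients.Default as NatSolver
open import Axiom.ExcludedMiddle using (ExcludedMiddle)
open import Data.Bool.Base using (if_then_else_)
open import Data.Empty using (⊥)
import Data.Integer.Base as ℤ
open import Data.Integer.Base using (ℤ; +_; 0ℤ; 1ℤ; -1ℤ)
import Data.Integer.Properties as ℤ
open import Data.Integer.Tactic.RingSolver using (solve-∀)
open import Data.Irrelevant using ([_])
open import Data.List.Base using (List; []; _∷_; _++_; length; lookup; map; upTo)
import Data.List.Extrema
import Data.List.Extrema.Nat as ℕExtrema
open import Data.List.Membership.Propositional using (_∈_; lose)
open import Data.List.Membership.Propositional.Properties
  using (∈-map⁺; ∈-++⁺ˡ; ∈-++⁺ʳ; ∈-map⁻; ∈-concatMap⁺; ∈-concatMap⁻; ∈-upTo⁺; ∈-filter⁺)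
open import Data.List.Properties using (length-map; length-upTo)
open import Data.List.Relation.Unary.All as All using (All; []; _∷_)
open import Data.List.Relation.Unary.AllPairs using ([]; _∷_)
open import Data.List.Relation.Unary.Any using (here; there; _─_; satisfied)
open import Data.List.Relation.Unary.Unique.Propositional using (Unique)
import Data.List.Relation.Unary.Unique.Propositional.Properties as Unique
import Data.Nat.Base as ℕ
open import Data.Nat.Base using (ℕ; zero; suc; z≤n; s≤s)
open import Data.Nat.Induction using (<-wellFounded)
import Data.Nat.Properties as ℕ
import Data.Nat.Tactic.RingSolver as ℕ-Solver
open import Data.Product.Base using (∃; ∃₂; _×_; _,_; proj₁; proj₂)
open import Data.Refinement using (value; value-injective; _,_)
import Data.Sum.Base as Sum
open import Data.Sum.Base using (_⊎_; inj₁; inj₂; [_,_]′)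
open import Function.Base using (_∘_; id; const; flip)
open import Induction.WellFounded using (WellFounded; Acc; acc; module Subrelation)
import Level
open import Level using (Level; _⊔_)
open import Relation.Binary.Bundles using (TotalOrder; Poset)
open import Relation.Binary.Construct.Closure.ReflexiveTransitive using (Star; ε; _◅_)
open import Relation.Binary.Construct.Closure.Transitive using (Plus; [_]; _∼⁺⟨_⟩_)
import Relation.Binary.Construct.On as On
open import Relation.Binary.Core using (Rel)
open import Relation.Binary.PropositionalEquality as ≡ using (_≡_; _≢_)
import Relation.Binary.Reasoning.PartialOrder as PartialOrderReasoning
open import Relation.Binary.Rewriting
  using (IsNormalForm; WeaklyConfluent; Confluent; sn&wcr⇒cr; WeaklyNormalizing)
open import Relation.Binary.Structures using (IsTotalOrder; IsPartialOrder)
open import Relation.Nullary.Decidable.Core using (Dec; yes; no; recompute; does; _⊎-dec_)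
open import Relation.Nullary.Negation.Core using (¬_; contradiction)
open import Relation.Unary using (Pred; Decidable; _∪_; ｛_｝)
open import Defs

-- Ordered fields

-- The obstacle is the quadratic term of skeleton expansion. Near a light face `v` it is harmless
-- because lightness bounds the heavy p-weight above `v` by `θ (dim v) * w v`. That threshold must
-- absorb `β`, leave one factor `η`, and pay for two factors `θ r`, since the faces that meet have
-- p-weight at least `θ r` times their weight. The exponents `2 ^ (n - dim) - 1` solve the resulting
-- recursion, with equality for n = k and room to spare for n = k + 1.
--
-- Local minimality is required only up to an error `q * w u` at each face `u`. A cochain of least
-- weight in its class has `q = 0`, while an output of the Correction Algorithm is minimal only up
-- to the parameter of the algorithm. Summed over the terminal faces, which have dimension at least
-- 0, this error stays below `K` times the heavy p-weight as soon as `q ≤ K * θ 0ℤ`; this is where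
-- the parameter comes from.
--
-- Coboundary expansion in links costs a factor `ε`, which the bad faces return through `η = K ε`
-- and the error through its own factor `ε`. Hence `K` alone has to beat the constants,
-- independently of `ε`.

module OrderedField {ℓ} (ℝ : Reals ℓ) where

  open Reals ℝ hiding (complete; _-_) public
  open IsTotalOrder isTotalOrder public using (total; antisym)
    renaming (refl to ≤-refl; reflexive to ≤-reflexive; trans to ≤-trans)
  open RingProperties ring public using (-‿distribʳ-*)

  ≤-poset : Poset ℓ ℓ ℓ
  ≤-poset = TotalOrder.poset totalOrder

  module ≤R = PartialOrderReasoning ≤-poset
  module Solver = NatSolver commutativeSemiring

  infixl 6 _-_
  _-_ : Carrier → Carrier → Carrier
  x - y = x + (- y)

  +-mono-≤ : ∀ {x y u v} → x ≤ y → u ≤ v → x + u ≤ y + v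
  +-mono-≤ {x} {y} {u} {v} x≤y u≤v = begin
    x + u ≤⟨ +-monoˡ-≤ u x≤y ⟩
    y + u ≈⟨ +-comm y u ⟩
    u + y ≤⟨ +-monoˡ-≤ y u≤v ⟩
    v + y ≈⟨ +-comm v y ⟩
    y + v ∎
    where open ≤R

  +-monoʳ-≤ : ∀ z {x y} → x ≤ y → z + x ≤ z + y
  +-monoʳ-≤ z = +-mono-≤ ≤-refl

  x+y-y : ∀ x y → x + y - y ≈ x
  x+y-y x y = trans (+-assoc x y (- y)) (trans (+-congˡ (-‿inverseʳ y)) (+-identityʳ x))

  x-y+y : ∀ x y → x - y + y ≈ x
  x-y+y x y = trans (+-assoc x (- y) y) (trans (+-congˡ (-‿inverseˡ y)) (+-identityʳ x))

  +-cancelʳ-≤ : ∀ z {x y} → x + z ≤ y + z → x ≤ y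
  +-cancelʳ-≤ z {x} {y} h = begin
    x         ≈⟨ x+y-y x z ⟨
    x + z - z ≤⟨ +-monoˡ-≤ (- z) h ⟩
    y + z - z ≈⟨ x+y-y y z ⟩
    y         ∎
    where open ≤R

  x≤x+y : ∀ {x y} → 0# ≤ y → x ≤ x + y
  x≤x+y {x} {y} 0≤y = begin
    x      ≈⟨ +-identityʳ x ⟨
    x + 0# ≤⟨ +-monoʳ-≤ x 0≤y ⟩
    x + y  ∎
    where open ≤R

  x≤y+x : ∀ {x y} → 0# ≤ y → x ≤ y + x
  x≤y+x {x} {y} 0≤y = ≤-trans (x≤x+y 0≤y) (≤-reflexive (+-comm x y))

  +-nonNeg : ∀ {x y} → 0# ≤ x → 0# ≤ y → 0# ≤ x + y
  +-nonNeg 0≤x 0≤y = ≤-trans 0≤x (x≤x+y 0≤y)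

  x≤y+z⇒x-z≤y : ∀ {x y z} → x ≤ y + z → x - z ≤ y
  x≤y+z⇒x-z≤y {x} {y} {z} h = +-cancelʳ-≤ z (≤-trans (≤-reflexive (x-y+y x z)) h)

  x-z≤y⇒x≤y+z : ∀ {x y z} → x - z ≤ y → x ≤ y + z
  x-z≤y⇒x≤y+z {x} {y} {z} h = ≤-trans (≤-reflexive (sym (x-y+y x z))) (+-monoˡ-≤ z h)

  <⇒≤ : ∀ {x y} → x < y → x ≤ y
  <⇒≤ = proj₁

  <⇒≱ : ∀ {x y} → x < y → ¬ y ≤ x
  <⇒≱ (x≤y , x≉y) y≤x = x≉y (antisym x≤y y≤x)

  ≰⇒> : ∀ {x y} → ¬ x ≤ y → y < x
  ≰⇒> {x} {y} x≰y with total x y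
  ... | inj₁ x≤y = contradiction x≤y x≰y
  ... | inj₂ y≤x = y≤x , λ y≈x → x≰y (≤-reflexive (sym y≈x))

  <-≤-trans : ∀ {x y z} → x < y → y ≤ z → x < z
  <-≤-trans x<y y≤z =
    ≤-trans (<⇒≤ x<y) y≤z , λ x≈z → <⇒≱ x<y (≤-trans y≤z (≤-reflexive (sym x≈z)))

  ≤-<-trans : ∀ {x y z} → x ≤ y → y < z → x < z
  ≤-<-trans x≤y y<z =
    ≤-trans x≤y (<⇒≤ y<z) , λ x≈z → <⇒≱ y<z (≤-trans (≤-reflexive (sym x≈z)) x≤y)

  >0⇒≉0 : ∀ {x} → 0# < x → ¬ x ≈ 0#
  >0⇒≉0 (_ , 0≉x) x≈0 = 0≉x (sym x≈0)

  *-monoˡ-≤ : ∀ {c x y} → 0# ≤ c → x ≤ y → c * x ≤ c * y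
  *-monoˡ-≤ {c} {x} {y} 0≤c x≤y = +-cancelʳ-≤ (c * - x) (begin
    c * x + c * - x ≈⟨ distribˡ c x (- x) ⟨
    c * (x - x)     ≈⟨ *-congˡ (-‿inverseʳ x) ⟩
    c * 0#          ≈⟨ zeroʳ c ⟩
    0#
      ≤⟨ *-nonNeg 0≤c (≤-trans (≤-reflexive (sym (-‿inverseʳ x))) (+-monoˡ-≤ (- x) x≤y)) ⟩
    c * (y - x)     ≈⟨ distribˡ c y (- x) ⟩
    c * y + c * - x ∎)
    where open ≤R

  *-monoʳ-≤ : ∀ {c x y} → 0# ≤ c → x ≤ y → x * c ≤ y * c
  *-monoʳ-≤ {c} {x} {y} 0≤c x≤y = begin
    x * c ≈⟨ *-comm x c ⟩
    c * x ≤⟨ *-monoˡ-≤ 0≤c x≤y ⟩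
    c * y ≈⟨ *-comm c y ⟩
    y * c ∎
    where open ≤R

  *-mono-≤ : ∀ {x y u v} → 0# ≤ x → 0# ≤ v → x ≤ y → u ≤ v → x * u ≤ y * v
  *-mono-≤ 0≤x 0≤v x≤y u≤v = ≤-trans (*-monoˡ-≤ 0≤x u≤v) (*-monoʳ-≤ 0≤v x≤y)

  0≤1 : 0# ≤ 1#
  0≤1 with total 0# 1#
  ... | inj₁ h = h
  ... | inj₂ 1≤0 = begin
    0#             ≤⟨ *-nonNeg 0≤-1 0≤-1 ⟩
    - 1# * - 1#    ≈⟨ -‿distribʳ-* (- 1#) 1# ⟨
    - (- 1# * 1#)  ≈⟨ -‿cong (*-identityʳ (- 1#)) ⟩
    - - 1#         ≈⟨ RingProperties.-‿involutive ring 1# ⟩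
    1#             ∎
    where
    open ≤R
    0≤-1 : 0# ≤ - 1#
    0≤-1 = ≤-trans (≤-reflexive (sym (-‿inverseʳ 1#)))
             (≤-trans (+-monoˡ-≤ (- 1#) 1≤0) (≤-reflexive (+-identityˡ (- 1#))))

  0<1 : 0# < 1#
  0<1 = 0≤1 , 0#≉1#

  *-inverseˡ : ∀ x → ¬ x ≈ 0# → x ⁻¹ * x ≈ 1#
  *-inverseˡ x x≉0 = trans (*-comm (x ⁻¹) x) (*-inverseʳ x x≉0)

  *-pos : ∀ {x y} → 0# < x → 0# < y → 0# < x * y
  *-pos {x} {y} 0<x 0<y = *-nonNeg (<⇒≤ 0<x) (<⇒≤ 0<y) , λ 0≈xy → >0⇒≉0 0<y (begin
    y               ≈⟨ *-identityˡ y ⟨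
    1# * y          ≈⟨ *-congʳ (*-inverseˡ x (>0⇒≉0 0<x)) ⟨
    x ⁻¹ * x * y    ≈⟨ *-assoc (x ⁻¹) x y ⟩
    x ⁻¹ * (x * y)  ≈⟨ *-congˡ 0≈xy ⟨
    x ⁻¹ * 0#       ≈⟨ zeroʳ (x ⁻¹) ⟩
    0#              ∎)
    where open import Relation.Binary.Reasoning.Setoid setoid

  ⁻¹-pos : ∀ {x} → 0# < x → 0# < x ⁻¹
  ⁻¹-pos {x} 0<x = ≰⇒> λ x⁻¹≤0 → <⇒≱ 0<1 (begin
    1#        ≈⟨ *-inverseʳ x (>0⇒≉0 0<x) ⟨
    x * x ⁻¹  ≤⟨ *-monoˡ-≤ (<⇒≤ 0<x) x⁻¹≤0 ⟩
    x * 0#    ≈⟨ zeroʳ x ⟩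
    0#        ∎)
    where open ≤R

  x⁻¹*xy : ∀ {x} y → 0# < x → x ⁻¹ * (x * y) ≈ y
  x⁻¹*xy {x} y 0<x =
    trans (sym (*-assoc _ _ _)) (trans (*-congʳ (*-inverseˡ x (>0⇒≉0 0<x))) (*-identityˡ y))

  x*x⁻¹y : ∀ {x} y → 0# < x → x * (x ⁻¹ * y) ≈ y
  x*x⁻¹y {x} y 0<x =
    trans (sym (*-assoc _ _ _)) (trans (*-congʳ (*-inverseʳ x (>0⇒≉0 0<x))) (*-identityˡ y))

  *-cancelˡ-≤ : ∀ {c x y} → 0# < c → c * x ≤ c * y → x ≤ y
  *-cancelˡ-≤ {c} {x} {y} 0<c h = begin
    x              ≈⟨ x⁻¹*xy x 0<c ⟨
    c ⁻¹ * (c * x) ≤⟨ *-monoˡ-≤ (<⇒≤ (⁻¹-pos 0<c)) h ⟩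
    c ⁻¹ * (c * y) ≈⟨ x⁻¹*xy y 0<c ⟩
    y              ∎
    where open ≤R

  x≤c*y⇒c⁻¹*x≤y : ∀ {c x y} → 0# < c → x ≤ c * y → c ⁻¹ * x ≤ y
  x≤c*y⇒c⁻¹*x≤y 0<c h = *-cancelˡ-≤ 0<c (≤-trans (≤-reflexive (x*x⁻¹y _ 0<c)) h)

  c⁻¹*x≤y⇒x≤c*y : ∀ {c x y} → 0# < c → c ⁻¹ * x ≤ y → x ≤ c * y
  c⁻¹*x≤y⇒x≤c*y {c} {x} {y} 0<c h =
    ≤-trans (≤-reflexive (sym (x*x⁻¹y x 0<c))) (*-monoˡ-≤ (<⇒≤ 0<c) h)

  c*x≤y⇒x≤c⁻¹*y : ∀ {c x y} → 0# < c → c * x ≤ y → x ≤ c ⁻¹ * y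
  c*x≤y⇒x≤c⁻¹*y 0<c h = *-cancelˡ-≤ 0<c (≤-trans h (≤-reflexive (sym (x*x⁻¹y _ 0<c))))

  x≤c⁻¹*y⇒c*x≤y : ∀ {c x y} → 0# < c → x ≤ c ⁻¹ * y → c * x ≤ y
  x≤c⁻¹*y⇒c*x≤y {c} {x} {y} 0<c h =
    ≤-trans (*-monoˡ-≤ (<⇒≤ 0<c) h) (≤-reflexive (x*x⁻¹y y 0<c))

  ⁻¹≤1 : ∀ {x} → 1# ≤ x → x ⁻¹ ≤ 1#
  ⁻¹≤1 {x} 1≤x = ≤-trans (≤-reflexive (sym (*-identityʳ _)))
    (x≤c*y⇒c⁻¹*x≤y (<-≤-trans 0<1 1≤x) (≤-trans 1≤x (≤-reflexive (sym (*-identityʳ x)))))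

  x≤c*x : ∀ {c x} → 1# ≤ c → 0# ≤ x → x ≤ c * x
  x≤c*x {c} {x} 1≤c 0≤x = ≤-trans (≤-reflexive (sym (*-identityˡ x))) (*-monoʳ-≤ 0≤x 1≤c)

  c*x≤x : ∀ {c x} → c ≤ 1# → 0# ≤ x → c * x ≤ x
  c*x≤x {c} {x} c≤1 0≤x = ≤-trans (*-monoʳ-≤ 0≤x c≤1) (≤-reflexive (*-identityˡ x))

  *-≤1 : ∀ {x y} → 0# ≤ y → x ≤ 1# → y ≤ 1# → x * y ≤ 1#
  *-≤1 0≤y x≤1 y≤1 = ≤-trans (c*x≤x x≤1 0≤y) y≤1

  *-≥1 : ∀ {x y} → 1# ≤ x → 1# ≤ y → 1# ≤ x * y
  *-≥1 1≤x 1≤y = ≤-trans 1≤y (x≤c*x 1≤x (≤-trans 0≤1 1≤y))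

  ^-homo-* : ∀ x m n → x ^ (m ℕ.+ n) ≈ x ^ m * x ^ n
  ^-homo-* = Exp.^-homo-* semiring

  ^-pos : ∀ {x} n → 0# < x → 0# < x ^ n
  ^-pos zero    0<x = 0<1
  ^-pos (suc n) 0<x = *-pos 0<x (^-pos n 0<x)

  ^-≤1 : ∀ {x} n → 0# < x → x ≤ 1# → x ^ n ≤ 1#
  ^-≤1 zero    0<x x≤1 = ≤-refl
  ^-≤1 (suc n) 0<x x≤1 = *-≤1 (<⇒≤ (^-pos n 0<x)) x≤1 (^-≤1 n 0<x x≤1)

  ^-≥1 : ∀ {x} n → 1# ≤ x → 1# ≤ x ^ n
  ^-≥1 zero    1≤x = ≤-refl
  ^-≥1 (suc n) 1≤x = *-≥1 1≤x (^-≥1 n 1≤x)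

  ^-antitone : ∀ {x m n} → 0# < x → x ≤ 1# → m ℕ.≤ n → x ^ n ≤ x ^ m
  ^-antitone {n = n} 0<x x≤1 z≤n       = ^-≤1 n 0<x x≤1
  ^-antitone         0<x x≤1 (s≤s m≤n) = *-monoˡ-≤ (<⇒≤ 0<x) (^-antitone 0<x x≤1 m≤n)

  ^-monotone : ∀ {x m n} → 1# ≤ x → m ℕ.≤ n → x ^ m ≤ x ^ n
  ^-monotone {n = n} 1≤x z≤n       = ^-≥1 n 1≤x
  ^-monotone         1≤x (s≤s m≤n) = *-monoˡ-≤ (≤-trans 0≤1 1≤x) (^-monotone 1≤x m≤n)

  0≤fromℕ : ∀ n → 0# ≤ fromℕ n
  0≤fromℕ zero    = ≤-refl
  0≤fromℕ (suc n) = +-nonNeg 0≤1 (0≤fromℕ n)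

  fromℕ-mono : ∀ {m n} → m ℕ.≤ n → fromℕ m ≤ fromℕ n
  fromℕ-mono {n = n} z≤n = 0≤fromℕ n
  fromℕ-mono (s≤s m≤n)   = +-monoʳ-≤ 1# (fromℕ-mono m≤n)

  1≤fromℕ : ∀ {n} → 1 ℕ.≤ n → 1# ≤ fromℕ n
  1≤fromℕ 1≤n = ≤-trans (≤-reflexive (sym (+-identityʳ 1#))) (fromℕ-mono 1≤n)

  -- The set of lower bounds has a supremum, since any member of `S` bounds it from above; that
  -- supremum is again a lower bound.
  infimum : ∀ (S : Carrier → Set ℓ) → ∃ S → ∃ (LowerBound S) →
            ∃ λ m → LowerBound S m × UpperBound (LowerBound S) m
  infimum S (s , s∈S) (l , l≤S) =
    let m , upper , least = Reals.complete ℝ (LowerBound S) (l , l≤S) (s , λ b b≤S → b≤S s s∈S)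
    in m , (λ x x∈S → least x λ b b≤S → b≤S x x∈S) , upper

-- Removal of one entry from a list.

module _ {a} {A : Set a} where

  ∈-─⁻ : ∀ {x y : A} {xs} (p : y ∈ xs) → x ∈ (xs ─ p) → x ∈ xs
  ∈-─⁻ (here _)  q         = there q
  ∈-─⁻ (there p) (here q)  = here q
  ∈-─⁻ (there p) (there q) = there (∈-─⁻ p q)

  ∈-─⁺ : ∀ {x y : A} {xs} (p : y ∈ xs) → x ≢ y → x ∈ xs → x ∈ (xs ─ p)
  ∈-─⁺ (here ≡.refl) x≢y (here x≡y) = contradiction x≡y x≢y
  ∈-─⁺ (here _)      x≢y (there q)  = q
  ∈-─⁺ (there p)     x≢y (here q)   = here q
  ∈-─⁺ (there p)     x≢y (there q)  = there (∈-─⁺ p x≢y q)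

  All-─ : ∀ {p} {P : Pred A p} {y : A} {xs} (q : y ∈ xs) → All P xs → All P (xs ─ q)
  All-─ (here _)  (_ ∷ ps) = ps
  All-─ (there q) (p ∷ ps) = p ∷ All-─ q ps

  Unique-─ : ∀ {y : A} {xs} (q : y ∈ xs) → Unique xs → Unique (xs ─ q)
  Unique-─ (here _)  (_ ∷ xs!)    = xs!
  Unique-─ (there q) (x∉xs ∷ xs!) = All-─ q x∉xs ∷ Unique-─ q xs!

  ─-fresh : ∀ {y : A} {xs} (q : y ∈ xs) → Unique xs → All (y ≢_) (xs ─ q)
  ─-fresh (here ≡.refl) (x∉xs ∷ _)   = x∉xs
  ─-fresh (there q)     (x∉xs ∷ xs!) = (All.lookup x∉xs q ∘ ≡.sym) ∷ ─-fresh q xs!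

-- Sums over finite sets

module Summation {m} (M : CommutativeMonoid m m) where

  open CommutativeMonoid M renaming (_∙_ to _+_; ε to 0#)
  open import Relation.Binary.Reasoning.Setoid setoid
  open import Algebra.Properties.CommutativeSemigroup commutativeSemigroup
    using (interchange; x∙yz≈y∙xz)

  module _ {a} {A : Set a} where

    sumL : List A → (A → Carrier) → Carrier
    sumL []       h = 0#
    sumL (x ∷ xs) h = h x + sumL xs h

    sum-lookup : ∀ xs (h : A → Carrier) → sum rawMonoid (h ∘ lookup xs) ≈ sumL xs h
    sum-lookup []       h = refl
    sum-lookup (x ∷ xs) h = ∙-congˡ (sum-lookup xs h)

    sumL-cong : ∀ {g h : A → Carrier} xs → (∀ x → g x ≈ h x) → sumL xs g ≈ sumL xs h
    sumL-cong []       g≈h = refl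
    sumL-cong (x ∷ xs) g≈h = ∙-cong (g≈h x) (sumL-cong xs g≈h)

    sumL-zero : ∀ {h : A → Carrier} xs → (∀ x → x ∈ xs → h x ≈ 0#) → sumL xs h ≈ 0#
    sumL-zero []       h≈0 = refl
    sumL-zero (x ∷ xs) h≈0 =
      trans (∙-cong (h≈0 x (here ≡.refl)) (sumL-zero xs λ y → h≈0 y ∘ there)) (identityˡ 0#)

    sumL-+ : ∀ (g h : A → Carrier) xs → sumL xs (λ x → g x + h x) ≈ sumL xs g + sumL xs h
    sumL-+ g h []       = sym (identityˡ 0#)
    sumL-+ g h (x ∷ xs) = trans (∙-congˡ (sumL-+ g h xs)) (interchange _ _ _ _)

    sumL-remove : ∀ (h : A → Carrier) {y xs} (p : y ∈ xs) → sumL xs h ≈ h y + sumL (xs ─ p) h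
    sumL-remove h (here ≡.refl)      = refl
    sumL-remove h {xs = x ∷ xs} (there p) =
      trans (∙-congˡ (sumL-remove h p)) (x∙yz≈y∙xz _ _ _)

    -- The entries of `ys` are removed from `xs` one at a time, and what is left over contributes
    -- zero. As neither list repeats an entry, the order of enumeration is irrelevant.
    sumL-⊆ : ∀ (h : A → Carrier) {xs} ys → Unique xs → Unique ys → All (_∈ xs) ys →
             (∀ x → x ∈ xs → x ∈ ys ⊎ h x ≈ 0#) → sumL ys h ≈ sumL xs h
    sumL-⊆ h {xs} [] xs! _ _ outside = sym (sumL-zero xs λ x x∈xs → from (outside x x∈xs))
      where
      from : ∀ {x} → x ∈ [] ⊎ h x ≈ 0# → h x ≈ 0#
      from (inj₂ h≈0) = h≈0
    sumL-⊆ h {xs} (y ∷ ys) xs! (y∉ys ∷ ys!) (y∈xs ∷ ys⊆xs) outside = begin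
      h y + sumL ys h
        ≈⟨ ∙-congˡ (sumL-⊆ h ys (Unique-─ y∈xs xs!) ys! ys⊆ outside′) ⟩
      h y + sumL (xs ─ y∈xs) h
        ≈⟨ sumL-remove h y∈xs ⟨
      sumL xs h ∎
      where
      ys⊆ : All (_∈ (xs ─ y∈xs)) ys
      ys⊆ = All.zipWith (λ (y≢x , x∈xs) → ∈-─⁺ y∈xs (y≢x ∘ ≡.sym) x∈xs) (y∉ys , ys⊆xs)
      outside′ : ∀ x → x ∈ (xs ─ y∈xs) → x ∈ ys ⊎ h x ≈ 0#
      outside′ x x∈ with outside x (∈-─⁻ y∈xs x∈)
      ... | inj₁ (here ≡.refl) = contradiction ≡.refl (All.lookup (─-fresh y∈xs xs!) x∈)
      ... | inj₁ (there x∈ys)  = inj₁ x∈ys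
      ... | inj₂ h≈0           = inj₂ h≈0

  sumL-map : ∀ {a b} {A : Set a} {B : Set b} (e : A → B) (h : B → Carrier) xs →
             sumL (map e xs) h ≈ sumL xs (h ∘ e)
  sumL-map e h []       = refl
  sumL-map e h (x ∷ xs) = ∙-congˡ (sumL-map e h xs)

  sumL-swap : ∀ {a b} {A : Set a} {B : Set b} (h : A → B → Carrier) xs ys →
              sumL xs (λ x → sumL ys (h x)) ≈ sumL ys (λ y → sumL xs (λ x → h x y))
  sumL-swap h []       ys = sym (sumL-zero ys λ _ _ → refl)
  sumL-swap h (x ∷ xs) ys = trans (∙-congˡ (sumL-swap h xs ys)) (sym (sumL-+ (h x) _ ys))

  -- The sums in the definitions run over differently nested refinements of the set of faces.
  -- Reading each of them along an injection into one fixed set, with zero terms outside the image,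
  -- makes them comparable.
  ∑-embed : ∀ {a b} (S : FiniteSet a) (T : FiniteSet b)
            (e : FiniteSet.Carrier S → FiniteSet.Carrier T) →
            (∀ {s s′} → e s ≡ e s′ → s ≡ s′) →
            (g : FiniteSet.Carrier S → Carrier) (h : FiniteSet.Carrier T → Carrier) →
            (∀ s → g s ≈ h (e s)) → (∀ t → (∃ λ s → e s ≡ t) ⊎ h t ≈ 0#) →
            ∑ M S g ≈ sumL (FiniteSet.elements T) h
  ∑-embed S T e e-inj g h g≈h outside = begin
    ∑ M S g                               ≈⟨ sum-lookup S.elements g ⟩
    sumL S.elements g                     ≈⟨ sumL-cong S.elements g≈h ⟩
    sumL S.elements (h ∘ e)               ≈⟨ sumL-map e h S.elements ⟨
    sumL (map e S.elements) h             ≈⟨ sumL-⊆ h (map e S.elements) T.unique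
                                               (Unique.map⁺ e-inj S.unique)
                                               (All.tabulate λ {t} _ → T.complete t)
                                               (λ t _ → outside′ (outside t)) ⟩
    sumL T.elements h                     ∎
    where
    module S = FiniteSet S
    module T = FiniteSet T
    outside′ : ∀ {t} → (∃ λ s → e s ≡ t) ⊎ h t ≈ 0# → t ∈ map e S.elements ⊎ h t ≈ 0#
    outside′ (inj₁ (s , ≡.refl)) = inj₁ (∈-map⁺ e (S.complete s))
    outside′ (inj₂ h≈0)          = inj₂ h≈0

-- Integer arithmetic for dimensions.

+∣i∣≡i : ∀ {i} → 0ℤ ℤ.≤ i → + ℤ.∣ i ∣ ≡ i
+∣i∣≡i (ℤ.+≤+ _) = ≡.refl

i≤j⇒j≡i+n : ∀ {i j} → i ℤ.≤ j → ∃ λ n → j ≡ i ℤ.+ + n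
i≤j⇒j≡i+n {i} {j} i≤j = ℤ.∣ j ℤ.- i ∣ , (begin
  j                          ≡⟨ ℤ.+-identityʳ j ⟨
  j ℤ.+ 0ℤ                   ≡⟨ ≡.cong (λ m → j ℤ.+ m) (ℤ.+-inverseˡ i) ⟨
  j ℤ.+ (ℤ.- i ℤ.+ i)        ≡⟨ ℤ.+-assoc j (ℤ.- i) i ⟨
  j ℤ.- i ℤ.+ i              ≡⟨ ℤ.+-comm (j ℤ.- i) i ⟩
  i ℤ.+ (j ℤ.- i)            ≡⟨ ≡.cong (λ m → i ℤ.+ m) (+∣i∣≡i (ℤ.i≤j⇒0≤j-i i≤j)) ⟨
  i ℤ.+ + ℤ.∣ j ℤ.- i ∣      ∎)
  where open ≡.≡-Reasoning

suc-injectiveℤ : ∀ {i j} → ℤ.suc i ≡ ℤ.suc j → i ≡ j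
suc-injectiveℤ {i} {j} eq =
  ≡.trans (≡.sym (ℤ.pred-suc i)) (≡.trans (≡.cong ℤ.pred eq) (ℤ.pred-suc j))

+1-injective : ∀ {i j} → i ℤ.+ 1ℤ ≡ j ℤ.+ 1ℤ → i ≡ j
+1-injective {i} {j} eq = suc-injectiveℤ (≡.trans (ℤ.+-comm 1ℤ i) (≡.trans eq (ℤ.+-comm j 1ℤ)))

i+suc[j] : ∀ i j → i ℤ.+ (1ℤ ℤ.+ j) ≡ 1ℤ ℤ.+ (i ℤ.+ j)
i+suc[j] = solve-∀

-- Graded posets

module FinitePoset {ℓ} (em : ExcludedMiddle ℓ) (X : GradedPoset ℓ) where

  open GradedPoset X
  open IsPartialOrder isPartialOrder public using ()
    renaming (refl to ⊑-refl; reflexive to ⊑-reflexive; trans to ⊑-trans; antisym to ⊑-antisym)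

  maximal : ∀ (P : Pred Face ℓ) x → P x →
            ∃ λ m → P m × x ≤ m × (∀ y → P y → m ≤ y → m ≡ y)
  maximal P x p with go elements x p
    where
    go : ∀ xs x → P x → ∃ λ m → P m × x ≤ m × (∀ y → y ∈ xs → P y → m ≤ y → m ≡ y)
    go []       x p = x , p , ⊑-refl , λ _ ()
    go (y ∷ ys) x p with em {P y × x ≤ y}
    ... | yes (q , x≤y) =
      let m , pm , y≤m , top = go ys y q in
      m , pm , ⊑-trans x≤y y≤m ,
      λ { _ (here ≡.refl) _ m≤y → ⊑-antisym m≤y y≤m ; v (there v∈ys) → top v v∈ys }
    ... | no ¬q =
      let m , pm , x≤m , top = go ys x p in
      m , pm , x≤m ,
      λ { _ (here ≡.refl) q m≤y → contradiction (q , ⊑-trans x≤m m≤y) ¬q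
        ; v (there v∈ys) → top v v∈ys }
  ... | m , pm , x≤m , top = m , pm , x≤m , λ y → top y (complete y)

  <-≤-trans : ∀ {x y z} → x < y → y ≤ z → x < z
  <-≤-trans (x≤y , x≢y) y≤z =
    ⊑-trans x≤y y≤z , λ { ≡.refl → x≢y (⊑-antisym x≤y y≤z) }

  lower-cover : ∀ {x z} → x < z → ∃ λ m → x ≤ m × m ⋖ z
  lower-cover {x} {z} x<z with maximal (λ v → x ≤ v × v < z) x (⊑-refl , x<z)
  ... | m , (x≤m , m<z) , _ , top =
    m , x≤m , m<z , λ (v , m<v , v<z) →
      proj₂ m<v (top v (⊑-trans x≤m (proj₁ m<v) , v<z) (proj₁ m<v))

  ⋖-dim : ∀ {x y} → x ⋖ y → ℤ.suc (dim x) ≡ dim y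
  ⋖-dim {x} x⋖y = ≡.trans (ℤ.+-comm 1ℤ (dim x)) (≡.sym (dim-⋖ x⋖y))

  -- Along `≤` the dimension is only assumed to be monotone; the strict increase comes from the last
  -- cover of a chain from `x` to `z`.
  dim-strict : ∀ {x z} → x < z → dim x ℤ.< dim z
  dim-strict x<z with lower-cover x<z
  ... | m , x≤m , m⋖z =
    ℤ.<-≤-trans (ℤ.suc[i]≤j⇒i<j ℤ.≤-refl) (≡.subst (_ ℤ.≤_) (⋖-dim m⋖z) (ℤ.suc-mono (dim-mono x≤m)))

  ≤∧dim≡⇒≡ : ∀ {x z} → x ≤ z → dim x ≡ dim z → x ≡ z
  ≤∧dim≡⇒≡ {x} {z} x≤z eq with em {x ≡ z}
  ... | yes x≡z = x≡z
  ... | no x≢z  = contradiction (dim-strict (x≤z , x≢z)) (ℤ.<-irrefl eq)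

  -- Descending from `z` by covers that stay above `x` lowers the dimension by one each time, so
  -- dimension `j` is met before the descent can get stuck at `x`.
  interpolate : ∀ {x z j} → x ≤ z → dim x ℤ.≤ j → j ℤ.≤ dim z →
                ∃ λ y → dim y ≡ j × x ≤ y × y ≤ z
  interpolate {x} {z} {j} x≤z dx≤j j≤dz = let n , eq = i≤j⇒j≡i+n j≤dz in go n z x≤z eq
    where
    go : ∀ n z → x ≤ z → dim z ≡ j ℤ.+ + n → ∃ λ y → dim y ≡ j × x ≤ y × y ≤ z
    go zero    z x≤z eq = z , ≡.trans eq (ℤ.+-identityʳ j) , x≤z , ⊑-refl
    go (suc n) z x≤z eq with lower-cover (x≤z , λ { ≡.refl → ℤ.<⇒≱ j<dz dx≤j })
      where
      j<dz : j ℤ.< dim z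
      j<dz = ≡.subst₂ ℤ._<_ (ℤ.+-identityʳ j) (≡.sym eq) (ℤ.+-monoʳ-< j (ℤ.+<+ ℕ.z<s))
    ... | m , x≤m , m⋖z =
      let y , dy , x≤y , y≤m = go n m x≤m (suc-injectiveℤ dm)
      in y , dy , x≤y , ⊑-trans y≤m (proj₁ (proj₁ m⋖z))
      where
      dm : ℤ.suc (dim m) ≡ ℤ.suc (j ℤ.+ + n)
      dm = ≡.trans (⋖-dim m⋖z) (≡.trans eq (i+suc[j] j (+ n)))

  Pair : Face → Face → Pred Face ℓ
  Pair x y = ｛ x ｝ ∪ ｛ y ｝

  pair-lower : ∀ {x y v} → v ≤ x → v ≤ y → ∀ z → Pair x y z → v ≤ z
  pair-lower v≤x v≤y z (inj₁ ≡.refl) = v≤x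
  pair-lower v≤x v≤y z (inj₂ ≡.refl) = v≤y

  module DPoset {d} (isDPoset : IsDPoset d X) where

    open IsDPoset isDPoset

    ∅ : Face
    ∅ = proj₁ emptyFace

    dim-∅ : dim ∅ ≡ -1ℤ
    dim-∅ = proj₁ (proj₂ emptyFace)

    ∅≤ : ∀ x → ∅ ≤ x
    ∅≤ = proj₂ (proj₂ emptyFace)

    -1≤dim : ∀ x → -1ℤ ℤ.≤ dim x
    -1≤dim x = ≡.subst (ℤ._≤ dim x) dim-∅ (dim-mono (∅≤ x))

    dim≤d : ∀ x → dim x ℤ.≤ + d
    dim≤d x = let y , dy , x≤y = below-d-face x in ≡.subst (dim x ℤ.≤_) dy (dim-mono x≤y)

    dim≡-1⇒≡∅ : ∀ {x} → dim x ≡ -1ℤ → x ≡ ∅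
    dim≡-1⇒≡∅ {x} dx = ≡.sym (≤∧dim≡⇒≡ (∅≤ x) (≡.trans dim-∅ (≡.sym dx)))

    Inf-exists : ∀ x y → ∃ (Inf (Pair x y))
    Inf-exists x y =
      let m , lb , _ , top = maximal (λ v → ∀ z → Pair x y z → v ≤ z) ∅ (λ z _ → ∅≤ z)
      in m , lb , top

-- Ranges of dimensions, arithmetic of exponents, normal forms.

dimsUpTo : ℕ → List ℤ
dimsUpTo d = map (λ n → + n ℤ.- 1ℤ) (upTo (d ℕ.+ 2))

∈dimsUpTo : ∀ {d j} → -1ℤ ℤ.≤ j → j ℤ.≤ + d → j ∈ dimsUpTo d
∈dimsUpTo {d} {j} -1≤j j≤d = ≡.subst (_∈ dimsUpTo d) n-1≡j (∈-map⁺ _ (∈-upTo⁺ n<))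
  where
  n : ℕ
  n = ℤ.∣ j ℤ.+ 1ℤ ∣
  cancel : ∀ i → i ℤ.+ 1ℤ ℤ.- 1ℤ ≡ i
  cancel = solve-∀
  +n : + n ≡ j ℤ.+ 1ℤ
  +n = +∣i∣≡i (ℤ.+-monoˡ-≤ 1ℤ -1≤j)
  n-1≡j : + n ℤ.- 1ℤ ≡ j
  n-1≡j = ≡.trans (≡.cong (ℤ._- 1ℤ) +n) (cancel j)
  n< : n ℕ.< d ℕ.+ 2
  n< = ℕ.≤-trans (ℕ.s≤s (ℤ.drop‿+≤+ (≡.subst (ℤ._≤ + (d ℕ.+ 1)) (≡.sym +n) (ℤ.+-monoˡ-≤ 1ℤ j≤d))))
         (ℕ.≤-reflexive (≡.sym (ℕ.+-suc d 1)))

length-dimsUpTo : ∀ n → length (dimsUpTo n) ≡ n ℕ.+ 2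
length-dimsUpTo n = ≡.trans (length-map _ (upTo (n ℕ.+ 2))) (length-upTo (n ℕ.+ 2))

i<j+1⇒i≤j : ∀ {i j} → i ℤ.< j ℤ.+ 1ℤ → i ℤ.≤ j
i<j+1⇒i≤j {i} {j} i<j+1 =
  ≡.subst₂ ℤ._≤_ (ℤ.pred-suc i) (pred-+1 j) (ℤ.pred-mono (ℤ.i<j⇒suc[i]≤j i<j+1))
  where
  pred-+1 : ∀ i → -1ℤ ℤ.+ (i ℤ.+ 1ℤ) ≡ i
  pred-+1 = solve-∀

module _ {a m₁ m₂} {A : Set a} (M₁ : CommutativeMonoid m₁ m₁) (M₂ : CommutativeMonoid m₂ m₂) where
  private
    module M₁ = CommutativeMonoid M₁
    module M₂ = CommutativeMonoid M₂
    module Σ₁ = Summation M₁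
    module Σ₂ = Summation M₂

  sumL-homo : (φ : M₁.Carrier → M₂.Carrier) → φ M₁.ε M₂.≈ M₂.ε →
              (∀ x y → φ (x M₁.∙ y) M₂.≈ φ x M₂.∙ φ y) →
              ∀ (h : A → M₁.Carrier) xs → φ (Σ₁.sumL xs h) M₂.≈ Σ₂.sumL xs (φ ∘ h)
  sumL-homo φ φ-ε φ-∙ h []       = φ-ε
  sumL-homo φ φ-ε φ-∙ h (x ∷ xs) = M₂.trans (φ-∙ _ _) (M₂.∙-congˡ (sumL-homo φ φ-ε φ-∙ h xs))

linkDim-+1 : ∀ m n → (m ℤ.+ 1ℤ) ℤ.- n ℤ.- 1ℤ ≡ (m ℤ.- n ℤ.- 1ℤ) ℤ.+ 1ℤ
linkDim-+1 = solve-∀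

linkDim-injective : ∀ b {i j} → i ℤ.- b ℤ.- 1ℤ ≡ j ℤ.- b ℤ.- 1ℤ → i ≡ j
linkDim-injective b {i} {j} eq =
  ≡.trans (unshift i b) (≡.trans (≡.cong (ℤ._+ (b ℤ.+ 1ℤ)) eq) (≡.sym (unshift j b)))
  where
  unshift : ∀ m n → m ≡ m ℤ.- n ℤ.- 1ℤ ℤ.+ (n ℤ.+ 1ℤ)
  unshift = solve-∀

2^n-suc : ∀ n → ∃ λ a → 2 ℕ.^ n ≡ suc a
2^n-suc n = 2 ℕ.^ n ℕ.∸ 1 , ≡.sym (ℕ.suc-pred (2 ℕ.^ n) {{ℕ.m^n≢0 2 n}})

-- To be read with `s = n - r`, `s′ = k + 1 - r` and `g = r - 1 - b`, so that `suc (s + g) = n - b`.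
-- The right side is the exponent of `θ b`; the left side is that of `η * (θ r * θ r)` plus the
-- exponent in the denominator of `β`. For `s′ = suc s` the two sides are equal.
threshold-exponent : ∀ s s′ g → s′ ℕ.≤ suc s →
  1 ℕ.+ ((2 ℕ.^ s ℕ.∸ 1) ℕ.+ (2 ℕ.^ s ℕ.∸ 1)) ℕ.+ 2 ℕ.^ s′ ℕ.* (2 ℕ.^ g ℕ.∸ 1) ℕ.≤
  2 ℕ.^ suc (s ℕ.+ g) ℕ.∸ 1
threshold-exponent s s′ g s′≤ with 2^n-suc s | 2^n-suc g
... | a , 2^s≡ | h , 2^g≡ = begin
  1 ℕ.+ ((2 ℕ.^ s ℕ.∸ 1) ℕ.+ (2 ℕ.^ s ℕ.∸ 1)) ℕ.+ 2 ℕ.^ s′ ℕ.* (2 ℕ.^ g ℕ.∸ 1)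
    ≤⟨ ℕ.+-monoʳ-≤ _ (ℕ.*-monoˡ-≤ (2 ℕ.^ g ℕ.∸ 1) (ℕ.^-monoʳ-≤ 2 s′≤)) ⟩
  1 ℕ.+ ((2 ℕ.^ s ℕ.∸ 1) ℕ.+ (2 ℕ.^ s ℕ.∸ 1)) ℕ.+ 2 ℕ.* 2 ℕ.^ s ℕ.* (2 ℕ.^ g ℕ.∸ 1)
    ≡⟨ ≡.cong₂ (λ x y → 1 ℕ.+ ((x ℕ.∸ 1) ℕ.+ (x ℕ.∸ 1)) ℕ.+ 2 ℕ.* x ℕ.* (y ℕ.∸ 1)) 2^s≡ 2^g≡ ⟩
  1 ℕ.+ (a ℕ.+ a) ℕ.+ 2 ℕ.* suc a ℕ.* h
    ≡⟨ ≡.cong (ℕ._∸ 1) (identity a h) ⟨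
  2 ℕ.* (suc a ℕ.* suc h) ℕ.∸ 1
    ≡⟨ ≡.cong₂ (λ x y → 2 ℕ.* (x ℕ.* y) ℕ.∸ 1) 2^s≡ 2^g≡ ⟨
  2 ℕ.* (2 ℕ.^ s ℕ.* 2 ℕ.^ g) ℕ.∸ 1
    ≡⟨ ≡.cong (λ x → 2 ℕ.* x ℕ.∸ 1) (ℕ.^-distribˡ-+-* 2 s g) ⟨
  2 ℕ.^ suc (s ℕ.+ g) ℕ.∸ 1 ∎
  where
  open ℕ.≤-Reasoning
  identity : ∀ a h → 2 ℕ.* (suc a ℕ.* suc h) ≡ suc (1 ℕ.+ (a ℕ.+ a) ℕ.+ 2 ℕ.* suc a ℕ.* h)
  identity = ℕ-Solver.solve-∀

confluent⇒unique-normal-form : ∀ {a ℓ} {A : Set a} {_⟶_ : Rel A ℓ} → Confluent _⟶_ → ∀ {x u v} →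
  IsNormalForm _⟶_ u → IsNormalForm _⟶_ v → Star _⟶_ x u → Star _⟶_ x v → u ≡ v
confluent⇒unique-normal-form confluent u-nf v-nf x⟶*u x⟶*v with confluent x⟶*u x⟶*v
... | _ , ε , ε           = ≡.refl
... | _ , s ◅ _ , _       = contradiction (_ , s) u-nf
... | _ , ε , s ◅ _       = contradiction (_ , s) v-nf

terminating⇒normal-form : ∀ {ℓ} → ExcludedMiddle ℓ → {A : Set ℓ} (_⟶_ : Rel A ℓ) →
  WellFounded (flip _⟶_) → WeaklyNormalizing _⟶_
terminating⇒normal-form em {A} _⟶_ wf x = go x (wf x)
  where
  go : ∀ x → Acc (flip _⟶_) x → ∃ λ y → IsNormalForm _⟶_ y × Star _⟶_ x y
  go x (acc rs) with em {∃ λ y → x ⟶ y}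
  ... | no none = x , none , ε
  ... | yes (y , s) = let z , nf , ss = go y (rs s) in z , nf , s ◅ ss

module Expansion {ℓ} (em : ExcludedMiddle ℓ) (ℝ : Reals ℓ) where

  open OrderedField ℝ
  open Theory em ℝ

  open Summation +-commutativeMonoid

  -- Sums over predicates on a finite set.

  opaque
    𝟙 : Set ℓ → Carrier
    𝟙 P with em {P}
    ... | yes _ = 1#
    ... | no  _ = 0#

    𝟙-yes : ∀ {P} → P → 𝟙 P ≈ 1#
    𝟙-yes {P} p with em {P}
    ... | yes _ = refl
    ... | no ¬p = contradiction p ¬p

    𝟙-no : ∀ {P} → ¬ P → 𝟙 P ≈ 0#
    𝟙-no {P} ¬p with em {P}
    ... | yes p = contradiction p ¬p
    ... | no _  = refl

  𝟙*-yes : ∀ {P} x → P → 𝟙 P * x ≈ x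
  𝟙*-yes x p = trans (*-congʳ (𝟙-yes p)) (*-identityˡ x)

  𝟙*-no : ∀ {P} x → ¬ P → 𝟙 P * x ≈ 0#
  𝟙*-no x ¬p = trans (*-congʳ (𝟙-no ¬p)) (zeroˡ x)

  𝟙*-nonNeg : ∀ {P : Set ℓ} {x} → 0# ≤ x → 0# ≤ 𝟙 P * x
  𝟙*-nonNeg {P} {x} 0≤x with em {P}
  ... | yes p = ≤-trans 0≤x (≤-reflexive (sym (𝟙*-yes x p)))
  ... | no ¬p = ≤-reflexive (sym (𝟙*-no x ¬p))

  𝟙*-× : ∀ {P Q : Set ℓ} x → 𝟙 P * (𝟙 Q * x) ≈ 𝟙 (P × Q) * x
  𝟙*-× {P} {Q} x with em {P} | em {Q}
  ... | yes p | yes q = trans (𝟙*-yes _ p) (trans (𝟙*-yes _ q) (sym (𝟙*-yes _ (p , q))))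
  ... | yes p | no ¬q = trans (𝟙*-yes _ p) (trans (𝟙*-no _ ¬q) (sym (𝟙*-no _ (¬q ∘ proj₂))))
  ... | no ¬p | _     = trans (𝟙*-no _ ¬p) (sym (𝟙*-no _ (¬p ∘ proj₁)))

  sumL-mono : ∀ {a} {A : Set a} {g h : A → Carrier} xs → (∀ x → g x ≤ h x) → sumL xs g ≤ sumL xs h
  sumL-mono []       g≤h = ≤-refl
  sumL-mono (x ∷ xs) g≤h = +-mono-≤ (g≤h x) (sumL-mono xs g≤h)

  sumL-* : ∀ {a} {A : Set a} c (g : A → Carrier) xs → sumL xs (λ x → c * g x) ≈ c * sumL xs g
  sumL-* c g []       = sym (zeroʳ c)
  sumL-* c g (x ∷ xs) = trans (+-congˡ (sumL-* c g xs)) (sym (distribˡ c _ _))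

  module Over (S : FiniteSet ℓ) where

    open FiniteSet S renaming (Carrier to A)

    opaque
      ∫ : Pred A ℓ → (A → Carrier) → Carrier
      ∫ P g = sumL elements λ x → 𝟙 (P x) * g x

      ∫-mono : ∀ {P Q : Pred A ℓ} {g h} → (∀ x → P x → Q x × g x ≤ h x) → (∀ x → Q x → 0# ≤ h x) →
               ∫ P g ≤ ∫ Q h
      ∫-mono {P} {Q} {g} {h} P⇒ 0≤h = sumL-mono elements λ x → pointwise x (em {P x}) (em {Q x})
        where
        pointwise : ∀ x → Dec (P x) → Dec (Q x) → 𝟙 (P x) * g x ≤ 𝟙 (Q x) * h x
        pointwise x (yes p) _ = let q , g≤h = P⇒ x p in
          ≤-trans (≤-reflexive (𝟙*-yes _ p)) (≤-trans g≤h (≤-reflexive (sym (𝟙*-yes _ q))))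
        pointwise x (no ¬p) (yes q) = ≤-trans (≤-reflexive (𝟙*-no _ ¬p)) (𝟙*-nonNeg (0≤h x q))
        pointwise x (no ¬p) (no ¬q) = ≤-reflexive (trans (𝟙*-no _ ¬p) (sym (𝟙*-no _ ¬q)))

      ∫-≤ : ∀ {P : Pred A ℓ} {g h} → (∀ x → P x → g x ≤ h x) → ∫ P g ≤ ∫ P h
      ∫-≤ {P} {g} {h} g≤h = sumL-mono elements λ x → pointwise x (em {P x})
        where
        pointwise : ∀ x → Dec (P x) → 𝟙 (P x) * g x ≤ 𝟙 (P x) * h x
        pointwise x (yes p) = *-monoˡ-≤ (≤-trans 0≤1 (≤-reflexive (sym (𝟙-yes p)))) (g≤h x p)
        pointwise x (no ¬p) = ≤-reflexive (trans (𝟙*-no _ ¬p) (sym (𝟙*-no _ ¬p)))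

      ∫-cong : ∀ {P Q : Pred A ℓ} {g h} → (∀ x → P x → Q x) → (∀ x → Q x → P x) →
               (∀ x → P x → g x ≈ h x) → ∫ P g ≈ ∫ Q h
      ∫-cong {P} {Q} {g} {h} P⇒Q Q⇒P g≈h = sumL-cong elements λ x → pointwise x (em {P x})
        where
        pointwise : ∀ x → Dec (P x) → 𝟙 (P x) * g x ≈ 𝟙 (Q x) * h x
        pointwise x (yes p) = trans (𝟙*-yes _ p) (trans (g≈h x p) (sym (𝟙*-yes _ (P⇒Q x p))))
        pointwise x (no ¬p) = trans (𝟙*-no _ ¬p) (sym (𝟙*-no _ (¬p ∘ Q⇒P x)))

      ∫-∪ : ∀ {P Q R : Pred A ℓ} {g} → (∀ x → P x → Q x ⊎ R x) → (∀ x → 0# ≤ g x) →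
            ∫ P g ≤ ∫ Q g + ∫ R g
      ∫-∪ {P} {Q} {R} {g} P⇒ 0≤g =
        ≤-trans (sumL-mono elements λ x → pointwise x (em {P x}))
                (≤-reflexive (sumL-+ _ _ elements))
        where
        pointwise : ∀ x → Dec (P x) → 𝟙 (P x) * g x ≤ 𝟙 (Q x) * g x + 𝟙 (R x) * g x
        pointwise x (no ¬p) = ≤-trans (≤-reflexive (𝟙*-no _ ¬p))
                                (+-nonNeg (𝟙*-nonNeg (0≤g x)) (𝟙*-nonNeg (0≤g x)))
        pointwise x (yes p) with P⇒ x p
        ... | inj₁ q = ≤-trans (≤-reflexive (trans (𝟙*-yes _ p) (sym (𝟙*-yes _ q))))
                         (x≤x+y (𝟙*-nonNeg (0≤g x)))
        ... | inj₂ r = ≤-trans (≤-reflexive (trans (𝟙*-yes _ p) (sym (𝟙*-yes _ r))))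
                         (x≤y+x (𝟙*-nonNeg (0≤g x)))

      ∫-split : ∀ {P : Pred A ℓ} (Q : Pred A ℓ) {g} →
                ∫ P g ≈ ∫ (λ x → P x × Q x) g + ∫ (λ x → P x × ¬ Q x) g
      ∫-split {P} Q {g} =
        trans (sumL-cong elements λ x → pointwise x (em {P x}) (em {Q x})) (sumL-+ _ _ elements)
        where
        pointwise : ∀ x → Dec (P x) → Dec (Q x) →
                    𝟙 (P x) * g x ≈ 𝟙 (P x × Q x) * g x + 𝟙 (P x × ¬ Q x) * g x
        pointwise x (no ¬p) _ = trans (𝟙*-no _ ¬p) (trans (sym (+-identityˡ 0#))
          (+-cong (sym (𝟙*-no _ (¬p ∘ proj₁))) (sym (𝟙*-no _ (¬p ∘ proj₁)))))
        pointwise x (yes p) (yes q) = trans (𝟙*-yes _ p) (trans (sym (+-identityʳ (g x)))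
          (+-cong (sym (𝟙*-yes _ (p , q))) (sym (𝟙*-no _ λ pq → proj₂ pq q))))
        pointwise x (yes p) (no ¬q) = trans (𝟙*-yes _ p) (trans (sym (+-identityˡ (g x)))
          (+-cong (sym (𝟙*-no _ (¬q ∘ proj₂))) (sym (𝟙*-yes _ (p , ¬q)))))

      ∫-* : ∀ {P : Pred A ℓ} c g → ∫ P (λ x → c * g x) ≈ c * ∫ P g
      ∫-* {P} c g = trans (sumL-cong elements λ x →
          trans (sym (*-assoc _ _ _)) (trans (*-congʳ (*-comm _ c)) (*-assoc c _ _)))
        (sumL-* c _ elements)

      ∫-+ : ∀ {P : Pred A ℓ} g h → ∫ P (λ x → g x + h x) ≈ ∫ P g + ∫ P h
      ∫-+ g h = trans (sumL-cong elements λ x → distribˡ _ _ _) (sumL-+ _ _ elements)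

      ∫-fubini : ∀ {U V : Pred A ℓ} {Q R : A → Pred A ℓ} {g : A → A → Carrier} →
                 (∀ v x → V v → Q v x → U x × R x v) → (∀ x v → U x → R x v → V v × Q v x) →
                 ∫ V (λ v → ∫ (Q v) (g v)) ≈ ∫ U (λ x → ∫ (R x) (λ v → g v x))
      ∫-fubini {U} {V} {Q} {R} {g} to from = begin
        sumL elements (λ v → 𝟙 (V v) * sumL elements (λ x → 𝟙 (Q v x) * g v x))
          ≈⟨ sumL-cong elements (λ v → sumL-* (𝟙 (V v)) _ elements) ⟨
        sumL elements (λ v → sumL elements (λ x → 𝟙 (V v) * (𝟙 (Q v x) * g v x)))
          ≈⟨ sumL-swap _ elements elements ⟩
        sumL elements (λ x → sumL elements (λ v → 𝟙 (V v) * (𝟙 (Q v x) * g v x)))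
          ≈⟨ sumL-cong elements (λ x → sumL-cong elements λ v → swap x v) ⟩
        sumL elements (λ x → sumL elements (λ v → 𝟙 (U x) * (𝟙 (R x v) * g v x)))
          ≈⟨ sumL-cong elements (λ x → sumL-* (𝟙 (U x)) _ elements) ⟩
        sumL elements (λ x → 𝟙 (U x) * sumL elements (λ v → 𝟙 (R x v) * g v x)) ∎
        where
        open import Relation.Binary.Reasoning.Setoid setoid
        swap : ∀ x v → 𝟙 (V v) * (𝟙 (Q v x) * g v x) ≈ 𝟙 (U x) * (𝟙 (R x v) * g v x)
        swap x v = trans (𝟙*-× (g v x)) (trans (eq (em {V v × Q v x})) (sym (𝟙*-× (g v x))))
          where
          eq : Dec (V v × Q v x) → 𝟙 (V v × Q v x) * g v x ≈ 𝟙 (U x × R x v) * g v x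
          eq (yes p) = trans (𝟙*-yes _ p) (sym (𝟙*-yes _ (to v x (proj₁ p) (proj₂ p))))
          eq (no ¬p) = trans (𝟙*-no _ ¬p) (sym (𝟙*-no _ λ q → ¬p (from x v (proj₁ q) (proj₂ q))))

      ∫-empty : ∀ {P : Pred A ℓ} {g} → (∀ x → ¬ P x) → ∫ P g ≈ 0#
      ∫-empty ¬P = sumL-zero elements λ x _ → 𝟙*-no _ (¬P x)

      ∫-point : ∀ {P : Pred A ℓ} {g x} → P x → (∀ x → 0# ≤ g x) → g x ≤ ∫ P g
      ∫-point {P} {g} {x} p 0≤g = begin
        g x             ≈⟨ 𝟙*-yes (g x) p ⟨
        𝟙 (P x) * g x   ≤⟨ x≤x+y (nonNeg (elements ─ complete x)) ⟩
        𝟙 (P x) * g x + sumL (elements ─ complete x) (λ x → 𝟙 (P x) * g x)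
          ≈⟨ sumL-remove (λ x → 𝟙 (P x) * g x) (complete x) ⟨
        sumL elements (λ x → 𝟙 (P x) * g x) ∎
        where
        open ≤R
        nonNeg : ∀ xs → 0# ≤ sumL xs (λ x → 𝟙 (P x) * g x)
        nonNeg []       = ≤-refl
        nonNeg (x ∷ xs) = +-nonNeg (𝟙*-nonNeg (0≤g x)) (nonNeg xs)

      ∑≈∫-raw : ∀ {t} (T : FiniteSet t) (e : FiniteSet.Carrier T → A) {P : Pred A ℓ}
                (f : FiniteSet.Carrier T → Carrier) (g : A → Carrier) → (∀ s → f s ≈ g (e s)) →
                (∀ {s s′} → e s ≡ e s′ → s ≡ s′) → (∀ s → P (e s)) → (∀ x → P x → ∃ λ s → e s ≡ x) →
                ∑ +-commutativeMonoid T f ≈ ∫ P g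
      ∑≈∫-raw T e {P} f g f≈g e-inj P-e e-P =
        ∑-embed T S e e-inj f (λ x → 𝟙 (P x) * g x)
          (λ s → trans (f≈g s) (sym (𝟙*-yes (g (e s)) (P-e s)))) (λ x → outside x (em {P x}))
        where
        outside : ∀ x → Dec (P x) → (∃ λ s → e s ≡ x) ⊎ 𝟙 (P x) * g x ≈ 0#
        outside x (yes p) = inj₁ (e-P x p)
        outside x (no ¬p) = inj₂ (𝟙*-no _ ¬p)

    opaque
      unfolding ∫

      -- The integrals of g over subsets take finitely many values, ranked by counting smaller ones.
      ∫-rank : ∀ g → ∃ λ (rank : Carrier → ℕ) → ∀ (P : Pred A ℓ) {v} → ∫ P g < v →
        rank (∫ P g) ℕ.< rank v
      ∫-rank g = count (subsetSums elements) , λ P ∫<v →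
          let s , s∈ , s≈ = ∈subsetSums P elements in count-strict s∈ s≈ ∫<v
        where
        subsetSums : List A → List Carrier
        subsetSums []       = 0# ∷ []
        subsetSums (x ∷ xs) = subsetSums xs ++ map (λ s → g x + s) (subsetSums xs)
        ∈subsetSums : ∀ (P : Pred A ℓ) xs → ∃ λ s →
          s ∈ subsetSums xs × s ≈ sumL xs (λ x → 𝟙 (P x) * g x)
        ∈subsetSums P []       = 0# , here ≡.refl , refl
        ∈subsetSums P (x ∷ xs) with ∈subsetSums P xs | em {P x}
        ... | s , s∈ , s≈ | yes p = g x + s , ∈-++⁺ʳ (subsetSums xs) (∈-map⁺ (λ s → g x + s) s∈) ,
                                    +-cong (sym (𝟙*-yes (g x) p)) s≈
        ... | s , s∈ , s≈ | no ¬p = s , ∈-++⁺ˡ s∈ ,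
                                    trans s≈ (trans (sym (+-identityˡ _))
                                      (+-congʳ (sym (𝟙*-no (g x) ¬p))))
        count : List Carrier → Carrier → ℕ
        count []       v = 0
        count (s ∷ ss) v with em {s < v}
        ... | yes _ = suc (count ss v)
        ... | no _  = count ss v
        count-mono : ∀ ss {u v} → u ≤ v → count ss u ℕ.≤ count ss v
        count-mono []       u≤v = z≤n
        count-mono (s ∷ ss) {u} {v} u≤v with em {s < u} | em {s < v}
        ... | yes _   | yes _   = s≤s (count-mono ss u≤v)
        ... | yes s<u | no s≮v  = contradiction (<-≤-trans s<u u≤v) s≮v
        ... | no _    | yes _   = ℕ.m≤n⇒m≤1+n (count-mono ss u≤v)
        ... | no _    | no _    = count-mono ss u≤v
        count-strict : ∀ {s ss u v} → s ∈ ss → s ≈ u → u < v → count ss u ℕ.< count ss v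
        count-strict {ss = s ∷ ss} {u} {v} s∈ s≈u u<v with em {s < u} | em {s < v} | s∈
        ... | yes s<u | _      | here ≡.refl = contradiction (≤-reflexive (sym s≈u)) (<⇒≱ s<u)
        ... | no _    | no s≮v | here ≡.refl = contradiction (≤-<-trans (≤-reflexive s≈u) u<v) s≮v
        ... | no _    | yes _  | here ≡.refl = s≤s (count-mono ss (<⇒≤ u<v))
        ... | yes _   | yes _  | there s∈ss  = s≤s (count-strict s∈ss s≈u u<v)
        ... | yes s<u | no s≮v | there _     = contradiction (<-≤-trans s<u (<⇒≤ u<v)) s≮v
        ... | no _    | yes _  | there s∈ss  = ℕ.m≤n⇒m≤1+n (count-strict s∈ss s≈u u<v)
        ... | no _    | no _   | there s∈ss  = count-strict s∈ss s≈u u<v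

    -- The bridge from the nested refinement types of the definitions to plain predicates on one
    -- carrier, on which unions, exchanges of sums and double counting are convenient.
    record Enumerates {t} (T : FiniteSet t) (e : FiniteSet.Carrier T → A) (P : Pred A ℓ) :
                      Set (ℓ ⊔ t) where
      field
        injective : ∀ {s s′} → e s ≡ e s′ → s ≡ s′
        sound     : ∀ s → P (e s)
        complete  : ∀ x → P x → ∃ λ s → e s ≡ x

    ∑≈∫-cong : ∀ {t} {T : FiniteSet t} {e : FiniteSet.Carrier T → A} {P : Pred A ℓ} →
               Enumerates T e P → ∀ f g → (∀ s → f s ≈ g (e s)) →
               ∑ +-commutativeMonoid T f ≈ ∫ P g
    ∑≈∫-cong {T = T} {e} en f g f≈g = ∑≈∫-raw T e f g f≈g E.injective E.sound E.complete
      where module E = Enumerates en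

    ∑≈∫ : ∀ {t} {T : FiniteSet t} {e : FiniteSet.Carrier T → A} {P : Pred A ℓ} → Enumerates T e P →
          ∀ g → ∑ +-commutativeMonoid T (g ∘ e) ≈ ∫ P g
    ∑≈∫ en g = ∑≈∫-cong en (g ∘ _) g λ _ → refl

    card≈∫ : ∀ {t} {T : FiniteSet t} {e : FiniteSet.Carrier T → A} {P : Pred A ℓ} →
      Enumerates T e P →
             fromℕ (card T) ≈ ∫ P (const 1#)
    card≈∫ {T = T} en = trans (count (FiniteSet.elements T))
                      (trans (sym (sum-lookup (FiniteSet.elements T) (const 1#)))
                        (∑≈∫ en (const 1#)))
      where
      count : ∀ {b} {B : Set b} (xs : List B) → fromℕ (length xs) ≈ sumL xs (const 1#)
      count []       = refl
      count (x ∷ xs) = +-congˡ (count xs)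

    enumerates-all : ∀ {P : Pred A ℓ} → (∀ x → P x) → Enumerates S id P
    enumerates-all P! = record { injective = id ; sound = P! ; complete = λ x _ → x , ≡.refl }

    enumerates-↾ : ∀ {t q} {T : FiniteSet t} {e : FiniteSet.Carrier T → A} {P P′ : Pred A ℓ}
                   {Q : Pred (FiniteSet.Carrier T) q} → Enumerates T e P → (Q? : Decidable Q) →
                   (∀ t → Q t → P′ (e t)) → (∀ x → P′ x → ∃ λ t → e t ≡ x × Q t) →
                   Enumerates (T ↾ Q?) (e ∘ value) P′
    enumerates-↾ {T = T} {e} {Q = Q} en Q? to from = record
      { injective = value-injective ∘ Enumerates.injective en
      ; sound     = λ (t , [ q ]) → to t (recompute (Q? t) q)
      ; complete  = λ x p → let t , et≡x , q = from x p in (t , [ q ]) , et≡x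
      }

    ∫-⊆ : ∀ {P Q : Pred A ℓ} {g} → (∀ x → P x → Q x) → (∀ x → 0# ≤ g x) → ∫ P g ≤ ∫ Q g
    ∫-⊆ P⇒Q 0≤g = ∫-mono (λ x p → P⇒Q x p , ≤-refl) (λ x _ → 0≤g x)

    ∫-nonNeg : ∀ {P : Pred A ℓ} {g} → (∀ x → P x → 0# ≤ g x) → 0# ≤ ∫ P g
    ∫-nonNeg {P} {g} 0≤g =
      ≤-trans (≤-reflexive (sym (∫-empty {λ _ → Empty} {g} λ _ ()))) (∫-mono (λ _ ()) 0≤g)
      where
      data Empty : Set ℓ where

    -- After exchanging the sums, `g x` is counted once for each `v` related to `x`, hence at most
    -- `N` times.
    ∫-double-count : ∀ {U V : Pred A ℓ} {Q : A → Pred A ℓ} {g N} → (∀ x → 0# ≤ g x) → 0# ≤ N →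
                     (∀ v x → V v → Q v x → U x) →
                     (∀ x → U x → ∫ (λ v → V v × Q v x) (const 1#) ≤ N) →
                     ∫ V (λ v → ∫ (Q v) g) ≤ N * ∫ U g
    ∫-double-count {U} {V} {Q} {g} {N} 0≤g 0≤N Q⊆U count = begin
      ∫ V (λ v → ∫ (Q v) g)
        ≈⟨ ∫-fubini (λ v x v∈V q → Q⊆U v x v∈V q , v∈V , q) (λ x v _ vq → vq) ⟩
      ∫ U (λ x → ∫ (λ v → V v × Q v x) (λ _ → g x))
        ≤⟨ ∫-≤ pointwise ⟩
      ∫ U (λ x → N * g x)
        ≈⟨ ∫-* N g ⟩
      N * ∫ U g ∎
      where
      open ≤R
      pointwise : ∀ x → U x → ∫ (λ v → V v × Q v x) (λ _ → g x) ≤ N * g x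
      pointwise x x∈U = begin
        ∫ (λ v → V v × Q v x) (λ _ → g x)
          ≈⟨ ∫-cong (λ _ p → p) (λ _ p → p) (λ _ _ → *-identityʳ (g x)) ⟨
        ∫ (λ v → V v × Q v x) (λ _ → g x * 1#)
          ≈⟨ ∫-* (g x) (const 1#) ⟩
        g x * ∫ (λ v → V v × Q v x) (const 1#)
          ≤⟨ *-monoˡ-≤ (0≤g x) (count x x∈U) ⟩
        g x * N
          ≈⟨ *-comm (g x) N ⟩
        N * g x ∎

    -- A union bound whose index set consists of elements of the same carrier: each `y` is counted
    -- at least once, at a witness `z`.
    ∫-cover : ∀ {P E : Pred A ℓ} {R : A → Pred A ℓ} {g} → (∀ x → 0# ≤ g x) →
              (∀ y → P y → ∃ λ z → E z × R z y) → ∫ P g ≤ ∫ E (λ z → ∫ (R z) g)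
    ∫-cover {P} {E} {R} {g} 0≤g covered = begin
      ∫ P g
        ≤⟨ ∫-mono (λ y p → let _ , e , r = covered y p in
             covered y p , ∫-point (e , r) (λ _ → 0≤g y)) (λ y _ → ∫-nonNeg λ _ _ → 0≤g y) ⟩
      ∫ (λ y → ∃ λ z → E z × R z y) (λ y → ∫ (λ z → E z × R z y) (λ _ → g y))
        ≈⟨ ∫-fubini (λ z y e r → (z , e , r) , e , r) (λ y z _ er → er) ⟨
      ∫ E (λ z → ∫ (R z) g) ∎
      where open ≤R

    -- Each element is charged to the first index in the list that covers it.
    ∫-⋃ : ∀ {I : Set} {P : Pred A ℓ} {Q : I → Pred A ℓ} {g c} (is : List I) → (∀ x → 0# ≤ g x) →
          (∀ x → P x → ∃ λ i → i ∈ is × Q i x) → (∀ i → i ∈ is → ∫ (Q i) g ≤ c) →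
          ∫ P g ≤ fromℕ (length is) * c
    ∫-⋃ {Q = Q} {c = c} [] 0≤g covered bound =
      ≤-reflexive (trans (∫-empty λ x p → case-[] (covered x p)) (sym (zeroˡ c)))
      where
      case-[] : ∀ {x} → ∃ (λ i → i ∈ [] × Q i x) → ⊥
      case-[] (_ , () , _)
    ∫-⋃ {P = P} {Q} {g} {c} (i ∷ is) 0≤g covered bound = begin
      ∫ P g
        ≤⟨ ∫-∪ {Q = Q i} {R = λ x → P x × ¬ Q i x} split 0≤g ⟩
      ∫ (Q i) g + ∫ (λ x → P x × ¬ Q i x) g
        ≤⟨ +-mono-≤ (bound i (here ≡.refl))
             (∫-⋃ {Q = Q} is 0≤g covered′ λ j → bound j ∘ there) ⟩
      c + fromℕ (length is) * c
        ≈⟨ +-congʳ (*-identityˡ c) ⟨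
      1# * c + fromℕ (length is) * c
        ≈⟨ distribʳ c 1# _ ⟨
      fromℕ (length (i ∷ is)) * c ∎
      where
      open ≤R
      split : ∀ x → P x → Q i x ⊎ P x × ¬ Q i x
      split x p with em {Q i x}
      ... | yes q = inj₁ q
      ... | no ¬q = inj₂ (p , ¬q)
      covered′ : ∀ x → P x × ¬ Q i x → ∃ λ j → j ∈ is × Q j x
      covered′ x (p , ¬q) with covered x p
      ... | _ , here ≡.refl , q = contradiction q ¬q
      ... | j , there j∈is , q  = j , j∈is , q

  -- Infima, suprema and the numerical core of skeleton expansion.

  inf-glb : ∀ (S : Pred Carrier ℓ) → ∃ S → ∃ (LowerBound S) →
            LowerBound S (inf S) × (∀ c → LowerBound S c → c ≤ inf S)
  inf-glb S s∈S bounded with em {∃ λ m → LowerBound S m × UpperBound (LowerBound S) m}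
  ... | yes (m , lower , greatest) = lower , greatest
  ... | no none = contradiction (infimum S s∈S bounded) none

  -- The supremum need not be known to exist or to be attained: where `a i` is positive, the
  -- quotient of `b i` by `a i` is an upper bound of all admissible `μ`, hence at least `c`.
  -- Elsewhere the left side is at most zero.
  ≤sup-expansion : ∀ {I : Set ℓ} (a b : I → Carrier) {c} → 0# ≤ c → (∀ i → 0# ≤ b i) →
                   c ≤sup (λ μ → 0# ≤ μ × (∀ i → μ * a i ≤ b i)) → ∀ i → c * a i ≤ b i
  ≤sup-expansion a b {c} 0≤c 0≤b c≤sup i with em {0# < a i}
  ... | yes 0<a = ≤-trans (*-monoʳ-≤ (<⇒≤ 0<a) (c≤sup (a i ⁻¹ * b i) λ μ (_ , μa≤b) →
          c*x≤y⇒x≤c⁻¹*y 0<a (≤-trans (≤-reflexive (*-comm _ _)) (μa≤b i))))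
        (≤-reflexive (trans (*-comm _ _) (x*x⁻¹y (b i) 0<a)))
  ... | no ¬0<a = begin
      c * a i ≤⟨ *-monoˡ-≤ 0≤c a≤0 ⟩
      c * 0#  ≈⟨ zeroʳ c ⟩
      0#      ≤⟨ 0≤b i ⟩
      b i     ∎
    where
    open ≤R
    a≤0 : a i ≤ 0#
    a≤0 with em {a i ≤ 0#}
    ... | yes a≤0 = a≤0
    ... | no a≰0  = contradiction (≰⇒> a≰0) ¬0<a

  -- Multiplied by θ * θ * u, the quadratic term becomes β times the square of θ * (u * W) ≤ C * μ;
  -- one of the two factors μ is then replaced by s * u.
  skeleton-bound : ∀ {B C η θ u s α β W μ} → 0# < θ → 0# < u → 0# ≤ η → 0# ≤ C →
                   0# ≤ β → 0# ≤ W → 0# ≤ μ →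
                   θ * (u * W) ≤ C * μ → μ ≤ s * u → α ≤ η * θ → β * s ≤ B * (η * (θ * θ)) →
                   u * (α * W + β * (W * W)) ≤ (C + B * (C * C)) * (η * μ)
  skeleton-bound {B} {C} {η} {θ} {u} {s} {α} {β} {W} {μ} 0<θ 0<u 0≤η 0≤C 0≤β 0≤W 0≤μ
                 θuW≤ μ≤ α≤ βs≤ = begin
    u * (α * W + β * (W * W))
      ≈⟨ solve 4
        (λ u a b W → u :* (a :* W :+ b :* (W :* W)) := a :* (u :* W) :+ u :* (b :* (W :* W))) refl
          u α β W ⟩
    α * (u * W) + u * (β * (W * W))
      ≤⟨ +-mono-≤ linear quadratic ⟩
    C * (η * μ) + B * (C * C) * (η * μ)
      ≈⟨ distribʳ (η * μ) C _ ⟨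
    (C + B * (C * C)) * (η * μ) ∎
    where
    open ≤R
    open Solver using (solve; _:*_; _:+_; _:=_)
    0≤uW : 0# ≤ u * W
    0≤uW = *-nonNeg (<⇒≤ 0<u) 0≤W
    linear : α * (u * W) ≤ C * (η * μ)
    linear = begin
      α * (u * W)       ≤⟨ *-monoʳ-≤ 0≤uW α≤ ⟩
      η * θ * (u * W)   ≈⟨ *-assoc η θ _ ⟩
      η * (θ * (u * W)) ≤⟨ *-monoˡ-≤ 0≤η θuW≤ ⟩
      η * (C * μ)       ≈⟨ solve 3 (λ a b c → a :* (b :* c) := b :* (a :* c)) refl η C μ ⟩
      C * (η * μ)       ∎
    0≤Cμ : 0# ≤ C * μ
    0≤Cμ = *-nonNeg 0≤C 0≤μ
    quadratic : u * (β * (W * W)) ≤ B * (C * C) * (η * μ)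
    quadratic = *-cancelˡ-≤ (*-pos (*-pos 0<θ 0<θ) 0<u) (begin
      θ * θ * u * (u * (β * (W * W)))
        ≈⟨ solve 4
          (λ t u b W → t :* t :* u :* (u :* (b :* (W :* W))) := b :*
            (t :* (u :* W) :* (t :* (u :* W)))) refl θ u β W ⟩
      β * (θ * (u * W) * (θ * (u * W)))
        ≤⟨ *-monoˡ-≤ 0≤β (*-mono-≤ (*-nonNeg (<⇒≤ 0<θ) 0≤uW) 0≤Cμ θuW≤ θuW≤) ⟩
      β * (C * μ * (C * μ))
        ≈⟨ solve 3 (λ b c m → b :* (c :* m :* (c :* m)) := b :* (c :* c :* m) :* m) refl β C μ ⟩
      β * (C * C * μ) * μ
        ≤⟨ *-monoˡ-≤ (*-nonNeg 0≤β (*-nonNeg (*-nonNeg 0≤C 0≤C) 0≤μ)) μ≤ ⟩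
      β * (C * C * μ) * (s * u)
        ≈⟨ solve 5 (λ b c m s u → b :* (c :* c :* m) :* (s :* u) := b :* s :* (c :* c :* m :* u))
          refl β C μ s u ⟩
      β * s * (C * C * μ * u)
        ≤⟨ *-monoʳ-≤ (*-nonNeg (*-nonNeg (*-nonNeg 0≤C 0≤C) 0≤μ) (<⇒≤ 0<u)) βs≤ ⟩
      B * (η * (θ * θ)) * (C * C * μ * u)
        ≈⟨ solve 6 (λ b e t c m u →
          b :* (e :* (t :* t)) :* (c :* c :* m :* u) := t :* t :* u :* (b :* (c :* c) :* (e :* m)))
            refl B η θ C μ u ⟩
      θ * θ * u * (B * (C * C) * (η * μ)) ∎)

  -- Thresholds and constants.

  module Thresholds (η : Carrier) (0<η : 0# < η) (η≤1 : η ≤ 1#) (n : ℕ) where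

    -- θ i is the product of η ^ (2 ^ (n - 1 - j)) over i ≤ j < n; it is meant for i ≤ n.
    exponent : ℤ → ℕ
    exponent i = 2 ℕ.^ ℤ.∣ + n ℤ.- i ∣ ℕ.∸ 1

    θ : ℤ → Carrier
    θ i = η ^ exponent i

    0<θ : ∀ i → 0# < θ i
    0<θ i = ^-pos (exponent i) 0<η

    θ-top : θ (+ n) ≈ 1#
    θ-top = reflexive (≡.cong (λ i → η ^ (2 ℕ.^ ℤ.∣ i ∣ ℕ.∸ 1)) (ℤ.+-inverseʳ (+ n)))

    θ-mono : ∀ {i j} → i ℤ.≤ j → j ℤ.≤ + n → θ i ≤ θ j
    θ-mono {i} {j} i≤j j≤n = ^-antitone 0<η η≤1 (ℕ.∸-monoˡ-≤ 1 (ℕ.^-monoʳ-≤ 2 (ℤ.drop‿+≤+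
      (≡.subst₂ ℤ._≤_ (≡.sym (+∣i∣≡i (ℤ.i≤j⇒0≤j-i j≤n)))
        (≡.sym (+∣i∣≡i (ℤ.i≤j⇒0≤j-i (ℤ.≤-trans i≤j j≤n))))
        (ℤ.+-monoʳ-≤ (+ n) (ℤ.neg-mono-≤ i≤j))))))

  module Constants (B : Carrier) (F : ℕ) (L : Carrier) (k : ℕ) where

    -- `C` bounds, in both directions, the distortion between `w x` and the product of `w z` with
    -- the weight of `x` in the link of `z`. Its fourth power of `L` stems from four comparisons of
    -- face counts. `𝔻` adds to this the linear and the quadratic term of skeleton expansion.
    C 𝔻 : Carrier
    C = L ^ 4 * fromℕ F
    𝔻 = C * (C + B * (C * C))

    -- The heavy faces have p-weight at most 𝔾 n * w A, the bad faces weight at most κ n * η * w A, and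
    -- w A ≤ K * contraction n * w A.  The factor E absorbs the losses in passing between the weights of
    -- f, of its coboundary and of the faces corrected.
    𝔾 𝕞 κ contraction : ℕ → Carrier
    𝔾 n = (1# + fromℕ F) ^ n
    𝕞 n = fromℕ (n ℕ.+ 3)
    κ n = 𝕞 n * (𝕞 n * (𝕞 n * (C * (𝔻 * (𝕞 n * fromℕ F * 𝔾 n)))))
    contraction n = C * C * (𝕞 n * fromℕ F * κ n) + 𝔾 n

    -- The summand 1 makes `K` times either contraction factor strictly less than 1, and gives
    -- `K ≤ 1`. `E` dominates the three losses that occur later: `C * C`, `C * 𝔾 (k + 1)` and `𝔾 n`
    -- for `n ≤ k + 1`.
    K⁻¹ K E K′ : Carrier
    K⁻¹ = 1# + (contraction k + contraction (k ℕ.+ 1))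
    K   = K⁻¹ ⁻¹
    E   = C * C * 𝔾 (k ℕ.+ 1)
    K′  = K * E ⁻¹

    module Bounds (0<B : 0# < B) (1≤F : 1 ℕ.≤ F) (1≤L : 1# ≤ L) where

      1≤C : 1# ≤ C
      1≤C = *-≥1 (^-≥1 4 1≤L) (1≤fromℕ 1≤F)

      0≤C : 0# ≤ C
      0≤C = ≤-trans 0≤1 1≤C

      1≤𝔾 : ∀ n → 1# ≤ 𝔾 n
      1≤𝔾 n = ^-≥1 n (x≤x+y (0≤fromℕ F))

      0≤𝔻 : 0# ≤ 𝔻
      0≤𝔻 = *-nonNeg 0≤C (+-nonNeg 0≤C (*-nonNeg (<⇒≤ 0<B) (*-nonNeg 0≤C 0≤C)))

      0≤contraction : ∀ n → 0# ≤ contraction n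
      0≤contraction n =
        +-nonNeg (*-nonNeg (*-nonNeg 0≤C 0≤C) (*-nonNeg 0≤𝕞𝔽 (*-nonNeg 0≤𝕞 (*-nonNeg 0≤𝕞
          (*-nonNeg 0≤𝕞 (*-nonNeg 0≤C (*-nonNeg 0≤𝔻 (*-nonNeg 0≤𝕞𝔽 0≤𝔾)))))))) 0≤𝔾
        where
        0≤𝕞 : 0# ≤ 𝕞 n
        0≤𝕞 = 0≤fromℕ (n ℕ.+ 3)
        0≤𝕞𝔽 : 0# ≤ 𝕞 n * fromℕ F
        0≤𝕞𝔽 = *-nonNeg 0≤𝕞 (0≤fromℕ F)
        0≤𝔾 : 0# ≤ 𝔾 n
        0≤𝔾 = ≤-trans 0≤1 (1≤𝔾 n)

      1≤K⁻¹ : 1# ≤ K⁻¹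
      1≤K⁻¹ = x≤x+y (+-nonNeg (0≤contraction k) (0≤contraction (k ℕ.+ 1)))

      0<K⁻¹ : 0# < K⁻¹
      0<K⁻¹ = <-≤-trans 0<1 1≤K⁻¹

      0<K : 0# < K
      0<K = ⁻¹-pos 0<K⁻¹

      K≤1 : K ≤ 1#
      K≤1 = ⁻¹≤1 1≤K⁻¹

      K*<1 : ∀ {c} → 1# + c ≤ K⁻¹ → K * c < 1#
      K*<1 {c} h = ≰⇒> λ 1≤Kc → <⇒≱ 0<1 (+-cancelʳ-≤ c (begin
        1# + c       ≤⟨ h ⟩
        K⁻¹          ≈⟨ *-identityʳ K⁻¹ ⟨
        K⁻¹ * 1#     ≤⟨ x≤c⁻¹*y⇒c*x≤y 0<K⁻¹ 1≤Kc ⟩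
        c            ≈⟨ +-identityˡ c ⟨
        0# + c       ∎))
        where open ≤R

      K*contraction₀<1 : K * contraction k < 1#
      K*contraction₀<1 = K*<1 (+-monoʳ-≤ 1# (x≤x+y (0≤contraction (k ℕ.+ 1))))

      K*contraction₁<1 : K * contraction (k ℕ.+ 1) < 1#
      K*contraction₁<1 = K*<1 (+-monoʳ-≤ 1# (x≤y+x (0≤contraction k)))

      1≤E : 1# ≤ E
      1≤E = *-≥1 (*-≥1 1≤C 1≤C) (1≤𝔾 (k ℕ.+ 1))

      0<E : 0# < E
      0<E = <-≤-trans 0<1 1≤E

      0<K′ : 0# < K′
      0<K′ = *-pos 0<K (⁻¹-pos 0<E)

      K′≤1 : K′ ≤ 1#
      K′≤1 = *-≤1 (<⇒≤ (⁻¹-pos 0<E)) K≤1 (⁻¹≤1 1≤E)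

      K′*≤K : ∀ {c} → c ≤ E → K′ * c ≤ K
      K′*≤K {c} c≤E = begin
        K * E ⁻¹ * c   ≈⟨ *-assoc K _ c ⟩
        K * (E ⁻¹ * c)
          ≤⟨ *-monoˡ-≤ (<⇒≤ 0<K)
            (x≤c*y⇒c⁻¹*x≤y 0<E (≤-trans c≤E (≤-reflexive (sym (*-identityʳ E))))) ⟩
        K * 1#         ≈⟨ *-identityʳ K ⟩
        K              ∎
        where open ≤R

      C*C≤E : C * C ≤ E
      C*C≤E = ≤-trans (x≤c*x (1≤𝔾 (k ℕ.+ 1)) (*-nonNeg 0≤C 0≤C)) (≤-reflexive (*-comm _ _))

      C*𝔾≤E : C * 𝔾 (k ℕ.+ 1) ≤ E
      C*𝔾≤E = ≤-trans (x≤c*x 1≤C (*-nonNeg 0≤C (≤-trans 0≤1 (1≤𝔾 (k ℕ.+ 1)))))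
        (≤-reflexive (sym (*-assoc _ _ _)))

      𝔾≤E : ∀ {n} → n ℕ.≤ k ℕ.+ 1 → 𝔾 n ≤ E
      𝔾≤E n≤k+1 = ≤-trans (^-monotone (x≤x+y (0≤fromℕ F)) n≤k+1)
        (x≤c*x (*-≥1 1≤C 1≤C) (≤-trans 0≤1 (1≤𝔾 (k ℕ.+ 1))))

  -- Standing hypotheses on the weighted poset.

  record Setting : Set (Level.suc ℓ) where
    field
      d              : ℕ
      X              : GradedPoset ℓ
      isDPoset       : IsDPoset d X
      w              : Weight X
      isProperWeight : IsProperWeight X d w
      L              : Carrier
      Φ              : ℕ
      -- The dimension up to which face counts are bounded. It becomes `k + 2`, because the argument
      -- in degree n = k + 1 involves faces of dimension n + 1.
      J              : ℤ
      irregularity   : lowerIrregularity X d ≤ L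
      1≤L            : 1# ≤ L
      1≤Φ            : 1 ℕ.≤ Φ
      Fmax≤Φ         : ∀ i j → -1ℤ ℤ.≤ i → i ℤ.≤ j → j ℤ.≤ J → Fmax X -1ℤ i j ℕ.≤ Φ

  module InSetting (𝒮 : Setting) where

    open Setting 𝒮
    open IsProperWeight isProperWeight
    open GradedPoset X renaming (_≤_ to _⊑_; _<_ to _⊏_) hiding (complete; unique)
    module FP = FinitePoset em X
    open FP using (⊑-refl; ⊑-trans; ⊑-reflexive; ⊑-antisym; dim-strict; interpolate; Pair)
    open FP.DPoset isDPoset
    open Over faces

    -- Weights of faces and of links

    0≤w : ∀ x → 0# ≤ w x
    0≤w x = <⇒≤ (positive x)

    0≤1ᶠ : (x : Face) → 0# ≤ 1#
    0≤1ᶠ _ = 0≤1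

    enumerates-dim : ∀ {P : Pred Face ℓ} i → (∀ x → dim x ≡ i → P x) → (∀ x → P x → dim x ≡ i) →
                     Enumerates (facesOfDim i) value P
    enumerates-dim i to from = enumerates-↾ (enumerates-all λ x → ∅≤ x) (λ x → dim x ℤ.≟ i)
      to (λ x p → x , ≡.refl , from x p)

    enumerates-dim∣ : ∀ i {P : Pred (FiniteSet.Carrier (facesOfDim i)) ℓ} {Q : Pred Face ℓ} →
                      (∀ x → P x → dim (value x) ≡ i → Q (value x)) →
                      (∀ x → Q x → ∃ λ (e : dim x ≡ i) → P (x , [ e ])) →
                      Enumerates (facesOfDim i ∣ P) (value ∘ value) Q
    enumerates-dim∣ i to from = enumerates-↾
      (enumerates-dim {λ x → dim x ≡ i × x ⊑ x} i (λ x e → e , ⊑-refl) λ x → proj₁)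
      (λ x → em) (λ (x , [ e ]) p → to (x , [ e ]) p (recompute (dim x ℤ.≟ i) e))
      (λ x q → let e , p = from x q in (x , [ e ]) , ≡.refl , p)

    N : Face → ℤ → Face → Carrier
    N x j z = ∫ (λ y → dim y ≡ j × x ⊑ y × y ⊑ z) (const 1#)

    card-between : ∀ x j z → fromℕ (card (between X x j z)) ≈ N x j z
    card-between x j z = card≈∫ (enumerates-dim∣ j (λ y p e → e , p) (λ y (e , p) → e , p))

    1≤N : ∀ {x j z} → x ⊑ z → dim x ℤ.≤ j → j ℤ.≤ dim z → 1# ≤ N x j z
    1≤N x⊑z dx≤j j≤dz = let y , p = interpolate x⊑z dx≤j j≤dz in
      ∫-point {x = y} p 0≤1ᶠ

    N-pos : ∀ {x j z} → x ⊑ z → dim x ℤ.≤ j → j ℤ.≤ dim z → 0# < N x j z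
    N-pos x⊑z dx≤j j≤dz = <-≤-trans 0<1 (1≤N x⊑z dx≤j j≤dz)

    between-nonempty : ∀ {x j z} → x ⊑ z → dim x ℤ.≤ j → j ℤ.≤ dim z → 1 ℕ.≤ card (between X x j z)
    between-nonempty {x} {j} {z} x⊑z dx≤j j≤dz with card (between X x j z) | card-between x j z
    ... | zero  | 0≈N = contradiction 0≈N (λ eq → >0⇒≉0 (N-pos x⊑z dx≤j j≤dz) (sym eq))
    ... | suc n | _   = ℕ.s≤s ℕ.z≤n

    card∈faceCounts : ∀ {x} j {z} → x ⊑ z → card (between X x j z) ∈ faceCounts X (dim x) j (dim z)
    card∈faceCounts {x} j {z} x⊑z = ∈-concatMap⁺ _ (lose
      (FiniteSet.complete (facesOfDim (dim x)) (x , [ ≡.refl ]))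
      (∈-map⁺ _ (FiniteSet.complete
        (facesOfDim (dim z) ∣ (λ z′ → x ⊑ value z′)) ((z , [ ≡.refl ]) , [ x⊑z ]))))

    All-faceCounts : ∀ {p} (P : Pred ℕ p) i j k →
                     (∀ x z → dim x ≡ i → dim z ≡ k → x ⊑ z → P (card (between X x j z))) →
                     All P (faceCounts X i j k)
    All-faceCounts P i j k h = All.tabulate λ {m} m∈ → go m∈
      where
      go : ∀ {m} → m ∈ faceCounts X i j k → P m
      go m∈ with satisfied (∈-concatMap⁻
        (λ x → map (λ z → card (between X (value x) j (value (value z))))
                   (FiniteSet.elements (facesOfDim k ∣ (λ z → value x ⊑ value z))))
        {xs = FiniteSet.elements (facesOfDim i)} m∈)
      ... | (x , [ ex ]) , m∈map with ∈-map⁻ _ m∈map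
      ... | ((z , [ ez ]) , [ x⊑z ]) , _ , ≡.refl =
        h x z (recompute (dim x ℤ.≟ i) ex) (recompute (dim z ℤ.≟ k) ez) (recompute em x⊑z)

    card≤Fmax : ∀ {x} j {z} → x ⊑ z → card (between X x j z) ℕ.≤ Fmax X (dim x) j (dim z)
    card≤Fmax {x} j {z} x⊑z =
      All.lookup (ℕExtrema.xs≤max 0 (faceCounts X (dim x) j (dim z))) (card∈faceCounts j x⊑z)

    Fmin≤card : ∀ {x} j {z} → x ⊑ z → Fmin X (dim x) j (dim z) ℕ.≤ card (between X x j z)
    Fmin≤card {x} j {z} x⊑z =
      All.lookup (ℕExtrema.min≤xs _ (faceCounts X (dim x) j (dim z))) (card∈faceCounts j x⊑z)

    1≤Fmin : ∀ {x j z} → x ⊑ z → dim x ℤ.≤ j → j ℤ.≤ dim z → 1 ℕ.≤ Fmin X (dim x) j (dim z)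
    1≤Fmin {x} {j} {z} x⊑z dx≤j j≤dz = ℕExtrema.v≤min⁺ {xs = faceCounts X (dim x) j (dim z)}
      (ℕ.≤-trans (between-nonempty x⊑z dx≤j j≤dz) (card≤Fmax j x⊑z))
      (All-faceCounts (1 ℕ.≤_) _ j _ λ x′ z′ ex ez x′⊑z′ → between-nonempty x′⊑z′
        (≡.subst (ℤ._≤ j) (≡.sym ex) dx≤j) (≡.subst (j ℤ.≤_) (≡.sym ez) j≤dz))

    𝔽 : Carrier
    𝔽 = fromℕ Φ

    C : Carrier
    C = L ^ 4 * 𝔽

    0≤L : 0# ≤ L
    0≤L = ≤-trans 0≤1 1≤L

    1≤𝔽 : 1# ≤ 𝔽
    1≤𝔽 = 1≤fromℕ 1≤Φ

    1≤C : 1# ≤ C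
    1≤C = *-≥1 (^-≥1 4 1≤L) 1≤𝔽

    0≤C : 0# ≤ C
    0≤C = ≤-trans 0≤1 1≤C

    -- Both counts lie between `Fmin` and `Fmax` for one triple of dimensions, and the ratio of
    -- these is among those maximised in `lowerIrregularity`. Interpolation makes `Fmin` positive,
    -- so the ratio is a genuine quotient.
    N-uniform : ∀ {x z x′ z′ j} → x ⊑ z → x′ ⊑ z′ → dim x′ ≡ dim x → dim z′ ≡ dim z →
                dim x ℤ.≤ j → j ℤ.≤ dim z → N x j z ≤ L * N x′ j z′
    N-uniform {x} {z} {x′} {z′} {j} x⊑z x′⊑z′ ex ez dx≤j j≤dz = begin
      N x j z                                ≈⟨ card-between x j z ⟨
      fromℕ (card (between X x j z))         ≤⟨ fromℕ-mono (card≤Fmax j x⊑z) ⟩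
      fromℕ Fmx                              ≈⟨ x⁻¹*xy (fromℕ Fmx) 0<Fmn ⟨
      fromℕ Fmn ⁻¹ * (fromℕ Fmn * fromℕ Fmx) ≈⟨ *-congˡ (*-comm _ _) ⟩
      fromℕ Fmn ⁻¹ * (fromℕ Fmx * fromℕ Fmn) ≈⟨ *-assoc _ _ _ ⟨
      fromℕ Fmn ⁻¹ * fromℕ Fmx * fromℕ Fmn   ≈⟨ *-congʳ (*-comm _ _) ⟩
      fromℕ Fmx / fromℕ Fmn * fromℕ Fmn
        ≤⟨ *-mono-≤ 0≤ratio (0≤fromℕ card′) (≤-trans ratio≤ irregularity) (fromℕ-mono
             (≡.subst₂ (λ i k → Fmin X i j k ℕ.≤ card′) ex ez (Fmin≤card j x′⊑z′))) ⟩
      L * fromℕ card′                        ≈⟨ *-congˡ (card-between x′ j z′) ⟩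
      L * N x′ j z′                          ∎
      where
      open ≤R
      Fmx Fmn card′ : ℕ
      Fmx = Fmax X (dim x) j (dim z)
      Fmn = Fmin X (dim x) j (dim z)
      card′ = card (between X x′ j z′)
      0<Fmn : 0# < fromℕ Fmn
      0<Fmn = <-≤-trans 0<1 (1≤fromℕ (1≤Fmin x⊑z dx≤j j≤dz))
      0≤ratio : 0# ≤ fromℕ Fmx / fromℕ Fmn
      0≤ratio = *-nonNeg (0≤fromℕ Fmx) (<⇒≤ (⁻¹-pos 0<Fmn))
      ratio≤ : fromℕ Fmx / fromℕ Fmn ≤ lowerIrregularity X d
      ratio≤ = All.lookup (Data.List.Extrema.xs≤max totalOrder 0# _)
        (∈-concatMap⁺ _ (lose (∈dimsUpTo (-1≤dim z) (dim≤d z))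
          (∈-concatMap⁺ _ (lose
            (∈-filter⁺ (ℤ._≤? dim z)
              (∈dimsUpTo (ℤ.≤-trans (-1≤dim x) dx≤j) (ℤ.≤-trans j≤dz (dim≤d z))) j≤dz)
            (∈-map⁺ _ (∈-filter⁺ (ℤ._≤? j) (∈dimsUpTo (-1≤dim x) (dim≤d x)) dx≤j))))))

    -- For `i` outside the range from -1 to `dim x` there is nothing to count, so later sums over
    -- all dimensions need no side condition on `i`.
    N∅≤𝔽 : ∀ i {x} → dim x ℤ.≤ J → N ∅ i x ≤ 𝔽
    N∅≤𝔽 i {x} dx≤J with -1ℤ ℤ.≤? i | i ℤ.≤? dim x
    ... | yes -1≤i | yes i≤dx = ≤-trans (≤-reflexive (sym (card-between ∅ i x)))
      (fromℕ-mono (ℕ.≤-trans (card≤Fmax i (∅≤ x))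
        (≡.subst (λ b → Fmax X b i (dim x) ℕ.≤ Φ) (≡.sym dim-∅) (Fmax≤Φ i (dim x) -1≤i i≤dx dx≤J))))
    ... | no -1≰i | _ =
      ≤-trans (≤-reflexive (∫-empty λ { y (≡.refl , _) → -1≰i (-1≤dim y) })) (0≤fromℕ Φ)
    ... | yes _ | no i≰dx =
      ≤-trans (≤-reflexive (∫-empty λ { y (≡.refl , _ , y⊑x) → i≰dx (dim-mono y⊑x) })) (0≤fromℕ Φ)

    -- By uniformity the denominators `g Y` vary by a factor of at most `L`, so a single reference
    -- count `n` may stand for all of them; `division-∫` is the opposite estimate.
    ∫-division : ∀ (P : Pred Face ℓ) {g : Face → Carrier} {n} → (∀ Y → P Y → 0# < g Y) →
                 (∀ Y → P Y → n ≤ L * g Y) → n * ∫ P (λ Y → w Y / g Y) ≤ L * ∫ P w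
    ∫-division P {g} {n} 0<g n≤ = begin
      n * ∫ P (λ Y → w Y / g Y)     ≈⟨ ∫-* n _ ⟨
      ∫ P (λ Y → n * (w Y / g Y))   ≤⟨ ∫-≤ pointwise ⟩
      ∫ P (λ Y → L * w Y)           ≈⟨ ∫-* L w ⟩
      L * ∫ P w                     ∎
      where
      open ≤R
      pointwise : ∀ Y → P Y → n * (w Y / g Y) ≤ L * w Y
      pointwise Y p = begin
        n * (w Y * g Y ⁻¹)
          ≤⟨ *-monoʳ-≤ (*-nonNeg (0≤w Y) (<⇒≤ (⁻¹-pos (0<g Y p)))) (n≤ Y p) ⟩
        L * g Y * (w Y * g Y ⁻¹)
          ≈⟨ Solver.solve 4 (λ l a b c → l :* a :* (b :* c) := l :* (a :* (c :* b)))
            refl L (g Y) (w Y) (g Y ⁻¹) ⟩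
        L * (g Y * (g Y ⁻¹ * w Y)) ≈⟨ *-congˡ (x*x⁻¹y (w Y) (0<g Y p)) ⟩
        L * w Y                    ∎
        where open Solver using (_:*_; _:=_)

    division-∫ : ∀ (P : Pred Face ℓ) {g : Face → Carrier} {n} → (∀ Y → P Y → 0# < g Y) →
                 (∀ Y → P Y → g Y ≤ L * n) → ∫ P w ≤ L * n * ∫ P (λ Y → w Y / g Y)
    division-∫ P {g} {n} 0<g ≤n = begin
      ∫ P w                               ≤⟨ ∫-≤ pointwise ⟩
      ∫ P (λ Y → L * n * (w Y / g Y))     ≈⟨ ∫-* (L * n) _ ⟩
      L * n * ∫ P (λ Y → w Y / g Y)       ∎
      where
      open ≤R
      pointwise : ∀ Y → P Y → w Y ≤ L * n * (w Y / g Y)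
      pointwise Y p = begin
        w Y                        ≈⟨ x*x⁻¹y (w Y) (0<g Y p) ⟨
        g Y * (g Y ⁻¹ * w Y)       ≈⟨ *-congˡ (*-comm _ _) ⟩
        g Y * (w Y / g Y)
          ≤⟨ *-monoʳ-≤ (*-nonNeg (0≤w Y) (<⇒≤ (⁻¹-pos (0<g Y p)))) (≤n Y p) ⟩
        L * n * (w Y / g Y)        ∎

    Above : Face → Pred Face ℓ
    Above x Y = dim Y ≡ + d × x ⊑ Y

    M : Face → Carrier
    M x = ∫ (Above x) w

    w≈ : ∀ x → w x ≈ ∫ (Above x) (λ Y → w Y / N ∅ (dim x) Y)
    w≈ x = trans (induced x) (trans (∑≈∫ (enumerates-dim∣ (+ d) (λ Y p e → e , p) (λ Y p → p))
      (λ Y → w Y / fromℕ (card (facesOfDim (dim x) ∣ (λ x′ → value x′ ⊑ Y)))))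
      (∫-cong (λ _ p → p) (λ _ p → p) λ Y _ → *-congˡ (⁻¹-cong (card≈∫
        (enumerates-dim∣ (dim x) (λ y p e → e , ∅≤ (value y) , p) (λ y (e , _ , p) → e , p))))))

    wᴸ : Face → Face → Carrier
    wᴸ z x = M z ⁻¹ * ∫ (Above x) (λ Y → w Y / N z (dim x) Y)

    linkWeight≈ : ∀ z x → linkWeight X d w z x ≈ wᴸ z (value x)
    linkWeight≈ z (x , _) = *-cong
      (⁻¹-cong (∑≈∫ (enumerates-dim∣ (+ d) (λ Y p e → e , p) (λ Y p → p)) w))
      (trans (∑≈∫ (enumerates-dim∣ (+ d) (λ Y p e → e , p) (λ Y p → p))
               (λ Y → w Y / fromℕ (card (between X z (dim x) Y))))
        (∫-cong (λ _ p → p) (λ _ p → p) λ Y _ → *-congˡ (⁻¹-cong (card-between z (dim x) Y))))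

    M-pos : ∀ x → 0# < M x
    M-pos x = let Y , dY , x⊑Y = IsDPoset.below-d-face isDPoset x in
      <-≤-trans (positive Y) (∫-point (dY , x⊑Y) 0≤w)

    N-pos-above : ∀ {z x Y} → z ⊑ x → Above x Y → 0# < N z (dim x) Y
    N-pos-above z⊑x (dY , x⊑Y) = N-pos (⊑-trans z⊑x x⊑Y) (dim-mono z⊑x) (dim-mono x⊑Y)

    wᴸ-nonNeg : ∀ {z x} → z ⊑ x → 0# ≤ wᴸ z x
    wᴸ-nonNeg z⊑x = *-nonNeg (<⇒≤ (⁻¹-pos (M-pos _))) (∫-nonNeg λ Y p →
      *-nonNeg (0≤w Y) (<⇒≤ (⁻¹-pos (N-pos-above z⊑x p))))

    -- All the sums defining w and wᴸ are compared, up to powers of L, with the face counts of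
    -- one fixed d-face Y₀ above x.
    module Compare {z x : Face} (z⊑x : z ⊑ x) (dx≤J : dim x ℤ.≤ J) where

      Y₀ : Face
      Y₀ = proj₁ (IsDPoset.below-d-face isDPoset x)

      Y₀∈ : Above x Y₀
      Y₀∈ = proj₂ (IsDPoset.below-d-face isDPoset x)

      z⊑Y₀ : z ⊑ Y₀
      z⊑Y₀ = ⊑-trans z⊑x (proj₂ Y₀∈)

      nx nz nzx S : Carrier
      nx  = N ∅ (dim x) Y₀
      nz  = N ∅ (dim z) Y₀
      nzx = N z (dim x) Y₀
      S   = ∫ (Above x) (λ Y → w Y / N z (dim x) Y)

      uniform-above : ∀ {v u Y Y′} → v ⊑ u → Above u Y → Above u Y′ →
                      N v (dim u) Y ≤ L * N v (dim u) Y′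
      uniform-above v⊑u (dY , u⊑Y) (dY′ , u⊑Y′) =
        N-uniform (⊑-trans v⊑u u⊑Y) (⊑-trans v⊑u u⊑Y′) ≡.refl (≡.trans dY′ (≡.sym dY))
          (dim-mono v⊑u) (dim-mono u⊑Y)

      Y₀∈z : Above z Y₀
      Y₀∈z = proj₁ Y₀∈ , z⊑Y₀

      nz*wz≤ : nz * w z ≤ L * M z
      nz*wz≤ = ≤-trans (≤-reflexive (*-congˡ (w≈ z)))
        (∫-division (Above z) (λ Y → N-pos-above (∅≤ z)) (λ Y p → uniform-above (∅≤ z) Y₀∈z p))

      Mz≤ : M z ≤ L * nz * w z
      Mz≤ = ≤-trans
        (division-∫ (Above z) (λ Y → N-pos-above (∅≤ z)) (λ Y p → uniform-above (∅≤ z) p Y₀∈z))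
        (≤-reflexive (*-congˡ (sym (w≈ z))))

      nx*wx≤ : nx * w x ≤ L * M x
      nx*wx≤ = ≤-trans (≤-reflexive (*-congˡ (w≈ x)))
        (∫-division (Above x) (λ Y → N-pos-above (∅≤ x)) (λ Y p → uniform-above (∅≤ x) Y₀∈ p))

      Mx≤ : M x ≤ L * nx * w x
      Mx≤ = ≤-trans
        (division-∫ (Above x) (λ Y → N-pos-above (∅≤ x)) (λ Y p → uniform-above (∅≤ x) p Y₀∈))
        (≤-reflexive (*-congˡ (sym (w≈ x))))

      nzx*S≤ : nzx * S ≤ L * M x
      nzx*S≤ = ∫-division (Above x) (λ Y → N-pos-above z⊑x) (λ Y p → uniform-above z⊑x Y₀∈ p)

      Mx≤S : M x ≤ L * nzx * S
      Mx≤S = division-∫ (Above x) (λ Y → N-pos-above z⊑x) (λ Y p → uniform-above z⊑x p Y₀∈)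

      Mz*wᴸ : M z * wᴸ z x ≈ S
      Mz*wᴸ = x*x⁻¹y S (M-pos z)

      -- Double counting of the pairs z′ ≤ x′ of faces of Y₀ with the dimensions of z and x.
      chains : ∫ (λ z′ → dim z′ ≡ dim z × ∅ ⊑ z′ × z′ ⊑ Y₀) (λ z′ → N z′ (dim x) Y₀) ≈
               ∫ (λ x′ → dim x′ ≡ dim x × ∅ ⊑ x′ × x′ ⊑ Y₀) (λ x′ → N ∅ (dim z) x′)
      chains = ∫-fubini
        (λ z′ x′ (ez , _ , _) (ex , z′⊑x′ , x′⊑Y₀) → (ex , ∅≤ x′ , x′⊑Y₀) , ez , ∅≤ z′ , z′⊑x′)
        (λ x′ z′ (ex , _ , x′⊑Y₀) (ez , _ , z′⊑x′) →
          (ez , ∅≤ z′ , ⊑-trans z′⊑x′ x′⊑Y₀) , ex , z′⊑x′ , x′⊑Y₀)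

      ∫-const : ∀ {P : Pred Face ℓ} c → ∫ P (const c) ≈ c * ∫ P (const 1#)
      ∫-const c = trans (∫-cong (λ _ p → p) (λ _ p → p) λ _ _ → sym (*-identityʳ c)) (∫-* c _)

      nx≤ : nx ≤ L * (nz * nzx)
      nx≤ = begin
        nx ≤⟨ ∫-≤ (λ x′ (ex , _ , x′⊑Y₀) → 1≤N {∅} {dim z} (∅≤ x′) (dim-mono (∅≤ z))
                (≡.subst (dim z ℤ.≤_) (≡.sym ex) (dim-mono z⊑x))) ⟩
        ∫ (λ x′ → dim x′ ≡ dim x × ∅ ⊑ x′ × x′ ⊑ Y₀) (λ x′ → N ∅ (dim z) x′) ≈⟨ chains ⟨
        ∫ (λ z′ → dim z′ ≡ dim z × ∅ ⊑ z′ × z′ ⊑ Y₀) (λ z′ → N z′ (dim x) Y₀)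
          ≤⟨ ∫-≤ (λ z′ (ez , _ , z′⊑Y₀) → N-uniform z′⊑Y₀ z⊑Y₀ (≡.sym ez) ≡.refl
               (≡.subst (ℤ._≤ dim x) (≡.sym ez) (dim-mono z⊑x)) (dim-mono (proj₂ Y₀∈))) ⟩
        ∫ (λ z′ → dim z′ ≡ dim z × ∅ ⊑ z′ × z′ ⊑ Y₀) (const (L * nzx)) ≈⟨ ∫-const _ ⟩
        L * nzx * nz   ≈⟨ *-assoc L nzx nz ⟩
        L * (nzx * nz) ≈⟨ *-congˡ (*-comm nzx nz) ⟩
        L * (nz * nzx) ∎
        where open ≤R

      -- Unlike in `nx≤`, where every `x′` lies above at least one `z′`, an upper bound on the
      -- number of `z′` below each `x′` is needed. This is where `𝔽` and the restriction to
      -- dimensions at most `J` enter.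
      nz*nzx≤ : nz * nzx ≤ L * 𝔽 * nx
      nz*nzx≤ = begin
        nz * nzx ≈⟨ *-comm nz nzx ⟩
        nzx * nz ≈⟨ ∫-const nzx ⟨
        ∫ (λ z′ → dim z′ ≡ dim z × ∅ ⊑ z′ × z′ ⊑ Y₀) (const nzx)
          ≤⟨ ∫-≤ (λ z′ (ez , _ , z′⊑Y₀) → N-uniform z⊑Y₀ z′⊑Y₀ ez ≡.refl
               (dim-mono z⊑x) (dim-mono (proj₂ Y₀∈))) ⟩
        ∫ (λ z′ → dim z′ ≡ dim z × ∅ ⊑ z′ × z′ ⊑ Y₀) (λ z′ → L * N z′ (dim x) Y₀) ≈⟨ ∫-* L _ ⟩
        L * ∫ (λ z′ → dim z′ ≡ dim z × ∅ ⊑ z′ × z′ ⊑ Y₀) (λ z′ → N z′ (dim x) Y₀)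
          ≈⟨ *-congˡ chains ⟩
        L * ∫ (λ x′ → dim x′ ≡ dim x × ∅ ⊑ x′ × x′ ⊑ Y₀) (λ x′ → N ∅ (dim z) x′)
          ≤⟨ *-monoˡ-≤ 0≤L (∫-≤ (λ x′ (ex , _ , x′⊑Y₀) →
               N∅≤𝔽 (dim z) (≡.subst (ℤ._≤ J) (≡.sym ex) dx≤J))) ⟩
        L * ∫ (λ x′ → dim x′ ≡ dim x × ∅ ⊑ x′ × x′ ⊑ Y₀) (const 𝔽) ≈⟨ *-congˡ (∫-const 𝔽) ⟩
        L * (𝔽 * nx) ≈⟨ *-assoc L 𝔽 nx ⟨
        L * 𝔽 * nx ∎
        where open ≤R

      0<nx : 0# < nx
      0<nx = N-pos-above (∅≤ x) Y₀∈
      0<nz : 0# < nz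
      0<nz = N-pos-above (∅≤ z) Y₀∈z
      0<nzx : 0# < nzx
      0<nzx = N-pos-above z⊑x Y₀∈

      wz*wᴸ≤ : w z * wᴸ z x ≤ C * w x
      wz*wᴸ≤ = *-cancelˡ-≤ (*-pos (*-pos 0<nz 0<nzx) (M-pos z)) (begin
        nz * nzx * M z * (w z * wᴸ z x)
          ≈⟨ solve 5 (λ a b m u v → a :* b :* m :* (u :* v) := (a :* u) :* (b :* (m :* v)))
            refl nz nzx (M z) (w z) (wᴸ z x) ⟩
        nz * w z * (nzx * (M z * wᴸ z x))  ≈⟨ *-congˡ (*-congˡ Mz*wᴸ) ⟩
        nz * w z * (nzx * S)
          ≤⟨ *-mono-≤ (*-nonNeg (<⇒≤ 0<nz) (0≤w z)) (*-nonNeg 0≤L (<⇒≤ (M-pos x))) nz*wz≤ nzx*S≤ ⟩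
        L * M z * (L * M x)
          ≤⟨ *-monoˡ-≤ 0≤LM (*-monoˡ-≤ 0≤L (≤-trans Mx≤ (*-monoʳ-≤ (0≤w x) (*-monoˡ-≤ 0≤L nx≤)))) ⟩
        L * M z * (L * (L * (L * (nz * nzx)) * w x))
          ≈⟨ solve 5 (λ l a b m u →
            l :* m :* (l :* (l :* (l :* (a :* b)) :* u)) := a :* b :* m :* (l :^ 4 :* u)) refl L nz
              nzx (M z) (w x) ⟩
        nz * nzx * M z * (L ^ 4 * w x)
          ≤⟨ *-monoˡ-≤ (*-nonNeg (*-nonNeg (<⇒≤ 0<nz) (<⇒≤ 0<nzx)) (<⇒≤ (M-pos z)))
            (*-monoʳ-≤ (0≤w x) (≤-trans (x≤c*x 1≤𝔽 0≤L⁴) (≤-reflexive (*-comm _ _)))) ⟩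
        nz * nzx * M z * (C * w x) ∎)
        where
        open ≤R
        open Solver using (solve; _:*_; _:=_; _:^_)
        0≤LM : 0# ≤ L * M z
        0≤LM = *-nonNeg 0≤L (<⇒≤ (M-pos z))
        0≤L⁴ : 0# ≤ L ^ 4
        0≤L⁴ = ≤-trans 0≤1 (^-≥1 4 1≤L)

      wx≤ : w x ≤ C * (w z * wᴸ z x)
      wx≤ = *-cancelˡ-≤ 0<nx (begin
        nx * w x                    ≤⟨ nx*wx≤ ⟩
        L * M x                     ≤⟨ *-monoˡ-≤ 0≤L Mx≤S ⟩
        L * (L * nzx * S)           ≈⟨ *-congˡ (*-congˡ Mz*wᴸ) ⟨
        L * (L * nzx * (M z * wᴸ z x))
          ≤⟨ *-monoˡ-≤ 0≤L (*-monoˡ-≤ (*-nonNeg 0≤L (<⇒≤ 0<nzx)) (*-monoʳ-≤ (wᴸ-nonNeg z⊑x) Mz≤)) ⟩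
        L * (L * nzx * (L * nz * w z * wᴸ z x))
          ≈⟨ solve 5 (λ l a b u v →
            l :* (l :* b :* (l :* a :* u :* v)) := a :* b :* (l :^ 3 :* (u :* v))) refl L nz nzx
              (w z) (wᴸ z x) ⟩
        nz * nzx * (L ^ 3 * (w z * wᴸ z x))
          ≤⟨ *-monoʳ-≤ (*-nonNeg (≤-trans 0≤1 (^-≥1 3 1≤L)) (*-nonNeg (0≤w z) (wᴸ-nonNeg z⊑x)))
            nz*nzx≤ ⟩
        L * 𝔽 * nx * (L ^ 3 * (w z * wᴸ z x))
          ≈⟨ solve 5 (λ l f n u v →
            l :* f :* n :* (l :^ 3 :* (u :* v)) := n :* (l :^ 4 :* f :* (u :* v))) refl L 𝔽 nx
              (w z) (wᴸ z x) ⟩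
        nx * (C * (w z * wᴸ z x)) ∎)
        where
        open ≤R
        open Solver using (solve; _:*_; _:=_; _:^_)

    -- Each d-face `Y` above `z` shares its weight equally among the faces of dimension `j` between
    -- `z` and `Y`; summing over these returns `w Y`, or nothing if there are none. The latter is
    -- why only an inequality is claimed.
    ∫-wᴸ : ∀ z j → ∫ (λ y → dim y ≡ j × z ⊑ y) (wᴸ z) ≤ 1#
    ∫-wᴸ z j = *-cancelˡ-≤ (M-pos z) (begin
      M z * ∫ (λ y → dim y ≡ j × z ⊑ y) (wᴸ z) ≈⟨ ∫-* (M z) (wᴸ z) ⟨
      ∫ (λ y → dim y ≡ j × z ⊑ y) (λ y → M z * wᴸ z y)
        ≈⟨ ∫-cong (λ _ p → p) (λ _ p → p) (λ { y (≡.refl , _) → x*x⁻¹y _ (M-pos z) }) ⟩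
      ∫ (λ y → dim y ≡ j × z ⊑ y) (λ y → ∫ (Above y) (λ Y → w Y / N z j Y))
        ≈⟨ ∫-fubini (λ y Y (ey , z⊑y) (dY , y⊑Y) → (dY , ⊑-trans z⊑y y⊑Y) , ey , z⊑y , y⊑Y)
             (λ Y y (dY , _) (ey , z⊑y , y⊑Y) → (ey , z⊑y) , dY , y⊑Y) ⟩
      ∫ (Above z) (λ Y → ∫ (λ y → dim y ≡ j × z ⊑ y × y ⊑ Y) (λ _ → w Y / N z j Y))
        ≤⟨ ∫-≤ pointwise ⟩
      M z      ≈⟨ *-identityʳ (M z) ⟨
      M z * 1# ∎)
      where
      open ≤R
      pointwise : ∀ Y → Above z Y →
                  ∫ (λ y → dim y ≡ j × z ⊑ y × y ⊑ Y) (λ _ → w Y / N z j Y) ≤ w Y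
      pointwise Y (dY , z⊑Y) with em {∃ λ y → dim y ≡ j × z ⊑ y × y ⊑ Y}
      ... | no none = ≤-trans (≤-reflexive (∫-empty λ y p → none (y , p))) (0≤w Y)
      ... | yes (y , ≡.refl , z⊑y , y⊑Y) = ≤-reflexive
        (trans (∫-cong (λ _ p → p) (λ _ p → p) (λ _ _ → sym (*-identityʳ _)))
        (trans (∫-* _ (const 1#))
        (trans (*-assoc _ _ _)
        (trans (*-congˡ (*-inverseˡ _ (>0⇒≉0 (N-pos z⊑Y (dim-mono z⊑y) (dim-mono y⊑Y)))))
          (*-identityʳ (w Y))))))

    wz*wᴸ≤C*wx : ∀ {z x} → z ⊑ x → dim x ℤ.≤ J → w z * wᴸ z x ≤ C * w x
    wz*wᴸ≤C*wx = Compare.wz*wᴸ≤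

    wx≤C*wz*wᴸ : ∀ {z x} → z ⊑ x → dim x ℤ.≤ J → w x ≤ C * (w z * wᴸ z x)
    wx≤C*wz*wᴸ = Compare.wx≤

    ∫-above≤ : ∀ z j → j ℤ.≤ J → ∫ (λ y → dim y ≡ j × z ⊑ y) w ≤ C * w z
    ∫-above≤ z j j≤J = begin
      ∫ (λ y → dim y ≡ j × z ⊑ y) w
        ≤⟨ ∫-≤ (λ { y (≡.refl , z⊑y) →
          ≤-trans (wx≤C*wz*wᴸ z⊑y j≤J) (≤-reflexive (sym (*-assoc _ _ _))) }) ⟩
      ∫ (λ y → dim y ≡ j × z ⊑ y) (λ y → C * w z * wᴸ z y) ≈⟨ ∫-* (C * w z) (wᴸ z) ⟩
      C * w z * ∫ (λ y → dim y ≡ j × z ⊑ y) (wᴸ z)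
        ≤⟨ *-monoˡ-≤ (*-nonNeg 0≤C (0≤w z)) (∫-wᴸ z j) ⟩
      C * w z * 1# ≈⟨ *-identityʳ _ ⟩
      C * w z ∎
      where open ≤R

    w∅≤1 : w ∅ ≤ 1#
    w∅≤1 = begin
      w ∅ ≈⟨ w≈ ∅ ⟩
      ∫ (Above ∅) (λ Y → w Y / N ∅ (dim ∅) Y)
        ≤⟨ ∫-≤ (λ Y (dY , p) → ≤-trans (*-monoˡ-≤ (0≤w Y) (⁻¹≤1 (1≤N p ℤ.≤-refl (dim-mono p))))
          (≤-reflexive (*-identityʳ _))) ⟩
      ∫ (Above ∅) w ≈⟨ ∑≈∫ (enumerates-dim (+ d) (λ Y e → e , ∅≤ Y) (λ Y → proj₁)) w ⟨
      _ ≈⟨ normalised ⟩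
      1# ∎
      where open ≤R

    -- The skeleton expansion of NIH (in X or in a link), with vertices and hyperedges read as faces of X.
    Meeting : Pred Face ℓ → ℤ → ℤ → ℤ → Face → Pred Face ℓ
    Meeting Q t l r v z = dim z ≡ t × v ⊑ z × ∃₂ λ a a′ → Q a × Q a′ ×
      dim a ≡ l × dim a′ ≡ r × a ⊑ z × a′ ⊑ z × Inf (Pair a a′) v

    IsSkeleton : Face → (Face → Carrier) → ℤ → ℤ → ℤ → Carrier → Carrier → Set (Level.suc ℓ)
    IsSkeleton v ω t l r α β = ∀ (Q : Pred Face ℓ) →
      let W = ∫ (λ x → Q x × v ⊑ x × (dim x ≡ l ⊎ dim x ≡ r)) ω in
      ∫ (Meeting Q t l r v) ω ≤ α * W + β * (W * W)

    module _ (l r : ℤ) where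

      vertexWeight : Carrier → Carrier
      vertexWeight x = if does (l ℤ.≟ r) then x else (1# / fromℕ 2) * x

      half : 0# ≤ 1# / fromℕ 2 × 1# / fromℕ 2 ≤ 1#
      half = *-nonNeg 0≤1 (<⇒≤ (⁻¹-pos (<-≤-trans 0<1 1≤2))) ,
        ≤-trans (≤-reflexive (*-identityˡ _)) (⁻¹≤1 1≤2)
        where
        1≤2 : 1# ≤ fromℕ 2
        1≤2 = 1≤fromℕ {2} (s≤s z≤n)

      vertexWeight-bounds : ∀ {x} → 0# ≤ x → 0# ≤ vertexWeight x × vertexWeight x ≤ x
      vertexWeight-bounds 0≤x with l ℤ.≟ r
      ... | yes _ = 0≤x , ≤-refl
      ... | no _  = *-nonNeg (proj₁ half) 0≤x , c*x≤x (proj₂ half) 0≤x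

      vertexWeight-cong : ∀ {x y} → x ≈ y → vertexWeight x ≈ vertexWeight y
      vertexWeight-cong x≈y with l ℤ.≟ r
      ... | yes _ = x≈y
      ... | no _  = *-congˡ x≈y

      -- A meeting `z` contains two related vertices, so it is the image of a hyperedge in `E₂`. On
      -- the other side the factor one half in the vertex weights is simply dropped: this enlarges
      -- `W`, in which the bound is monotone as `α` and `β` are nonnegative.
      from-expander : ∀ {v t α β} (ω : Face → Carrier) → (∀ x → v ⊑ x → 0# ≤ ω x) → 0# ≤ α →
        0# ≤ β →
        (ℋ : RelatedWeightedHypergraph) →
        let open RelatedWeightedHypergraph ℋ using (Vertex; Hyperedge; E₂; wⱽ; wᴱ) in
        (e : Vertex → Face) (h : Hyperedge → Face) →
        (∀ {s s′} → e s ≡ e s′ → s ≡ s′) → (∀ {s s′} → h s ≡ h s′ → s ≡ s′) →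
        (∀ s → v ⊑ e s × (dim (e s) ≡ l ⊎ dim (e s) ≡ r)) → (∀ s → v ⊑ h s) →
        (∀ s → wⱽ s ≈ vertexWeight (ω (e s))) → (∀ s → wᴱ s ≈ ω (h s)) →
        (∀ Q z → Meeting Q t l r v z → ∃ λ s → h s ≡ z × E₂ (Q ∘ e) s) →
        IsSkeletonExpander ℋ α β → IsSkeleton v ω t l r α β
      from-expander {v} {t} {α} {β} ω 0≤ω 0≤α 0≤β ℋ e h e-inj h-inj e-sound h-sound wⱽ≈ wᴱ≈ meet
        expander Q = begin
        ∫ (Meeting Q t l r v) ω
          ≤⟨ ∫-mono (λ z m → let s , eq , s∈ = meet Q z m in ((s , [ s∈ ]) , eq) , ≤-refl)
               (λ { _ (s , ≡.refl) → 0≤ω _ (h-sound (value s)) }) ⟩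
        ∫ (λ z → ∃ λ (s : FiniteSet.Carrier (hyperedges ∣ E₂ (Q ∘ e))) → h (value s) ≡ z) ω
          ≈⟨ ∑≈∫-cong (image (hyperedges ∣ E₂ (Q ∘ e)) (h ∘ value) (value-injective ∘ h-inj)) _ ω
            (wᴱ≈ ∘ value) ⟨
        _ ≤⟨ expander (Q ∘ e) ⟩
        α * wA + β * (wA * wA)
          ≤⟨ +-mono-≤ (*-monoˡ-≤ 0≤α wA≤W)
            (*-monoˡ-≤ 0≤β (*-mono-≤ 0≤wA (≤-trans 0≤wA wA≤W) wA≤W wA≤W)) ⟩
        α * W + β * (W * W) ∎
        where
        open ≤R
        open RelatedWeightedHypergraph ℋ using (vertices; hyperedges; E₂; wⱽ)
        V : Pred Face ℓ
        V x = Q x × v ⊑ x × (dim x ≡ l ⊎ dim x ≡ r)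
        W wA : Carrier
        W  = ∫ V ω
        wA = ∑ +-commutativeMonoid (vertices ∣ (Q ∘ e)) (wⱽ ∘ value)
        image : ∀ (S : FiniteSet ℓ) (e : FiniteSet.Carrier S → Face) →
                (∀ {s s′} → e s ≡ e s′ → s ≡ s′) → Enumerates S e (λ x → ∃ λ s → e s ≡ x)
        image S e e-inj =
          record { injective = e-inj ; sound = λ s → s , ≡.refl ; complete = λ x p → p }
        wA≈ : wA ≈ ∫ (λ x → ∃ λ (s : FiniteSet.Carrier (vertices ∣ (Q ∘ e))) → e (value s) ≡ x)
          (vertexWeight ∘ ω)
        wA≈ = ∑≈∫-cong (image (vertices ∣ (Q ∘ e)) (e ∘ value) (value-injective ∘ e-inj)) _ _
          (wⱽ≈ ∘ value)
        bounds : ∀ x → (∃ λ (s : FiniteSet.Carrier (vertices ∣ (Q ∘ e))) → e (value s) ≡ x) →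
          0# ≤ vertexWeight (ω x) × vertexWeight (ω x) ≤ ω x
        bounds x (s , ≡.refl) = vertexWeight-bounds (0≤ω _ (proj₁ (e-sound (value s))))
        0≤wA : 0# ≤ wA
        0≤wA = ≤-trans (∫-nonNeg λ x p → proj₁ (bounds x p)) (≤-reflexive (sym wA≈))
        wA≤W : wA ≤ W
        wA≤W = ≤-trans (≤-reflexive wA≈) (∫-mono
          (λ { x p@((s , [ q ]) , ≡.refl) → (recompute em q , e-sound s) , proj₂ (bounds x p) })
          (λ x (_ , v⊑x , _) → 0≤ω x v⊑x))

    -- If the two faces coincided, that face would itself be their only maximal lower bound, but its
    -- dimension exceeds that of `v`.
    meeting-distinct : ∀ {a a′ v} → dim v ℤ.< dim a → Inf (Pair a a′) v → a ≢ a′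
    meeting-distinct {a} {v = v} dv<da (lower , greatest) ≡.refl = ℤ.<-irrefl ≡.refl
      (≡.subst (λ b → dim b ℤ.< dim a)
        (greatest a (FP.pair-lower ⊑-refl ⊑-refl) (lower a (inj₁ ≡.refl))) dv<da)

    -- The relation of the hypergraph asks that the empty face be the only maximal lower bound,
    -- while a meeting only says that it is one of them. As it lies below every lower bound, its
    -- maximality excludes all others.
    skeleton-∅ : ∀ {t l r α β} → -1ℤ ℤ.< l → 0# ≤ α → 0# ≤ β →
                 IsSkeletonExpander (NIH l r t X w) α β → IsSkeleton ∅ w t l r α β
    skeleton-∅ {t} {l} {r} -1<l 0≤α 0≤β =
      from-expander l r w (λ x _ → 0≤w x) 0≤α 0≤β (NIH l r t X w)
      value value value-injective value-injective
      (λ (x , [ e ]) → ∅≤ x , recompute ((dim x ℤ.≟ l) ⊎-dec (dim x ℤ.≟ r)) e) (λ s → ∅≤ _)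
        (λ s → refl) (λ s → refl)
      λ { Q z (dz , _ , a , a′ , qa , qa′ , ea , ea′ , a⊑z , a′⊑z , inf) →
          (z , [ dz ]) , ≡.refl , (a , [ inj₁ ea ]) , (a′ , [ inj₂ ea′ ]) , qa , qa′ , a⊑z , a′⊑z ,
          (λ eq → meeting-distinct (≡.subst₂ ℤ._<_ (≡.sym dim-∅) (≡.sym ea) -1<l) inf
            (≡.cong value eq)) ,
          ((z , [ dz ]) , a⊑z , a′⊑z) , (to inf , from inf) , inj₁ (ea , ea′) }
      where
      to : ∀ {a a′} → Inf (Pair a a′) ∅ → ∀ {u} → Inf (Pair a a′) u → IsEmptyFace u
      to (_ , greatest) {u} (lower , _) with greatest u lower (∅≤ u)
      ... | ≡.refl = dim-∅ , ∅≤
      from : ∀ {a a′} → Inf (Pair a a′) ∅ → ∀ {u} → IsEmptyFace u → Inf (Pair a a′) u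
      from inf {u} (du , _) with dim≡-1⇒≡∅ {u} du
      ... | ≡.refl = inf

    skeleton-link : ∀ {t l r α β} v → dim v ℤ.< l → 0# ≤ α → 0# ≤ β →
      IsSkeletonExpander (NIH (l ℤ.- dim v ℤ.- 1ℤ) (r ℤ.- dim v ℤ.- 1ℤ) (t ℤ.- dim v ℤ.- 1ℤ)
                              (link X v) (linkWeight X d w v)) α β →
      IsSkeleton v (wᴸ v) t l r α β
    skeleton-link {t} {l} {r} v dv<l 0≤α 0≤β = from-expander l r (wᴸ v) (λ x → wᴸ-nonNeg) 0≤α 0≤β
      (NIH l′ r′ (linkDim t) (link X v) (linkWeight X d w v))
      (value ∘ value) (value ∘ value) (value-injective ∘ value-injective)
        (value-injective ∘ value-injective)
      (λ { ((x , [ v⊑x ]) , [ e ]) → recompute em v⊑x ,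
           Sum.map (linkDim-injective (dim v)) (linkDim-injective (dim v))
             (recompute ((linkDim (dim x) ℤ.≟ l′) ⊎-dec (linkDim (dim x) ℤ.≟ r′)) e) })
      (λ { ((x , [ v⊑x ]) , _) → recompute em v⊑x })
      (λ s → trans (weight-cong (linkWeight≈ v (value s)))
        (reflexive (≡.cong (λ b → if b then _ else _) does-≟)))
      (λ s → linkWeight≈ v (value s))
      λ { Q z (dz , v⊑z , a , a′ , qa , qa′ , ea , ea′ , a⊑z , a′⊑z , inf@(lower , _)) →
          let v⊑a  = lower a (inj₁ ≡.refl)
              v⊑a′ = lower a′ (inj₂ ≡.refl)
              z′ = ((z , [ v⊑z ]) , [ ≡.cong linkDim dz ])
          in
          z′ , ≡.refl , ((a , [ v⊑a ]) , [ inj₁ (≡.cong linkDim ea) ]) ,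
            ((a′ , [ v⊑a′ ]) , [ inj₂ (≡.cong linkDim ea′) ]) ,
          qa , qa′ , a⊑z , a′⊑z ,
          (λ eq → meeting-distinct (≡.subst (dim v ℤ.<_) (≡.sym ea) dv<l) inf
            (≡.cong (value ∘ value) eq)) ,
          (z′ , a⊑z , a′⊑z) ,
          (to inf , from inf) , inj₁ (≡.cong linkDim ea , ≡.cong linkDim ea′) }
      where
      linkDim : ℤ → ℤ
      linkDim i = i ℤ.- dim v ℤ.- 1ℤ
      l′ r′ : ℤ
      l′ = linkDim l
      r′ = linkDim r
      weight-cong : ∀ {x y} → x ≈ y → vertexWeight l′ r′ x ≈ vertexWeight l′ r′ y
      weight-cong = vertexWeight-cong l′ r′
      does-≟ : does (l′ ℤ.≟ r′) ≡ does (l ℤ.≟ r)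
      does-≟ with l′ ℤ.≟ r′ | l ℤ.≟ r
      ... | yes _ | yes _ = ≡.refl
      ... | no _  | no _  = ≡.refl
      ... | yes eq | no ne = contradiction (linkDim-injective (dim v) eq) ne
      ... | no ne | yes eq = contradiction (≡.cong linkDim eq) ne
      open GradedPoset (link X v) using () renaming
        (Inf to Infᴸ; IsEmptyFace to IsEmptyFaceᴸ; Face to Faceᴸ)
      b-b-1 : ∀ b → b ℤ.- b ℤ.- 1ℤ ≡ -1ℤ
      b-b-1 = solve-∀
      module _ {a a′ : Face} .{v⊑a : v ⊑ a} .{v⊑a′ : v ⊑ a′} (inf : Inf (Pair a a′) v) where
        Pairᴸ : Pred Faceᴸ ℓ
        Pairᴸ = ｛ (a , [ v⊑a ]) ｝ ∪ ｛ (a′ , [ v⊑a′ ]) ｝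
        -- Every face of the link lies above `v`, and `v` is a maximal lower bound in `X`; hence it
        -- is the only lower bound inside the link.
        lower-value : ∀ (u : Faceᴸ) → (∀ x → Pairᴸ x → value u ⊑ value x) → value u ≡ v
        lower-value (u , [ v⊑u ]) lower = ≡.sym (proj₂ inf u
          (FP.pair-lower (lower (a , [ v⊑a ]) (inj₁ ≡.refl)) (lower (a′ , [ v⊑a′ ]) (inj₂ ≡.refl)))
          (recompute em v⊑u))
        to : ∀ {u} → Infᴸ Pairᴸ u → IsEmptyFaceᴸ u
        to {u} (lower , _) = empty (lower-value u lower)
          where
          empty : value u ≡ v → IsEmptyFaceᴸ u
          empty ≡.refl = b-b-1 (dim v) , λ (x , [ v⊑x ]) → recompute em v⊑x
        from : ∀ {u} → IsEmptyFaceᴸ u → Infᴸ Pairᴸ u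
        from {u , [ v⊑u ]} (_ , bottom) =
          below (⊑-antisym (bottom (v , [ ⊑-refl ])) (recompute em v⊑u))
          where
          below : u ≡ v → Infᴸ Pairᴸ (u , [ v⊑u ])
          below ≡.refl =
            (λ { _ (inj₁ ≡.refl) → proj₁ inf a (inj₁ ≡.refl) ; _ (inj₂ ≡.refl) →
              proj₁ inf a′ (inj₂ ≡.refl) }) ,
            λ u′ lower _ → value-injective (≡.sym (lower-value u′ lower))

    -- Heavy faces and their total weight.

    module Heaviness (n : ℕ) (n+1≤J : + n ℤ.+ 1ℤ ℤ.≤ J)
                     (A : Pred Face ℓ) (A-dim : ∀ x → A x → dim x ≡ + n)
                     (η : Carrier) (0<η : 0# < η) (η≤1 : η ≤ 1#) where

      open Thresholds η 0<η η≤1 n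

      n≤n+1 : + n ℤ.≤ + n ℤ.+ 1ℤ
      n≤n+1 = ℤ.+≤+ (ℕ.m≤m+n n 1)

      n≤J : + n ℤ.≤ J
      n≤J = ℤ.≤-trans n≤n+1 n+1≤J

      p : Face → Carrier
      p x = θ (dim x) * w x

      0<p : ∀ x → 0# < p x
      0<p x = *-pos (0<θ (dim x)) (positive x)

      0≤p : ∀ x → 0# ≤ p x
      0≤p x = <⇒≤ (0<p x)

      -- H m consists of the heavy faces of dimension at least n - m.
      H : ℕ → Pred Face ℓ
      H zero    v = A v
      H (suc m) v = H m v ⊎
        (dim v ≡ + n ℤ.- + suc m × p v ≤ ∫ (λ x → H m x × v ⊑ x) p)

      -- After `n` levels dimension 0 is reached. The empty face is thus never heavy, by
      -- construction; the hypothesis `small` below supplies what lightness supplies for the other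
      -- faces.
      Heavy : Pred Face ℓ
      Heavy = H n

      H-mono : ∀ {m m′ x} → m ℕ.≤ m′ → H m x → H m′ x
      H-mono {m} {m′} m≤m′ h = go (ℕ.≤⇒≤′ m≤m′)
        where
        go : ∀ {m′} → m ℕ.≤′ m′ → H m′ _
        go ℕ.≤′-refl       = h
        go (ℕ.≤′-step m≤m″) = inj₁ (go m≤m″)

      A⇒Heavy : ∀ {x} → A x → Heavy x
      A⇒Heavy = H-mono {0} {n} ℕ.z≤n

      n-m≤n : ∀ m → + n ℤ.- + m ℤ.≤ + n
      n-m≤n m = ℤ.i-j≤i (+ n) (+ m)

      H-dim≤n : ∀ m {x} → H m x → dim x ℤ.≤ + n
      H-dim≤n zero    a              = ℤ.≤-reflexive (A-dim _ a)
      H-dim≤n (suc m) (inj₁ h)       = H-dim≤n m h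
      H-dim≤n (suc m) (inj₂ (e , _)) = ≡.subst (ℤ._≤ + n) (≡.sym e) (n-m≤n (suc m))

      n-anti : ∀ {m m′} → m ℕ.≤ m′ → + n ℤ.- + m′ ℤ.≤ + n ℤ.- + m
      n-anti m≤m′ = ℤ.+-monoʳ-≤ (+ n) (ℤ.neg-mono-≤ (ℤ.+≤+ m≤m′))

      H-dim≥ : ∀ m {x} → H m x → + n ℤ.- + m ℤ.≤ dim x
      H-dim≥ zero    a              =
        ℤ.≤-reflexive (≡.trans (ℤ.+-identityʳ (+ n)) (≡.sym (A-dim _ a)))
      H-dim≥ (suc m) (inj₁ h)       = ℤ.≤-trans (n-anti (ℕ.n≤1+n m)) (H-dim≥ m h)
      H-dim≥ (suc m) (inj₂ (e , _)) = ℤ.≤-reflexive (≡.sym e)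

      Heavy-0≤dim : ∀ {x} → Heavy x → 0ℤ ℤ.≤ dim x
      Heavy-0≤dim {x} h = ≡.subst (ℤ._≤ dim x) (ℤ.+-inverseʳ (+ n)) (H-dim≥ n h)

      -- Heaviness is decided once, at the level of the dimension of the face; later levels only add
      -- faces of smaller dimension.
      H-restrict : ∀ m m′ {x} → + n ℤ.- + m ℤ.≤ dim x → H m′ x → H m x
      H-restrict m zero _ a = H-mono {0} {m} ℕ.z≤n a
      H-restrict m (suc m′) n-m≤ h with suc m′ ℕ.≤? m
      ... | yes m′<m = H-mono m′<m h
      H-restrict m (suc m′) n-m≤ (inj₁ h) | no _ = H-restrict m m′ n-m≤ h
      H-restrict m (suc m′) n-m≤ (inj₂ (e , _)) | no m′≮m =
        contradiction (≡.subst (+ n ℤ.- + m ℤ.≤_) e n-m≤)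
          (ℤ.<⇒≱ (ℤ.+-monoʳ-< (+ n) (ℤ.neg-mono-< (ℤ.+<+ (ℕ.≰⇒> m′≮m)))))

      -- The p-weight of a newly added face is at most that of the heavy faces above it, and each of
      -- those has at most `𝔽` faces of the new dimension. One level therefore costs a factor of at
      -- most `1# + 𝔽`.
      ∫H : ∀ m → ∫ (H m) p ≤ (1# + 𝔽) ^ m * ∫ A w
      ∫H zero = ≤-reflexive (trans (∫-cong (λ _ a → a) (λ _ a → a) λ x a →
          trans (*-congʳ (trans (reflexive (≡.cong θ (A-dim x a))) θ-top)) (*-identityˡ (w x)))
        (sym (*-identityˡ _)))
      ∫H (suc m) = begin
        ∫ (H (suc m)) p                 ≤⟨ ∫-∪ (λ _ h → h) 0≤p ⟩
        ∫ (H m) p + ∫ New p             ≤⟨ +-monoʳ-≤ _ (∫-≤ (λ v → proj₂)) ⟩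
        ∫ (H m) p + ∫ New (λ v → ∫ (λ x → H m x × v ⊑ x) p)
          ≤⟨ +-monoʳ-≤ _ (∫-double-count 0≤p (0≤fromℕ Φ) (λ v x _ → proj₁)
               λ x h → ≤-trans (∫-⊆ (λ v ((e , _) , _ , v⊑x) → e , ∅≤ v , v⊑x) 0≤1ᶠ)
                 (N∅≤𝔽 (+ n ℤ.- + suc m) (ℤ.≤-trans (H-dim≤n m h) n≤J))) ⟩
        ∫ (H m) p + 𝔽 * ∫ (H m) p       ≈⟨ +-congʳ (*-identityˡ _) ⟨
        1# * ∫ (H m) p + 𝔽 * ∫ (H m) p  ≈⟨ distribʳ _ 1# 𝔽 ⟨
        (1# + 𝔽) * ∫ (H m) p            ≤⟨ *-monoˡ-≤ (+-nonNeg 0≤1 (0≤fromℕ Φ)) (∫H m) ⟩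
        (1# + 𝔽) * ((1# + 𝔽) ^ m * ∫ A w) ≈⟨ *-assoc _ _ _ ⟨
        (1# + 𝔽) ^ suc m * ∫ A w        ∎
        where
        open ≤R
        New : Pred Face ℓ
        New v = dim v ≡ + n ℤ.- + suc m × p v ≤ ∫ (λ x → H m x × v ⊑ x) p

      μ : Face → Carrier
      μ v = ∫ (λ x → Heavy x × v ⊑ x) p

      0≤μ : ∀ v → 0# ≤ μ v
      0≤μ v = ∫-nonNeg λ x _ → 0≤p x

      -- The test for `v` at level `suc m` only sees `H m`, whereas `μ` counts all heavy faces. The
      -- two agree above a light `v`: a heavy face there differs from `v`, so its dimension is
      -- larger and it already belongs to `H m`.
      light⇒μ< : ∀ v → ¬ Heavy v → 0ℤ ℤ.≤ dim v → dim v ℤ.< + n → μ v < p v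
      light⇒μ< v ¬h 0≤dv dv<n = ≰⇒> λ p≤μ → ¬h (H-mono m<n (inj₂ (dv , ≤-trans p≤μ
        (∫-⊆ (λ x (h , v⊑x) → H-restrict m n (n-m≤ x h v⊑x) h , v⊑x) 0≤p))))
        where
        m : ℕ
        m = proj₁ (i≤j⇒j≡i+n (ℤ.i<j⇒suc[i]≤j dv<n))
        n≡ : + n ≡ ℤ.suc (dim v) ℤ.+ + m
        n≡ = proj₂ (i≤j⇒j≡i+n (ℤ.i<j⇒suc[i]≤j dv<n))
        rearrange : ∀ a b → a ≡ (1ℤ ℤ.+ a ℤ.+ b) ℤ.- (1ℤ ℤ.+ b)
        rearrange = solve-∀
        rearrange′ : ∀ a b → 1ℤ ℤ.+ a ≡ (1ℤ ℤ.+ a ℤ.+ b) ℤ.- b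
        rearrange′ = solve-∀
        dv : dim v ≡ + n ℤ.- + suc m
        dv = ≡.trans (rearrange (dim v) (+ m)) (≡.cong (ℤ._- + suc m) (≡.sym n≡))
        m<n : m ℕ.< n
        m<n = ℤ.drop‿+≤+ (≡.subst (+ suc m ℤ.≤_) (≡.sym n≡)
          (ℤ.+-monoˡ-≤ (+ m) (ℤ.+-monoʳ-≤ 1ℤ 0≤dv)))
        n-m≤ : ∀ x → Heavy x → v ⊑ x → + n ℤ.- + m ℤ.≤ dim x
        n-m≤ x h v⊑x = ≡.subst (ℤ._≤ dim x)
          (≡.trans (rearrange′ (dim v) (+ m)) (≡.cong (ℤ._- + m) (≡.sym n≡)))
          (ℤ.i<j⇒suc[i]≤j (dim-strict (v⊑x , λ { ≡.refl → ¬h h })))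

      -- Light meetings and the weight of the bad faces.

      module Meetings (𝒫 : AbstractIntersectionProfile ℓ n) (isProfile : 𝒫 IsProfileFor X)
                      (B B′ : Carrier) (0≤B : 0# ≤ B) (0<B′ : 0# < B′)
                      (skeleton : ∀ {t l r} v → AbstractIntersectionProfile.Quad 𝒫 t l r (dim v) →
                        0ℤ ℤ.≤ dim v → ∃₂ λ α β → 0# ≤ β × α ≤ η * θ r ×
                        β * θ (dim v) ≤ B * (η * (θ r * θ r)) × IsSkeleton v (wᴸ v) t l r α β)
                      (skeleton∅ : ∀ {t l r} → AbstractIntersectionProfile.Quad 𝒫 t l r -1ℤ →
                        ∃₂ λ α β → 0# ≤ β × α ≤ η * θ r ×
                        β * θ -1ℤ ≤ B′ * B * (η * (θ r * θ r)) × IsSkeleton ∅ w t l r α β)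
                      (small : B′ * ((1# + 𝔽) ^ n * ∫ A w) ≤ θ -1ℤ) where

        open AbstractIntersectionProfile 𝒫

        𝔾 : Carrier
        𝔾 = (1# + 𝔽) ^ n

        ∫Heavy : ∫ Heavy p ≤ 𝔾 * ∫ A w
        ∫Heavy = ∫H n

        𝔻 : Carrier
        𝔻 = C * (C + B * (C * C))

        0≤𝔻′ : 0# ≤ C + B * (C * C)
        0≤𝔻′ = +-nonNeg 0≤C (*-nonNeg 0≤B (*-nonNeg 0≤C 0≤C))

        0≤𝔻 : 0# ≤ 𝔻
        0≤𝔻 = *-nonNeg 0≤C 0≤𝔻′

        Q≤n+1 : ∀ {t l r b} → Quad t l r b → t ℤ.≤ J
        Q≤n+1 q = ℤ.≤-trans (proj₁ (Quad-range q)) n+1≤J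

        θw≤p : ∀ {t l r b x} → Quad t l r b → Heavy x → dim x ≡ l ⊎ dim x ≡ r → θ r * w x ≤ p x
        θw≤p {x = x} q h (inj₁ ≡.refl) =
          *-monoʳ-≤ (0≤w x) (θ-mono (proj₁ (proj₂ (proj₂ (Quad-range q)))) (H-dim≤n n h))
        θw≤p q h (inj₂ ≡.refl) = ≤-refl

        -- Both cases are `skeleton-bound`. For `dim v` at least 0 expansion is used in the link of
        -- `v`, with `u = w v` and `s = θ (dim v)`, and lightness bounds `μ v`. For the empty face
        -- it is used in `X` with `u = 1#`, and `small` replaces lightness: there
        -- `s = B′ ⁻¹ * θ -1ℤ`, whose first factor cancels the `B′` in the bound on `β`.
        ∫Meeting : ∀ {t l r} v → Quad t l r (dim v) → ¬ Heavy v →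
                   ∫ (Meeting Heavy t l r v) w ≤ 𝔻 * (η * μ v)
        ∫Meeting {t} {l} {r} v q ¬h with 0ℤ ℤ.≤? dim v
        ... | yes 0≤dv = begin
          ∫ (Meeting Heavy t l r v) w
            ≤⟨ ∫-≤ (λ { z (≡.refl , v⊑z , _) →
              ≤-trans (wx≤C*wz*wᴸ v⊑z (Q≤n+1 q)) (≤-reflexive (sym (*-assoc _ _ _))) }) ⟩
          ∫ (Meeting Heavy t l r v) (λ z → C * w v * wᴸ v z)   ≈⟨ ∫-* (C * w v) (wᴸ v) ⟩
          C * w v * ∫ (Meeting Heavy t l r v) (wᴸ v)
            ≤⟨ *-monoˡ-≤ (*-nonNeg 0≤C (0≤w v)) (expander Heavy) ⟩
          C * w v * (α * W + β * (W * W))     ≈⟨ *-assoc _ _ _ ⟩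
          C * (w v * (α * W + β * (W * W)))
            ≤⟨ *-monoˡ-≤ 0≤C (skeleton-bound (0<θ r) (positive v)
                 (<⇒≤ 0<η) 0≤C 0≤β 0≤W (0≤μ v) θuW≤ (<⇒≤ (light⇒μ< v ¬h 0≤dv dv<n)) α≤ β≤) ⟩
          C * ((C + B * (C * C)) * (η * μ v)) ≈⟨ *-assoc _ _ _ ⟨
          𝔻 * (η * μ v)                       ∎
          where
          open ≤R
          α = proj₁ (skeleton v q 0≤dv)
          β = proj₁ (proj₂ (skeleton v q 0≤dv))
          0≤β = proj₁ (proj₂ (proj₂ (skeleton v q 0≤dv)))
          α≤ = proj₁ (proj₂ (proj₂ (proj₂ (skeleton v q 0≤dv))))
          β≤ = proj₁ (proj₂ (proj₂ (proj₂ (proj₂ (skeleton v q 0≤dv)))))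
          expander = proj₂ (proj₂ (proj₂ (proj₂ (proj₂ (skeleton v q 0≤dv)))))
          V : Pred Face ℓ
          V x = Heavy x × v ⊑ x × (dim x ≡ l ⊎ dim x ≡ r)
          W : Carrier
          W = ∫ V (wᴸ v)
          0≤W : 0# ≤ W
          0≤W = ∫-nonNeg λ x (_ , v⊑x , _) → wᴸ-nonNeg v⊑x
          dv<n : dim v ℤ.< + n
          dv<n = let t≤ , l<t , r≤l , b<r , _ = Quad-range q in
            ℤ.<-≤-trans b<r (ℤ.≤-trans r≤l
              (i<j+1⇒i≤j (ℤ.<-≤-trans l<t t≤)))
          θuW≤ : θ r * (w v * W) ≤ C * μ v
          θuW≤ = begin
            θ r * (w v * W)                      ≈⟨ *-congˡ (∫-* (w v) (wᴸ v)) ⟨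
            θ r * ∫ V (λ x → w v * wᴸ v x)       ≈⟨ ∫-* (θ r) _ ⟨
            ∫ V (λ x → θ r * (w v * wᴸ v x))     ≤⟨ ∫-≤ pointwise ⟩
            ∫ V (λ x → C * p x)                  ≈⟨ ∫-* C p ⟩
            C * ∫ V p
              ≤⟨ *-monoˡ-≤ 0≤C (∫-⊆ (λ x (h , v⊑x , _) → h , v⊑x) 0≤p) ⟩
            C * μ v                              ∎
            where
            pointwise : ∀ x → V x → θ r * (w v * wᴸ v x) ≤ C * p x
            pointwise x (h , v⊑x , dx) = begin
              θ r * (w v * wᴸ v x)
                ≤⟨ *-monoˡ-≤ (<⇒≤ (0<θ r)) (wz*wᴸ≤C*wx v⊑x (ℤ.≤-trans (H-dim≤n n h) n≤J)) ⟩
              θ r * (C * w x)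
                ≈⟨ Solver.solve 3 (λ a b c → a :* (b :* c) := b :* (a :* c)) refl (θ r) C (w x) ⟩
              C * (θ r * w x)      ≤⟨ *-monoˡ-≤ 0≤C (θw≤p q h dx) ⟩
              C * p x              ∎
              where open Solver using (_:*_; _:=_)
        ... | no dv<0 = begin
          ∫ (Meeting Heavy t l r v) w
            ≤⟨ ∫-⊆ (λ z m → ≡.subst (λ u → Meeting Heavy t l r u z) v≡∅ m) 0≤w ⟩
          ∫ (Meeting Heavy t l r ∅) w              ≤⟨ expander Heavy ⟩
          α * W + β * (W * W)                      ≈⟨ *-identityˡ _ ⟨
          1# * (α * W + β * (W * W))
            ≤⟨ skeleton-bound (0<θ r) 0<1 (<⇒≤ 0<η) 0≤C 0≤β 0≤W (0≤μ v) θuW≤ μ≤ α≤ β≤′ ⟩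
          (C + B * (C * C)) * (η * μ v)
            ≤⟨ *-monoʳ-≤ (*-nonNeg (<⇒≤ 0<η) (0≤μ v)) (x≤c*x 1≤C 0≤𝔻′) ⟩
          𝔻 * (η * μ v)                            ∎
          where
          open ≤R
          dv≡-1 : dim v ≡ -1ℤ
          dv≡-1 = ℤ.≤-antisym (i<j+1⇒i≤j {j = -1ℤ} (ℤ.≰⇒> dv<0)) (-1≤dim v)
          v≡∅ : v ≡ ∅
          v≡∅ = dim≡-1⇒≡∅ dv≡-1
          skel = skeleton∅ (≡.subst (Quad t l r) dv≡-1 q)
          α = proj₁ skel
          β = proj₁ (proj₂ skel)
          0≤β = proj₁ (proj₂ (proj₂ skel))
          α≤ = proj₁ (proj₂ (proj₂ (proj₂ skel)))
          β≤ = proj₁ (proj₂ (proj₂ (proj₂ (proj₂ skel))))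
          expander = proj₂ (proj₂ (proj₂ (proj₂ (proj₂ skel))))
          V : Pred Face ℓ
          V x = Heavy x × ∅ ⊑ x × (dim x ≡ l ⊎ dim x ≡ r)
          W : Carrier
          W = ∫ V w
          0≤W : 0# ≤ W
          0≤W = ∫-nonNeg λ x _ → 0≤w x
          s : Carrier
          s = B′ ⁻¹ * θ -1ℤ
          μ≤ : μ v ≤ s * 1#
          μ≤ = begin
            μ v          ≤⟨ ∫-⊆ (λ x → proj₁) 0≤p ⟩
            ∫ Heavy p    ≤⟨ ∫Heavy ⟩
            𝔾 * ∫ A w    ≤⟨ c*x≤y⇒x≤c⁻¹*y 0<B′ small ⟩
            s            ≈⟨ *-identityʳ s ⟨
            s * 1#       ∎
          β≤′ : β * s ≤ B * (η * (θ r * θ r))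
          β≤′ = begin
            β * (B′ ⁻¹ * θ -1ℤ)
              ≈⟨ solve 3 (λ a b c → a :* (b :* c) := b :* (a :* c)) refl β (B′ ⁻¹) (θ -1ℤ) ⟩
            B′ ⁻¹ * (β * θ -1ℤ)              ≤⟨ *-monoˡ-≤ (<⇒≤ (⁻¹-pos 0<B′)) β≤ ⟩
            B′ ⁻¹ * (B′ * B * (η * (θ r * θ r))) ≈⟨ *-congˡ (*-assoc B′ B _) ⟩
            B′ ⁻¹ * (B′ * (B * (η * (θ r * θ r)))) ≈⟨ x⁻¹*xy _ 0<B′ ⟩
            B * (η * (θ r * θ r)) ∎
            where open Solver using (solve; _:*_; _:=_)
          θuW≤ : θ r * (1# * W) ≤ C * μ v
          θuW≤ = begin
            θ r * (1# * W)                ≈⟨ *-congˡ (*-identityˡ W) ⟩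
            θ r * W                       ≈⟨ ∫-* (θ r) w ⟨
            ∫ V (λ x → θ r * w x)         ≤⟨ ∫-≤ (λ x (h , _ , dx) → θw≤p q h dx) ⟩
            ∫ V p
              ≤⟨ ∫-⊆ (λ x (h , ∅⊑x , _) → h , ≡.subst (_⊑ x) (≡.sym v≡∅) ∅⊑x) 0≤p ⟩
            μ v                           ≤⟨ x≤c*x 1≤C (0≤μ v) ⟩
            C * μ v                       ∎

        𝕞 : Carrier
        𝕞 = fromℕ (n ℕ.+ 3)

        0≤𝕞 : 0# ≤ 𝕞
        0≤𝕞 = 0≤fromℕ (n ℕ.+ 3)

        dims : List ℤ
        dims = dimsUpTo (n ℕ.+ 1)

        ∈dims : ∀ x → dim x ℤ.≤ + n ℤ.+ 1ℤ → dim x ∈ dims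
        ∈dims x dx≤ = ∈dimsUpTo (-1≤dim x) dx≤

        ∫-⋃-dims : ∀ {P : Pred Face ℓ} {Q : ℤ → Pred Face ℓ} {g c} → (∀ x → 0# ≤ g x) →
                   (∀ x → P x → ∃ λ i → i ∈ dims × Q i x) → (∀ i → ∫ (Q i) g ≤ c) → ∫ P g ≤ 𝕞 * c
        ∫-⋃-dims {Q = Q} {c = c} 0≤g cover bound =
          ≤-trans (∫-⋃ {Q = Q} dims 0≤g cover λ i _ → bound i)
          (≤-reflexive
            (*-congʳ (reflexive
              (≡.cong fromℕ (≡.trans (length-dimsUpTo (n ℕ.+ 1)) (ℕ.+-assoc n 1 2))))))

        count-below : ∀ x → dim x ℤ.≤ + n ℤ.+ 1ℤ → ∫ (_⊑ x) (const 1#) ≤ 𝕞 * 𝔽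
        count-below x dx≤ = ∫-⋃-dims {Q = λ i v → dim v ≡ i × ∅ ⊑ v × v ⊑ x} 0≤1ᶠ
          (λ v v⊑x → dim v , ∈dims v (ℤ.≤-trans (dim-mono v⊑x) dx≤) , ≡.refl , ∅≤ v , v⊑x)
          (λ i → N∅≤𝔽 i (ℤ.≤-trans dx≤ n+1≤J))

        -- The face `z` may be `y` itself or any face below it, because local confluence is needed
        -- wherever two descents inside `y` can part.
        Bad : Pred Face ℓ
        Bad y = dim y ≡ + n ℤ.+ 1ℤ × ∃ λ z → z ⊑ y × ∃ λ v → ¬ Heavy v × ∃₂ λ a a′ →
          Heavy a × Heavy a′ × a ⊑ z × a′ ⊑ z × Inf (Pair a a′) v × Quad (dim z) (dim a) (dim a′)
            (dim v)

        κ : Carrier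
        κ = 𝕞 * (𝕞 * (𝕞 * (C * (𝔻 * (𝕞 * 𝔽 * 𝔾)))))

        -- The factors of `κ` in order: three unions over the dimensions `t`, `l`, `r`; `C` for
        -- passing from `z` to the (n + 1)-faces above it; `𝔻` for expansion at `v`; `𝕞 * 𝔽` for the
        -- number of faces `v` below one heavy face; `𝔾` for the total heavy p-weight.
        ∫Bad : ∫ Bad w ≤ κ * (η * ∫ A w)
        ∫Bad = begin
          ∫ Bad w
            ≤⟨ ∫-⋃-dims {Q = λ t y → Bad y × ∃ λ l → ∃ λ r → Bad³ t l r y} 0≤w
                 (λ y bad@(_ , z , z⊑y , v , ¬h , a , a′ , ha , ha′ , a⊑z , a′⊑z , inf , q) →
                   dim z , ∈dims z (proj₁ (Quad-range q)) , bad , dim a , dim a′ , z , z⊑y , v ,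
                   (¬h , q) , ≡.refl , proj₁ inf a (inj₁ ≡.refl) ⟨⊑⟩ a⊑z ,
                   a , a′ , ha , ha′ , ≡.refl , ≡.refl , a⊑z , a′⊑z , inf)
                 (λ t → ∫-⋃-dims {Q = λ l y → Bad y × ∃ λ r → Bad³ t l r y} 0≤w
                   (λ { y (bad , l , r , b³@(z , _ , v , _ , _ , _ , a , a′ , ha , _ , ≡.refl , _))
                     →
                     l , ∈dims a (ℤ.≤-trans (H-dim≤n n ha) n≤n+1) , bad , r , b³ })
                   (λ l → ∫-⋃-dims {Q = λ r y → Bad y × Bad³ t l r y} 0≤w
                     (λ { y (bad , r ,
                       b³@(z , _ , v , _ , _ , _ , a , a′ , ha , ha′ , _ , ≡.refl , _)) →
                       r , ∈dims a′ (ℤ.≤-trans (H-dim≤n n ha′) n≤n+1) , bad , b³ })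
                     (∫Bad³ t l))) ⟩
          𝕞 * (𝕞 * (𝕞 * (C * (𝔻 * (η * (𝕞 * 𝔽 * (𝔾 * ∫ A w)))))))
            ≈⟨ solve 7 (λ m c d e f g a →
              m :* (m :* (m :* (c :* (d :* (e :* (m :* f :* (g :* a))))))) := m :*
                (m :* (m :* (c :* (d :* (m :* f :* g))))) :* (e :* a)) refl 𝕞 C 𝔻 η 𝔽 𝔾 (∫ A w) ⟩
          κ * (η * ∫ A w) ∎
          where
          open ≤R
          open Solver using (solve; _:*_; _:=_)
          _⟨⊑⟩_ : ∀ {x y z} → x ⊑ y → y ⊑ z → x ⊑ z
          _⟨⊑⟩_ = ⊑-trans
          Light : ℤ → ℤ → ℤ → Pred Face ℓ
          Light t l r v = ¬ Heavy v × Quad t l r (dim v)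
          Bad³ : ℤ → ℤ → ℤ → Pred Face ℓ
          Bad³ t l r y = ∃ λ z → z ⊑ y × ∃ λ v → Light t l r v × Meeting Heavy t l r v z
          module _ (t l r : ℤ) where
            Z : Pred Face ℓ
            Z z = ∃ λ v → Light t l r v × Meeting Heavy t l r v z
            ∫Bad³ : ∫ (λ y → Bad y × Bad³ t l r y) w ≤ C * (𝔻 * (η * (𝕞 * 𝔽 * (𝔾 * ∫ A w))))
            ∫Bad³ = begin
              ∫ (λ y → Bad y × Bad³ t l r y) w
                ≤⟨ ∫-cover {E = Z} {R = λ z y → dim y ≡ + n ℤ.+ 1ℤ × z ⊑ y} 0≤w
                     (λ y ((dy , _) , z , z⊑y , v , m) → z , (v , m) , dy , z⊑y) ⟩
              ∫ Z (λ z → ∫ (λ y → dim y ≡ + n ℤ.+ 1ℤ × z ⊑ y) w)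
                ≤⟨ ∫-≤ (λ z _ → ∫-above≤ z _ n+1≤J) ⟩
              ∫ Z (λ z → C * w z)  ≈⟨ ∫-* C w ⟩
              C * ∫ Z w            ≤⟨ *-monoˡ-≤ 0≤C (∫-cover 0≤w λ z z∈ → z∈) ⟩
              C * ∫ (Light t l r) (λ v → ∫ (Meeting Heavy t l r v) w)
                ≤⟨ *-monoˡ-≤ 0≤C (∫-≤ λ v (¬h , q) → ∫Meeting v q ¬h) ⟩
              C * ∫ (Light t l r) (λ v → 𝔻 * (η * μ v))
                ≈⟨ *-congˡ (trans (∫-* 𝔻 _) (*-congˡ (∫-* η μ))) ⟩
              C * (𝔻 * (η * ∫ (Light t l r) μ))
                ≤⟨ *-monoˡ-≤ 0≤C (*-monoˡ-≤ 0≤𝔻 (*-monoˡ-≤ (<⇒≤ 0<η) (≤-trans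
                     (∫-double-count 0≤p (*-nonNeg 0≤𝕞 (0≤fromℕ Φ)) (λ v x _ → proj₁)
                       λ x h → ≤-trans (∫-⊆ (λ v (_ , _ , v⊑x) → v⊑x) 0≤1ᶠ)
                         (count-below x (ℤ.≤-trans (H-dim≤n n h) n≤n+1)))
                     (*-monoˡ-≤ (*-nonNeg 0≤𝕞 (0≤fromℕ Φ)) ∫Heavy)))) ⟩
              C * (𝔻 * (η * (𝕞 * 𝔽 * (𝔾 * ∫ A w)))) ∎

        -- Descent along heavy faces and its confluence.

        infix 4 _⇝_ _⇝*_

        -- Only the target has to be heavy, so that a descent may start at an (n + 1)-face, which is
        -- never heavy.
        _⇝_ : Rel Face ℓ
        a ⇝ b = b ⊏ a × Heavy b × Ad (dim a) (dim b)

        _⇝*_ : Rel Face ℓ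
        _⇝*_ = Star _⇝_

        Terminal : Pred Face ℓ
        Terminal u = Heavy u × IsNormalForm _⇝_ u

        ⊏-wellFounded : WellFounded _⊏_
        ⊏-wellFounded = Subrelation.wellFounded rank-< (On.wellFounded rank <-wellFounded)
          where
          rank : Face → ℕ
          rank x = ℤ.∣ dim x ℤ.+ 1ℤ ∣
          +rank : ∀ x → + rank x ≡ dim x ℤ.+ 1ℤ
          +rank x = +∣i∣≡i (ℤ.+-monoˡ-≤ 1ℤ (-1≤dim x))
          rank-< : ∀ {x y} → x ⊏ y → rank x ℕ.< rank y
          rank-< {x} {y} x⊏y = ℤ.drop‿+<+ (≡.subst₂ ℤ._<_ (≡.sym (+rank x)) (≡.sym (+rank y))
            (ℤ.+-monoˡ-< 1ℤ (dim-strict x⊏y)))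

        ⇝*-⊑ : ∀ {x u} → x ⇝* u → u ⊑ x
        ⇝*-⊑ ε                    = ⊑-refl
        ⇝*-⊑ (((y⊑x , _) , _) ◅ s) = ⊑-trans (⇝*-⊑ s) y⊑x

        reach-terminal : ∀ x → Heavy x → ∃ λ u → x ⇝* u × Terminal u
        reach-terminal x h = go x h (⊏-wellFounded x)
          where
          go : ∀ x → Heavy x → Acc _⊏_ x → ∃ λ u → x ⇝* u × Terminal u
          go x h (acc rs) with em {∃ λ y → x ⇝ y}
          ... | no none = x , ε , h , none
          ... | yes (y , x⇝y@(y⊏x , hy , _)) =
            let u , y⇝*u , t = go y hy (rs y⊏x) in u , x⇝y ◅ y⇝*u , t

        module BelowGood {y : Face} (dy : dim y ≡ + n ℤ.+ 1ℤ) (¬bad : ¬ Bad y) where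

          _⟶_ : Rel Face ℓ
          a ⟶ b = a ⊑ y × a ⇝ b

          -- If `a₂` lies under `a₁`, the axiom `Ad-descend` gives a direct step between them.
          -- Otherwise an infimum `u` closes the diamond: a light `u` would make `y` bad, with `a`
          -- in the role of `z`, and the quadruple makes both steps to `u` admissible.
          meet : ∀ {a a₁ a₂} → a ⟶ a₁ → a ⟶ a₂ → dim a₂ ℤ.≤ dim a₁ →
                 ∃ λ u → Star _⟶_ a₁ u × Star _⟶_ a₂ u
          meet {a} {a₁} {a₂} (a⊑y , a₁⊏a , h₁ , ad₁) (_ , a₂⊏a , h₂ , ad₂) d₂≤d₁
            with isProfile a a₁ a₂ (a₁⊏a , ad₁) (a₂⊏a , ad₂) d₂≤d₁ | em {a₂ ≡ a₁}
          ... | _ | yes ≡.refl = a₁ , ε , ε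
          ... | inj₁ a₂⊑a₁ | no a₂≢a₁ = a₂ , (⊑-trans (proj₁ a₁⊏a) a⊑y , a₂⊏a₁ , h₂ ,
              Ad-descend (dim-strict a₁⊏a) (dim-strict a₂⊏a₁) (-1≤dim a₂) ad₁ ad₂) ◅ ε , ε
            where
            a₂⊏a₁ : a₂ ⊏ a₁
            a₂⊏a₁ = a₂⊑a₁ , a₂≢a₁
          ... | inj₂ quad | no _ with Inf-exists a₁ a₂
          ... | u , inf@(lower , _) with em {Heavy u}
          ... | no ¬h = contradiction (dy , a , a⊑y , u , ¬h , a₁ , a₂ , h₁ , h₂ ,
              proj₁ a₁⊏a , proj₁ a₂⊏a , inf , quad u inf) ¬bad
          ... | yes h = u , step a₁⊏a (lower a₁ (inj₁ ≡.refl)) (ℤ.<-≤-trans u<r r≤l) (proj₁ ads) ◅ ε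
                          , step a₂⊏a (lower a₂ (inj₂ ≡.refl)) u<r (proj₂ ads) ◅ ε
            where
            r≤l : dim a₂ ℤ.≤ dim a₁
            r≤l = d₂≤d₁
            u<r : dim u ℤ.< dim a₂
            u<r = proj₁ (proj₂ (proj₂ (proj₂ (Quad-range (quad u inf)))))
            ads : Ad (dim a₁) (dim u) × Ad (dim a₂) (dim u)
            ads = proj₂ (proj₂ (Quad⇒Ad (quad u inf)))
            step : ∀ {b} → b ⊏ a → u ⊑ b → dim u ℤ.< dim b → Ad (dim b) (dim u) → b ⟶ u
            step (b⊑a , _) u⊑b du<db ad =
              ⊑-trans b⊑a a⊑y , (u⊑b , λ { ≡.refl → ℤ.<-irrefl ≡.refl du<db }) , h , ad

          weakly-confluent : WeaklyConfluent _⟶_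
          weakly-confluent {a} {a₁} {a₂} s₁ s₂ with ℤ.≤-total (dim a₂) (dim a₁)
          ... | inj₁ d₂≤d₁ = meet s₁ s₂ d₂≤d₁
          ... | inj₂ d₁≤d₂ = let u , r₂ , r₁ = meet s₂ s₁ d₁≤d₂ in u , r₁ , r₂

          confluent : Confluent _⟶_
          confluent = sn&wcr⇒cr (Subrelation.wellFounded Plus⇒⊏ ⊏-wellFounded) weakly-confluent
            where
            Plus⇒⊏ : ∀ {a b} → Plus _⟶_ b a → a ⊏ b
            Plus⇒⊏ [ (_ , a⊏b , _) ]     = a⊏b
            Plus⇒⊏ (_ ∼⁺⟨ s ⟩ t) = FP.<-≤-trans (Plus⇒⊏ t) (proj₁ (Plus⇒⊏ s))

          lift : ∀ {x u} → x ⊑ y → x ⇝* u → Star _⟶_ x u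
          lift x⊑y ε                             = ε
          lift x⊑y (s@((x′⊑x , _) , _) ◅ s*) = (x⊑y , s) ◅ lift (⊑-trans x′⊑x x⊑y) s*

          top-step : ∀ {x} → A x → x ⊑ y → y ⟶ x
          top-step {x} a x⊑y =
            ⊑-refl , (x⊑y , λ { ≡.refl → n≢n+1 (≡.trans (≡.sym (A-dim x a)) dy) }) ,
            A⇒Heavy a , ≡.subst₂ Ad (≡.sym dy) (≡.sym (A-dim x a)) Ad-top
            where
            n≢n+1 : + n ≢ + n ℤ.+ 1ℤ
            n≢n+1 eq = ℤ.i≢suc[i] (≡.trans eq (ℤ.+-comm (+ n) 1ℤ))

          -- By `Ad-top` both faces are one step away from `y`. Their terminal faces are therefore
          -- normal forms of the same start, and confluence identifies them.
          same-terminal : ∀ {x₁ x₂ u} → A x₁ → A x₂ → x₁ ⊑ y → x₂ ⊑ y → Terminal u →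
                          x₁ ⇝* u → x₂ ⇝* u
          same-terminal {x₁} {x₂} {u} a₁ a₂ x₁⊑y x₂⊑y (_ , u-nf) x₁⇝*u =
            ≡.subst (x₂ ⇝*_) (≡.sym (confluent⇒unique-normal-form confluent
              (λ (v , _ , s) → u-nf (v , s)) (λ (v , _ , s) → proj₂ (proj₂ (proj₂ t₂)) (v , s))
              (top-step a₁ x₁⊑y ◅ lift x₁⊑y x₁⇝*u)
                (top-step a₂ x₂⊑y ◅ lift x₂⊑y (proj₁ (proj₂ t₂)))))
              (proj₁ (proj₂ t₂))
            where
            t₂ : ∃ λ u₂ → x₂ ⇝* u₂ × Terminal u₂
            t₂ = reach-terminal x₂ (A⇒Heavy a₂)

    -- The coboundary on total families.

    module InSheaf {R : CommutativeRing ℓ ℓ} (orientation : Orientation R X) (ℱ : Sheaf R X) where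

      open Orientation orientation
      open Sheaf ℱ
      module 𝒲 = WeightedSheaf d X w orientation ℱ

      -- Cochains of all degrees at once: families of stalk elements indexed by all faces.

      private
        module R = CommutativeRing R
        module Σ (y : Face) = Summation (Stalk.+ᴹ-commutativeMonoid y)

      Tot : Set ℓ
      Tot = ∀ x → Stalk.Carrierᴹ x

      infix 4 _◁_
      -- Stated through dimensions rather than through `⋖`, since `δ` selects its facets by
      -- dimension.
      _◁_ : Face → Face → Set ℓ
      x ◁ y = x ⊏ y × dim y ≡ dim x ℤ.+ 1ℤ

      module _ (y x : Face) where
        private
          module Y = Module (stalk y)
          module X′ = Module (stalk x)

        opaque
          incidence : X′.Carrierᴹ → Y.Carrierᴹ
          incidence m with em {x ◁ y}
          ... | yes x◁y = [ y ∶ x ] Y.*ₗ res (proj₁ x◁y) m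
          ... | no  _   = Y.0ᴹ

          incidence-yes : ∀ m .(x⊏y : x ⊏ y) → x ◁ y → incidence m Y.≈ᴹ [ y ∶ x ] Y.*ₗ res x⊏y m
          incidence-yes m x⊏y x◁y with em {x ◁ y}
          ... | yes _    = Y.≈ᴹ-refl
          ... | no ¬x◁y = contradiction x◁y ¬x◁y

          incidence-no : ∀ m → ¬ x ◁ y → incidence m Y.≈ᴹ Y.0ᴹ
          incidence-no m ¬x◁y with em {x ◁ y}
          ... | yes x◁y = contradiction x◁y ¬x◁y
          ... | no _    = Y.≈ᴹ-refl

          incidence-cong : ∀ {m m′} → m X′.≈ᴹ m′ → incidence m Y.≈ᴹ incidence m′
          incidence-cong m≈m′ with em {x ◁ y}
          ... | yes x◁y = Y.*ₗ-congˡ (IsModuleHomomorphism.⟦⟧-cong (res-hom (proj₁ x◁y)) m≈m′)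
          ... | no _    = Y.≈ᴹ-refl

          incidence-+ : ∀ m m′ → incidence (m X′.+ᴹ m′) Y.≈ᴹ incidence m Y.+ᴹ incidence m′
          incidence-+ m m′ with em {x ◁ y}
          ... | yes x◁y =
            Y.≈ᴹ-trans (Y.*ₗ-congˡ (IsModuleHomomorphism.+ᴹ-homo (res-hom (proj₁ x◁y)) m m′))
                            (Y.*ₗ-distribˡ _ _ _)
          ... | no _    = Y.≈ᴹ-sym (Y.+ᴹ-identityˡ Y.0ᴹ)

          incidence-0 : incidence X′.0ᴹ Y.≈ᴹ Y.0ᴹ
          incidence-0 with em {x ◁ y}
          ... | yes x◁y =
            Y.≈ᴹ-trans (Y.*ₗ-congˡ (IsModuleHomomorphism.0ᴹ-homo (res-hom (proj₁ x◁y))))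
                            (Y.*ₗ-zeroʳ _)
          ... | no _    = Y.≈ᴹ-refl

        incidence-≈0 : ∀ {m} → m X′.≈ᴹ X′.0ᴹ → incidence m Y.≈ᴹ Y.0ᴹ
        incidence-≈0 m≈0 = Y.≈ᴹ-trans (incidence-cong m≈0) incidence-0

      D : Tot → Tot
      D F y = Σ.sumL y elements λ x → incidence y x (F x)

      infix  4 _≈ᵀ_
      infixl 6 _+ᵀ_
      _≈ᵀ_ : Tot → Tot → Set ℓ
      F ≈ᵀ G = ∀ x → Stalk._≈ᴹ_ x (F x) (G x)

      _+ᵀ_ : Tot → Tot → Tot
      (F +ᵀ G) x = Stalk._+ᴹ_ x (F x) (G x)

      -ᵀ_ : Tot → Tot
      (-ᵀ F) x = Stalk.-ᴹ_ x (F x)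

      0ᵀ : Tot
      0ᵀ x = Stalk.0ᴹ x

      supp : Tot → Pred Face ℓ
      supp F x = ¬ Stalk._≈ᴹ_ x (F x) (Stalk.0ᴹ x)

      ¬supp⇒≈0 : ∀ {F x} → ¬ supp F x → Stalk._≈ᴹ_ x (F x) (Stalk.0ᴹ x)
      ¬supp⇒≈0 {F} {x} ¬s with em {Stalk._≈ᴹ_ x (F x) (Stalk.0ᴹ x)}
      ... | yes F≈0 = F≈0
      ... | no F≉0  = contradiction F≉0 ¬s

      D-cong : ∀ {F G : Tot} y → (∀ x → x ◁ y → Stalk._≈ᴹ_ x (F x) (G x)) →
        Stalk._≈ᴹ_ y (D F y) (D G y)
      D-cong {F} {G} y F≈G = Σ.sumL-cong y elements pointwise
        where
        open Stalk y using (_≈ᴹ_; ≈ᴹ-trans; ≈ᴹ-sym)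
        pointwise : ∀ x → incidence y x (F x) ≈ᴹ incidence y x (G x)
        pointwise x with em {x ◁ y}
        ... | yes x◁y = incidence-cong y x (F≈G x x◁y)
        ... | no ¬x◁y = ≈ᴹ-trans (incidence-no y x _ ¬x◁y) (≈ᴹ-sym (incidence-no y x _ ¬x◁y))

      D-≈0 : ∀ {F : Tot} y → (∀ x → x ◁ y → Stalk._≈ᴹ_ x (F x) (Stalk.0ᴹ x)) →
             Stalk._≈ᴹ_ y (D F y) (Stalk.0ᴹ y)
      D-≈0 {F} y F≈0 = Stalk.≈ᴹ-trans y (D-cong {F} {0ᵀ} y F≈0)
        (Σ.sumL-zero y elements λ x _ → incidence-0 y x)

      D-support : ∀ {F : Tot} {y} → supp (D F) y → ∃ λ x → x ◁ y × supp F x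
      D-support {F} {y} DF≉0 with em {∃ λ x → x ◁ y × supp F x}
      ... | yes found = found
      ... | no none   = contradiction
        (D-≈0 {F} y λ x x◁y → ¬supp⇒≈0 {F} λ F≉0 → none (x , x◁y , F≉0)) DF≉0

      D-+ : ∀ F G → D (F +ᵀ G) ≈ᵀ D F +ᵀ D G
      D-+ F G y = Stalk.≈ᴹ-trans y (Σ.sumL-cong y elements λ x → incidence-+ y x (F x) (G x))
        (Σ.sumL-+ y _ _ elements)

      D-neg : ∀ F → D (-ᵀ F) ≈ᵀ -ᵀ D F
      D-neg F y = inverseʳ-unique (D F y) (D (-ᵀ F) y) (Stalk.≈ᴹ-trans y
        (Stalk.≈ᴹ-sym y (D-+ F (-ᵀ F) y)) (D-≈0 {F +ᵀ (-ᵀ F)} y λ x _ → Stalk.-ᴹ‿inverseʳ x (F x)))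
        where open GroupProperties (Stalk.+ᴹ-group y) using (inverseʳ-unique)

      module _ (z : Face) where
        private
          module Z = Module (stalk z)

        ◁-◁ : ∀ {x y} → x ◁ y → y ◁ z → x ⊑ z × dim z ≡ dim x ℤ.+ (+ 2)
        ◁-◁ {x} (x⊏y , dy) (y⊏z , dz) = proj₁ (FP.<-≤-trans x⊏y (proj₁ y⊏z)) ,
          ≡.trans dz (≡.trans (≡.cong (ℤ._+ 1ℤ) dy) (ℤ.+-assoc (dim x) 1ℤ 1ℤ))

        ⊏-⊏ : ∀ {x y} → dim z ≡ dim x ℤ.+ (+ 2) → x ⊏ y → y ⊏ z → x ◁ y × y ◁ z
        ⊏-⊏ {x} {y} dz x⊏y y⊏z = (x⊏y , dy) , y⊏z , ≡.trans dz (≡.trans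
            (≡.sym (ℤ.+-assoc (dim x) 1ℤ 1ℤ)) (≡.cong (ℤ._+ 1ℤ) (≡.sym dy)))
          where
          dy : dim y ≡ dim x ℤ.+ 1ℤ
          dy = ℤ.≤-antisym
            (i<j+1⇒i≤j
              (≡.subst (dim y ℤ.<_) (≡.trans dz (≡.sym (ℤ.+-assoc (dim x) 1ℤ 1ℤ)))
                (FP.dim-strict y⊏z)))
            (≡.subst (ℤ._≤ dim y) (ℤ.+-comm 1ℤ (dim x)) (ℤ.i<j⇒suc[i]≤j (FP.dim-strict x⊏y)))

        -- The component of `D ∘ D` from `x` to `z`. Unless `z` lies above `x` with dimension larger
        -- by two, no intermediate face contributes. If it does, all composed restrictions equal the
        -- one from `x` to `z`, and the coefficients add up to zero by the orientation axiom.
        incidence² : ∀ x (m : Stalk.Carrierᴹ x) →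
                     Σ.sumL z elements (λ y → incidence z y (incidence y x m)) Z.≈ᴹ Z.0ᴹ
        incidence² x m with em {x ⊑ z × dim z ≡ dim x ℤ.+ (+ 2)}
        ... | no ¬xz = Σ.sumL-zero z elements λ y _ → vanish y
          where
          vanish : ∀ y → incidence z y (incidence y x m) Z.≈ᴹ Z.0ᴹ
          vanish y with em {y ◁ z} | em {x ◁ y}
          ... | no ¬y◁z | _        = incidence-no z y _ ¬y◁z
          ... | yes _   | no ¬x◁y  = incidence-≈0 z y (incidence-no y x m ¬x◁y)
          ... | yes y◁z | yes x◁y  = contradiction (◁-◁ x◁y y◁z) ¬xz
        ... | yes (x⊑z , dz) = begin
          Σ.sumL z elements (λ y → incidence z y (incidence y x m))
            ≈⟨ Σ.sumL-cong z elements (λ y → pointwise y (em {x ⊏ y × y ⊏ z})) ⟩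
          Σ.sumL z elements (λ y → coefficient y Z.*ₗ r)
            ≈⟨ sumL-homo R.+-commutativeMonoid Z.+ᴹ-commutativeMonoid (Z._*ₗ r)
                 (Z.*ₗ-zeroˡ r) (Z.*ₗ-distribʳ r) coefficient elements ⟨
          Summation.sumL R.+-commutativeMonoid elements coefficient Z.*ₗ r
            ≈⟨ Z.*ₗ-congʳ (R.trans (R.sym coefficient-sum) (cancel x⊑z dz)) ⟩
          R.0# Z.*ₗ r
            ≈⟨ Z.*ₗ-zeroˡ r ⟩
          Z.0ᴹ ∎
          where
          open import Relation.Binary.Reasoning.Setoid Z.≈ᴹ-setoid
          x⊏z : x ⊏ z
          x⊏z = x⊑z , λ { ≡.refl → dim≢dim+2 dz }
            where
            dim≢dim+2 : ∀ {i} → i ≢ i ℤ.+ (+ 2)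
            dim≢dim+2 {i} eq with ≡.trans (≡.sym (ℤ.+-inverseˡ i))
              (≡.trans (≡.cong (λ j → ℤ.- i ℤ.+ j) eq)
              (≡.trans (≡.sym (ℤ.+-assoc (ℤ.- i) i (+ 2))) (≡.cong (ℤ._+ (+ 2)) (ℤ.+-inverseˡ i))))
            ... | ()
          r : Z.Carrierᴹ
          r = res x⊏z m
          opaque
            coefficient : Face → R.Carrier
            coefficient y with em {x ⊏ y × y ⊏ z}
            ... | yes _ = [ z ∶ y ] R.* [ y ∶ x ]
            ... | no  _ = R.0#
            coefficient-yes : ∀ y → x ⊏ y × y ⊏ z → [ z ∶ y ] R.* [ y ∶ x ] R.≈ coefficient y
            coefficient-yes y p with em {x ⊏ y × y ⊏ z}
            ... | yes _ = R.refl
            ... | no ¬p = contradiction p ¬p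
            coefficient-no : ∀ y → ¬ (x ⊏ y × y ⊏ z) → coefficient y R.≈ R.0#
            coefficient-no y ¬p with em {x ⊏ y × y ⊏ z}
            ... | yes p = contradiction p ¬p
            ... | no _  = R.refl
          pointwise : ∀ y → Dec (x ⊏ y × y ⊏ z) →
                      incidence z y (incidence y x m) Z.≈ᴹ coefficient y Z.*ₗ r
          pointwise y (yes xyz@(x⊏y , y⊏z)) = begin
            incidence z y (incidence y x m)
              ≈⟨ incidence-cong z y (incidence-yes y x m x⊏y (proj₁ (⊏-⊏ dz x⊏y y⊏z))) ⟩
            incidence z y ([ y ∶ x ] Y.*ₗ res x⊏y m)
              ≈⟨ incidence-yes z y _ y⊏z (proj₂ (⊏-⊏ dz x⊏y y⊏z)) ⟩
            [ z ∶ y ] Z.*ₗ res y⊏z ([ y ∶ x ] Y.*ₗ res x⊏y m)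
              ≈⟨ Z.*ₗ-congˡ (IsModuleHomomorphism.*ₗ-homo (res-hom y⊏z) _ _) ⟩
            [ z ∶ y ] Z.*ₗ [ y ∶ x ] Z.*ₗ res y⊏z (res x⊏y m)
              ≈⟨ Z.*ₗ-congˡ (Z.*ₗ-congˡ (res-∘ x⊏y y⊏z x⊏z m)) ⟩
            [ z ∶ y ] Z.*ₗ [ y ∶ x ] Z.*ₗ r
              ≈⟨ Z.*ₗ-assoc _ _ r ⟨
            ([ z ∶ y ] R.* [ y ∶ x ]) Z.*ₗ r
              ≈⟨ Z.*ₗ-congʳ (coefficient-yes y xyz) ⟩
            coefficient y Z.*ₗ r ∎
            where module Y = Module (stalk y)
          pointwise y (no ¬p) = Z.≈ᴹ-trans (vanish (em {y ◁ z}) (em {x ◁ y}))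
              (Z.≈ᴹ-sym (Z.≈ᴹ-trans (Z.*ₗ-congʳ (coefficient-no y ¬p)) (Z.*ₗ-zeroˡ r)))
            where
            vanish : Dec (y ◁ z) → Dec (x ◁ y) → incidence z y (incidence y x m) Z.≈ᴹ Z.0ᴹ
            vanish (no ¬y◁z) _        = incidence-no z y _ ¬y◁z
            vanish (yes _) (no ¬x◁y)  = incidence-≈0 z y (incidence-no y x m ¬x◁y)
            vanish (yes y◁z) (yes x◁y) = contradiction (proj₁ x◁y , proj₁ y◁z) ¬p
          coefficient-sum : ∑ R.+-commutativeMonoid (faces ↾ (λ y → em {x ⊏ y × y ⊏ z}))
                              (λ y → [ z ∶ value y ] R.* [ value y ∶ x ]) R.≈
                            Summation.sumL R.+-commutativeMonoid elements coefficient
          coefficient-sum = Summation.∑-embed R.+-commutativeMonoid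
            (faces ↾ (λ y → em {x ⊏ y × y ⊏ z})) faces value value-injective _ coefficient
            (λ (y , [ p ]) → coefficient-yes y (recompute em p)) outside
            where
            outside : ∀ y → (∃ λ s → value s ≡ y) ⊎ coefficient y R.≈ R.0#
            outside y with em {x ⊏ y × y ⊏ z}
            ... | yes p = inj₁ ((y , [ p ]) , ≡.refl)
            ... | no ¬p = inj₂ (coefficient-no y ¬p)

      D∘D≈0 : ∀ F → D (D F) ≈ᵀ 0ᵀ
      D∘D≈0 F z = begin
        Σ.sumL z elements (λ y → incidence z y (Σ.sumL y elements λ x → incidence y x (F x)))
          ≈⟨ Σ.sumL-cong z elements
            (λ y → sumL-homo (Stalk.+ᴹ-commutativeMonoid y) (Stalk.+ᴹ-commutativeMonoid z)
               (incidence z y) (incidence-0 z y) (incidence-+ z y) _ elements) ⟩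
        Σ.sumL z elements (λ y → Σ.sumL z elements λ x → incidence z y (incidence y x (F x)))
          ≈⟨ Σ.sumL-swap z _ elements elements ⟩
        Σ.sumL z elements (λ x → Σ.sumL z elements λ y → incidence z y (incidence y x (F x)))
          ≈⟨ Σ.sumL-zero z elements (λ x _ → incidence² z x (F x)) ⟩
        Stalk.0ᴹ z ∎
        where open import Relation.Binary.Reasoning.Setoid (Stalk.≈ᴹ-setoid z)

      -- Norms, supports and the cochains of the definitions.

      infix 4 _≈ˣ_
      _≈ˣ_ : ∀ {x} → Stalk.Carrierᴹ x → Stalk.Carrierᴹ x → Set ℓ
      _≈ˣ_ {x} = Stalk._≈ᴹ_ x

      norm : Tot → Carrier
      norm F = ∫ (supp F) w

      norm-nonNeg : ∀ F → 0# ≤ norm F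
      norm-nonNeg F = ∫-nonNeg λ x _ → 0≤w x

      supp-cong : ∀ {F G x} → F x ≈ˣ G x → supp F x → supp G x
      supp-cong {x = x} F≈G F≉0 G≈0 = F≉0 (Stalk.≈ᴹ-trans x F≈G G≈0)

      supp-+ : ∀ F G x → supp (F +ᵀ G) x → supp F x ⊎ supp G x
      supp-+ F G x s with em {supp F x} | em {supp G x}
      ... | yes f | _     = inj₁ f
      ... | no _  | yes g = inj₂ g
      ... | no ¬f | no ¬g = contradiction (Stalk.≈ᴹ-trans x
              (Stalk.+ᴹ-cong x (¬supp⇒≈0 {F} ¬f) (¬supp⇒≈0 {G} ¬g)) (Stalk.+ᴹ-identityˡ x _)) s

      supp-neg : ∀ F x → supp (-ᵀ F) x → supp F x
      supp-neg F x s F≈0 = s (Stalk.≈ᴹ-trans x (Stalk.-ᴹ‿cong x F≈0) ε⁻¹≈ε)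
        where open GroupProperties (Stalk.+ᴹ-group x) using (ε⁻¹≈ε)

      -- Stated for an arbitrary index set so that it applies to the coboundary of `X` and to that
      -- of a link; facets missing from the index set do no harm as long as `G` vanishes there.
      ∑≈D : ∀ y {s} (S : FiniteSet s) (e : FiniteSet.Carrier S → Face)
        (τ : FiniteSet.Carrier S → Stalk.Carrierᴹ y)
            (G : Tot) → (∀ {s s′} → e s ≡ e s′ → s ≡ s′) →
            (∀ s → τ s ≈ˣ incidence y (e s) (G (e s))) →
            (∀ x → x ◁ y → supp G x → ∃ λ s → e s ≡ x) →
            ∑ (Stalk.+ᴹ-commutativeMonoid y) S τ ≈ˣ D G y
      ∑≈D y S e τ G e-inj τ≈ complete =
        Summation.∑-embed (Stalk.+ᴹ-commutativeMonoid y) S faces e e-inj τ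
          (λ x → incidence y x (G x)) τ≈ outside
        where
        outside : ∀ x → (∃ λ s → e s ≡ x) ⊎ incidence y x (G x) ≈ˣ Stalk.0ᴹ y
        outside x with em {x ◁ y} | em {supp G x}
        ... | no ¬x◁y | _      = inj₂ (incidence-no y x _ ¬x◁y)
        ... | yes _   | no ¬s  = inj₂ (incidence-≈0 y x (¬supp⇒≈0 {G} ¬s))
        ... | yes x◁y | yes s  = inj₁ (complete x x◁y s)

      -- A cochain of X in degree i is the restriction of a total cochain supported in dimension i.

      infix 4 _⊨_
      _⊨_ : ∀ {i} → 𝒲.C i → Tot → Set ℓ
      _⊨_ {i} f F = (∀ x → f x ≈ˣ F (value x)) × (∀ x → supp F x → dim x ≡ i)

      opaque
        tot : ∀ {i} → 𝒲.C i → Tot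
        tot {i} f x with dim x ℤ.≟ i
        ... | yes e = f (x , [ e ])
        ... | no _  = Stalk.0ᴹ x

        ⊨-tot : ∀ {i} (f : 𝒲.C i) → f ⊨ tot f
        ⊨-tot {i} f = agree , support
          where
          agree : ∀ x → f x ≈ˣ tot f (value x)
          agree (x , [ e ]) with dim x ℤ.≟ i
          ... | yes _ = Stalk.≈ᴹ-refl x
          ... | no ¬e = contradiction (recompute (dim x ℤ.≟ i) e) ¬e
          support : ∀ x → supp (tot f) x → dim x ≡ i
          support x s with dim x ℤ.≟ i
          ... | yes e = e
          ... | no _  = contradiction (Stalk.≈ᴹ-refl x) s

      module _ {i : ℤ} where

        ⊨-0 : _⊨_ {i} 𝒲.𝟎 0ᵀ
        ⊨-0 = (λ x → Stalk.≈ᴹ-refl (value x)) , λ x s → contradiction (Stalk.≈ᴹ-refl x) s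

        ⊨-⊕ : ∀ {f g : 𝒲.C i} {F G} → f ⊨ F → g ⊨ G → f 𝒲.⊕ g ⊨ F +ᵀ G
        ⊨-⊕ {F = F} {G} (f≈F , F-dim) (g≈G , G-dim) =
          (λ x → Stalk.+ᴹ-cong (value x) (f≈F x) (g≈G x)) ,
          λ x s → [ F-dim x , G-dim x ]′ (supp-+ F G x s)
          where open import Data.Sum.Base using ([_,_]′)

        ⊨-neg : ∀ {f : 𝒲.C i} {F} → f ⊨ F → (λ x → Stalk.-ᴹ_ (value x) (f x)) ⊨ -ᵀ F
        ⊨-neg {F = F} (f≈F , F-dim) =
          (λ x → Stalk.-ᴹ‿cong (value x) (f≈F x)) , λ x s → F-dim x (supp-neg F x s)

        ⊨-⊖ : ∀ {f g : 𝒲.C i} {F G} → f ⊨ F → g ⊨ G → f 𝒲.⊖ g ⊨ F +ᵀ (-ᵀ G)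
        ⊨-⊖ f⊨F g⊨G = ⊨-⊕ f⊨F (⊨-neg g⊨G)

        ⊨-≋ : ∀ {f g : 𝒲.C i} {F} → f 𝒲.≋ g → g ⊨ F → f ⊨ F
        ⊨-≋ f≋g (g≈F , F-dim) = (λ x → Stalk.≈ᴹ-trans (value x) (f≋g x) (g≈F x)) , F-dim

        ⊨⇒≈ᵀ : ∀ {f : 𝒲.C i} {F G} → f ⊨ F → f ⊨ G → F ≈ᵀ G
        ⊨⇒≈ᵀ {f} {F} {G} (f≈F , F-dim) (f≈G , G-dim) x with dim x ℤ.≟ i
        ... | yes e = Stalk.≈ᴹ-trans x (Stalk.≈ᴹ-sym x (f≈F (x , [ e ]))) (f≈G (x , [ e ]))
        ... | no ¬e =
          Stalk.≈ᴹ-trans x (¬supp⇒≈0 {F} (¬e ∘ F-dim x))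
            (Stalk.≈ᴹ-sym x (¬supp⇒≈0 {G} (¬e ∘ G-dim x)))

        ≋𝟎⇔ : ∀ {f : 𝒲.C i} {F} → f ⊨ F → (f 𝒲.≋ 𝒲.𝟎 → F ≈ᵀ 0ᵀ) × (F ≈ᵀ 0ᵀ → f 𝒲.≋ 𝒲.𝟎)
        ≋𝟎⇔ f⊨F = (λ f≋0 → ⊨⇒≈ᵀ f⊨F (⊨-≋ f≋0 ⊨-0)) ,
          λ F≈0 x → Stalk.≈ᴹ-trans (value x) (proj₁ f⊨F x) (F≈0 (value x))

        ‖‖≈norm : ∀ {f : 𝒲.C i} {F} → f ⊨ F → 𝒲.‖ f ‖ ≈ norm F
        ‖‖≈norm {f} {F} (f≈F , F-dim) = ∑≈∫ (enumerates-dim∣ i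
          (λ x f≉0 _ F≈0 → f≉0 (Stalk.≈ᴹ-trans (value x) (f≈F x) F≈0))
          (λ x F≉0 → F-dim x F≉0 , λ f≈0 →
            F≉0 (Stalk.≈ᴹ-trans x (Stalk.≈ᴹ-sym x (f≈F (x , [ F-dim x F≉0 ]))) f≈0))) w

      ⊨-δ : ∀ {i j} .(e : j ≡ i ℤ.+ 1ℤ) → j ≡ i ℤ.+ 1ℤ → ∀ {f : 𝒲.C i} {F} → f ⊨ F → 𝒲.δ e f ⊨ D F
      ⊨-δ {i} {j} e e′ {f} {F} (f≈F , F-dim) = agree , λ y s →
          let x , (_ , dy) , x∈ = D-support {F} s in ≡.trans dy (≡.trans (≡.cong (ℤ._+ 1ℤ) (F-dim x x∈)) (≡.sym e′))
        where
        agree : ∀ y → 𝒲.δ e f y ≈ˣ D F (value y)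
        agree (y , [ ey ]) = ∑≈D y (facesOfDim i ∣ (λ x → value x ⊑ y)) (value ∘ value) _ F
            (value-injective ∘ value-injective) pointwise complete
          where
          dy : dim y ≡ j
          dy = recompute (dim y ℤ.≟ j) ey
          pointwise : ∀ s → 𝒲.term e f (y , [ ey ]) s ≈ˣ incidence y (value (value s))
            (F (value (value s)))
          pointwise ((x , [ ex ]) , [ x⊑y ]) = Stalk.≈ᴹ-trans y
              (Stalk.*ₗ-congˡ y (IsModuleHomomorphism.⟦⟧-cong (res-hom x⊏y) (f≈F (x , [ ex ]))))
              (Stalk.≈ᴹ-sym y (incidence-yes y x (F x) x⊏y (x⊏y , dy≡)))
            where
            dx : dim x ≡ i
            dx = recompute (dim x ℤ.≟ i) ex
            x⊏y : x ⊏ y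
            x⊏y = 𝒲.facet-< dx (≡.trans dy e′) (recompute em x⊑y)
            dy≡ : dim y ≡ dim x ℤ.+ 1ℤ
            dy≡ = ≡.trans dy (≡.trans e′ (≡.cong (ℤ._+ 1ℤ) (≡.sym dx)))
          complete : ∀ x → x ◁ y → supp F x → ∃ λ s → value (value s) ≡ x
          complete x x◁y s = ((x , [ F-dim x s ]) , [ proj₁ (proj₁ x◁y) ]) , ≡.refl

      -- Cochains on a link and their coboundary expansion.

      module OnLink (u : Face) where

        module ℒ = 𝒲.Link u
        open GradedPoset (link X u) using () renaming
          (facesOfDim to facesOfDimᴸ; Face to Faceᴸ; dim to dimᴸ)

        infix 4 _⊨ᴸ_
        _⊨ᴸ_ : ∀ {m} → ℒ.C m → Tot → Set ℓ
        _⊨ᴸ_ {m} g G = (∀ x → g x ≈ˣ G (value (value x))) ×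
                       (∀ x → supp G x → u ⊑ x × dim x ℤ.- dim u ℤ.- 1ℤ ≡ m)

        opaque
          totᴸ : ∀ {m} → ℒ.C m → Tot
          totᴸ {m} g x with em {u ⊑ x} | dim x ℤ.- dim u ℤ.- 1ℤ ℤ.≟ m
          ... | yes u⊑x | yes e = g ((x , [ u⊑x ]) , [ e ])
          ... | yes _   | no _  = Stalk.0ᴹ x
          ... | no _    | _     = Stalk.0ᴹ x

          ⊨ᴸ-tot : ∀ {m} (g : ℒ.C m) → g ⊨ᴸ totᴸ g
          ⊨ᴸ-tot {m} g = agree , support
            where
            agree : ∀ x → g x ≈ˣ totᴸ g (value (value x))
            agree ((x , [ u⊑x ]) , [ e ]) with em {u ⊑ x} | dim x ℤ.- dim u ℤ.- 1ℤ ℤ.≟ m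
            ... | yes _ | yes _  = Stalk.≈ᴹ-refl x
            ... | yes _ | no ¬e  = contradiction (recompute (_ ℤ.≟ m) e) ¬e
            ... | no ¬u⊑x | _    = contradiction (recompute em u⊑x) ¬u⊑x
            support : ∀ x → supp (totᴸ g) x → u ⊑ x × dim x ℤ.- dim u ℤ.- 1ℤ ≡ m
            support x s with em {u ⊑ x} | dim x ℤ.- dim u ℤ.- 1ℤ ℤ.≟ m
            ... | yes u⊑x | yes e = u⊑x , e
            ... | yes _   | no _  = contradiction (Stalk.≈ᴹ-refl x) s
            ... | no _    | _     = contradiction (Stalk.≈ᴹ-refl x) s

        module _ {m : ℤ} where

          restrictᴸ : Tot → ℒ.C m
          restrictᴸ G x = G (value (value x))

          ⊨ᴸ-⊖ : ∀ {f g : ℒ.C m} {F G} → f ⊨ᴸ F → g ⊨ᴸ G → f ℒ.⊖ g ⊨ᴸ F +ᵀ (-ᵀ G)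
          ⊨ᴸ-⊖ {F = F} {G} (f≈F , F-supp) (g≈G , G-supp) =
            (λ x → Stalk.+ᴹ-cong (value (value x)) (f≈F x)
              (Stalk.-ᴹ‿cong (value (value x)) (g≈G x))) ,
            λ x s → [ F-supp x , G-supp x ∘ supp-neg G x ]′ (supp-+ F (-ᵀ G) x s)
            where open import Data.Sum.Base using ([_,_]′)

          ⊨ᴸ-≋ : ∀ {f g : ℒ.C m} {F} → f ℒ.≋ g → g ⊨ᴸ F → f ⊨ᴸ F
          ⊨ᴸ-≋ f≋g (g≈F , F-supp) =
            (λ x → Stalk.≈ᴹ-trans (value (value x)) (f≋g x) (g≈F x)) , F-supp

          ‖‖≈∫wᴸ : ∀ {g : ℒ.C m} {G} → g ⊨ᴸ G → ℒ.‖ g ‖ ≈ ∫ (supp G) (wᴸ u)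
          ‖‖≈∫wᴸ {g} {G} (g≈G , G-supp) =
            ∑≈∫-cong enumerates _ (wᴸ u) (λ s → linkWeight≈ u (value (value s)))
            where
            enumerates : Enumerates (facesOfDimᴸ m ∣ (λ x → ¬ g x ≈ˣ Stalk.0ᴹ (value (value x))))
                                    (value ∘ value ∘ value) (supp G)
            enumerates = enumerates-↾
              (enumerates-↾ {P′ = λ x → u ⊑ x × dim x ℤ.- dim u ℤ.- 1ℤ ≡ m}
                (enumerates-↾ {P′ =
                  u ⊑_} (enumerates-all {P = λ x → x ⊑ x} (λ x → ⊑-refl)) (λ x → em {u ⊑ x})
                    (λ x u⊑x → u⊑x) (λ x u⊑x → x , ≡.refl , u⊑x))
                (λ x → dimᴸ x ℤ.≟ m) (λ (x , [ u⊑x ]) e → recompute em u⊑x , e)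
                  (λ x (u⊑x , e) → (x , [ u⊑x ]) , ≡.refl , e))
              (λ x → em)
              (λ x g≉0 G≈0 → g≉0 (Stalk.≈ᴹ-trans (value (value x)) (g≈G x) G≈0))
              (λ x G≉0 → let u⊑x , e = G-supp x G≉0 ; x′ = ((x , [ u⊑x ]) , [ e ]) in
                x′ , ≡.refl , λ g≈0 → G≉0 (Stalk.≈ᴹ-trans x (Stalk.≈ᴹ-sym x (g≈G x′)) g≈0))

        -- The coboundary of a link is `D` itself. A family supported above `u` has its coboundary
        -- supported above `u`, and the facets of `y` that do not lie above `u` contribute zero.
        ⊨ᴸ-δ : ∀ {i j} .(e : j ≡ i ℤ.+ 1ℤ) → j ≡ i ℤ.+ 1ℤ → ∀ {f : ℒ.C i} {F} → f ⊨ᴸ F →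
          ℒ.δ e f ⊨ᴸ D F
        ⊨ᴸ-δ {i} {j} e e′ {f} {F} (f≈F , F-supp) = agree , support
          where
          support : ∀ y → supp (D F) y → u ⊑ y × dim y ℤ.- dim u ℤ.- 1ℤ ≡ j
          support y s = let x , (x⊏y , dy) , x∈ = D-support {F} s ; u⊑x , ex = F-supp x x∈ in
            ⊑-trans u⊑x (proj₁ x⊏y) ,
            ≡.trans (≡.cong (λ k → k ℤ.- dim u ℤ.- 1ℤ) dy)
              (≡.trans (linkDim-+1 (dim x) (dim u)) (≡.trans (≡.cong (ℤ._+ 1ℤ) ex) (≡.sym e′)))
          agree : ∀ y → ℒ.δ e f y ≈ˣ D F (value (value y))
          agree ((y , [ u⊑y ]) , [ ey ]) =
            ∑≈D y (facesOfDimᴸ i ∣ (λ x → value (value x) ⊑ y)) (value ∘ value ∘ value) _ F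
              (value-injective ∘ value-injective ∘ value-injective) pointwise complete
            where
            dy : dim y ℤ.- dim u ℤ.- 1ℤ ≡ j
            dy = recompute (_ ℤ.≟ j) ey
            pointwise : ∀ s → ℒ.term e f ((y , [ u⊑y ]) , [ ey ]) s ≈ˣ
                              incidence y (value (value (value s))) (F (value (value (value s))))
            pointwise (((x , [ u⊑x ]) , [ ex ]) , [ x⊑y ]) = Stalk.≈ᴹ-trans y
                (Stalk.*ₗ-congˡ y
                  (IsModuleHomomorphism.⟦⟧-cong (res-hom x⊏y) (f≈F ((x , [ u⊑x ]) , [ ex ]))))
                (Stalk.≈ᴹ-sym y (incidence-yes y x (F x) x⊏y (x⊏y , dy≡)))
              where
              dx : dim x ℤ.- dim u ℤ.- 1ℤ ≡ i
              dx = recompute (_ ℤ.≟ i) ex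
              dy≡ : dim y ≡ dim x ℤ.+ 1ℤ
              dy≡ = linkDim-injective (dim u) (≡.trans dy (≡.trans e′
                (≡.trans (≡.cong (ℤ._+ 1ℤ) (≡.sym dx)) (≡.sym (linkDim-+1 (dim x) (dim u))))))
              x⊏y : x ⊏ y
              x⊏y = 𝒲.facet-< ≡.refl dy≡ (recompute em x⊑y)
            complete : ∀ x → x ◁ y → supp F x → ∃ λ s → value (value (value s)) ≡ x
            complete x x◁y s = let u⊑x , ex = F-supp x s in
              (((x , [ u⊑x ]) , [ ex ]) , [ proj₁ (proj₁ x◁y) ]) , ≡.refl

        ⊨-extend : ∀ {k} {g : ℒ.C (k ℤ.- dim u ℤ.- 1ℤ)} {G} → g ⊨ᴸ G → 𝒲.extend {k} u g ⊨ G
        ⊨-extend {k} {g} {G} (g≈G , G-supp) =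
          agree , λ x s → linkDim-injective (dim u) (proj₂ (G-supp x s))
          where
          agree : ∀ x → 𝒲.extend {k} u g x ≈ˣ G (value x)
          agree (x , [ e ]) with em {u ⊑ x}
          ... | yes u⊑x = g≈G ((x , [ u⊑x ]) , [ ≡.cong (λ n → n ℤ.- dim u ℤ.- 1ℤ) e ])
          ... | no ¬u⊑x = Stalk.≈ᴹ-sym x (¬supp⇒≈0 {G} λ s → ¬u⊑x (proj₁ (G-supp x s)))

        i≡i-1+1 : ∀ i → i ≡ i ℤ.- 1ℤ ℤ.+ 1ℤ
        i≡i-1+1 = solve-∀

        -- Quantifying over the lower bounds `c` of the distance to the coboundaries keeps the
        -- infimum, and the cochain types of the link, out of the later arguments.
        link-expansion : ∀ {m n : ℤ} {ϵ} → m ≡ n ℤ.- dim u ℤ.- 1ℤ → 0# ≤ ϵ → ϵ 𝒲.≤cbe[ u ] m →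
          ∀ G → (∀ x → supp G x → u ⊑ x × dim x ≡ n) → ∀ c →
          (∀ G′ → (∀ x → supp G′ x → u ⊑ x × dim x ℤ.+ 1ℤ ≡ n) →
            c ≤ ∫ (supp (G +ᵀ (-ᵀ D G′))) (wᴸ u)) →
          ϵ * c ≤ ∫ (supp (D G)) (wᴸ u)
        link-expansion {m} {n} {ϵ} m≡ 0≤ϵ cbe G G-supp c c≤ = begin
          ϵ * c                    ≤⟨ *-monoˡ-≤ 0≤ϵ c≤dist ⟩
          ϵ * ℒ.distTo g ℒ.B
            ≤⟨ ≤sup-expansion (λ f → ℒ.distTo f ℒ.B) (λ f → ℒ.‖ ℒ.d f ‖) 0≤ϵ ‖‖-nonNeg cbe g ⟩
          ℒ.‖ ℒ.d g ‖              ≈⟨ ‖‖≈∫wᴸ (⊨ᴸ-δ ≡.refl ≡.refl g⊨G) ⟩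
          ∫ (supp (D G)) (wᴸ u)    ∎
          where
          open ≤R
          ‖‖-nonNeg′ : ∀ {i} (f : ℒ.C i) → 0# ≤ ℒ.‖ f ‖
          ‖‖-nonNeg′ f =
            ≤-trans (∫-nonNeg λ x s → wᴸ-nonNeg (proj₁ (proj₂ (⊨ᴸ-tot f) x s)))
              (≤-reflexive (sym (‖‖≈∫wᴸ (⊨ᴸ-tot f))))
          ‖‖-nonNeg : ∀ (f : ℒ.C m) → 0# ≤ ℒ.‖ ℒ.d f ‖
          ‖‖-nonNeg f = ‖‖-nonNeg′ (ℒ.d f)
          g : ℒ.C m
          g = restrictᴸ G
          g⊨G : g ⊨ᴸ G
          g⊨G = (λ x → Stalk.≈ᴹ-refl (value (value x))) , λ x s → let u⊑x , dx = G-supp x s in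
            u⊑x , ≡.trans (≡.cong (λ k → k ℤ.- dim u ℤ.- 1ℤ) dx) (≡.sym m≡)
          coboundary-dim : ∀ {i} → i ℤ.- dim u ℤ.- 1ℤ ≡ m ℤ.- 1ℤ → i ℤ.+ 1ℤ ≡ n
          coboundary-dim {i} eq = linkDim-injective (dim u) (≡.trans (linkDim-+1 i (dim u))
            (≡.trans (≡.cong (ℤ._+ 1ℤ) eq) (≡.trans (≡.sym (i≡i-1+1 m)) m≡)))
          c≤dist : c ≤ ℒ.distTo g ℒ.B
          c≤dist = proj₂ (inf-glb (λ r → ∃ λ b → ℒ.B b × r ≈ ℒ.dist g b)
              (ℒ.dist g (ℒ.δ (i≡i-1+1 m) ℒ.𝟎) , ℒ.δ (i≡i-1+1 m) ℒ.𝟎 ,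
                (ℒ.𝟎 , λ x → Stalk.≈ᴹ-refl (value (value x))) , refl)
              (0# , λ r (b , _ , r≈) → ≤-trans (‖‖-nonNeg′ (g ℒ.⊖ b)) (≤-reflexive (sym r≈)))) c
            λ { r (b , (g′ , b≋δg′) , r≈) → begin
              c ≤⟨ c≤ (totᴸ g′) (λ x s → let u⊑x , dx = proj₂ (⊨ᴸ-tot g′) x s in u⊑x , coboundary-dim {dim x} dx) ⟩
              ∫ (supp (G +ᵀ (-ᵀ D (totᴸ g′)))) (wᴸ u)
                ≈⟨ ‖‖≈∫wᴸ (⊨ᴸ-⊖ g⊨G (⊨ᴸ-≋ b≋δg′ (⊨ᴸ-δ (i≡i-1+1 m) (i≡i-1+1 m) (⊨ᴸ-tot g′)))) ⟨
              ℒ.dist g b ≈⟨ r≈ ⟨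
              r ∎ }

      -- Norm estimates and representatives of least weight.

      norm-≤ : ∀ {F G} → (∀ x → supp F x → supp G x) → norm F ≤ norm G
      norm-≤ F⊆G = ∫-⊆ F⊆G 0≤w

      norm-cong : ∀ {F G} → F ≈ᵀ G → norm F ≈ norm G
      norm-cong {F} {G} F≈G = antisym
        (norm-≤ {F} {G} λ x → supp-cong {F} {G} (F≈G x))
        (norm-≤ {G} {F} λ x → supp-cong {G} {F} (Stalk.≈ᴹ-sym x (F≈G x)))

      norm-+ : ∀ F G → norm (F +ᵀ G) ≤ norm F + norm G
      norm-+ F G = ∫-∪ (supp-+ F G) 0≤w

      norm-dim : ∀ {F j u} → j ℤ.≤ J → (∀ x → supp F x → u ⊑ x × dim x ≡ j) → norm F ≤ C * w u
      norm-dim {F} {j} {u} j≤J F-supp = ≤-trans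
        (∫-⊆ (λ x s → let u⊑x , dx = F-supp x s in dx , u⊑x) 0≤w) (∫-above≤ u j j≤J)

      norm-D : ∀ {F j} → j ℤ.+ 1ℤ ℤ.≤ J → (∀ x → supp F x → dim x ≡ j) → norm (D F) ≤ C * norm F
      norm-D {F} {j} j+1≤J F-dim = begin
        norm (D F)
          ≤⟨ ∫-cover 0≤w (λ y s → let x , (x⊏y , dy) , s′ = D-support {F} s in
               x , s′ , ≡.trans dy (≡.cong (ℤ._+ 1ℤ) (F-dim x s′)) , proj₁ x⊏y) ⟩
        ∫ (supp F) (λ x → ∫ (λ y → dim y ≡ j ℤ.+ 1ℤ × x ⊑ y) w)
          ≤⟨ ∫-≤ (λ x _ → ∫-above≤ x (j ℤ.+ 1ℤ) j+1≤J) ⟩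
        ∫ (supp F) (λ x → C * w x) ≈⟨ ∫-* C w ⟩
        C * norm F ∎
        where open ≤R

      rank : Carrier → ℕ
      rank = proj₁ (∫-rank w)

      rank-< : ∀ F {v} → norm F < v → rank (norm F) ℕ.< rank v
      rank-< F = proj₂ (∫-rank w) (supp F)

      -- A norm is a sum of `w` over a set of faces, so only finitely many values occur, and
      -- repeated improvement by coboundaries must stop.
      minimise : ∀ j F → ∃ λ G → (∀ x → supp G x → dim x ℤ.+ 1ℤ ≡ j) × norm (F +ᵀ D G) ≤ norm F ×
        (∀ G′ → (∀ x → supp G′ x → dim x ℤ.+ 1ℤ ≡ j) → norm (F +ᵀ D G) ≤ norm (F +ᵀ D G +ᵀ D G′))
      minimise j F = go 0ᵀ (λ x s → contradiction (Stalk.≈ᴹ-refl x) s)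
          (≤-reflexive (norm-cong λ x →
            Stalk.≈ᴹ-trans x (Stalk.+ᴹ-congˡ x (D-≈0 {0ᵀ} x λ y _ → Stalk.≈ᴹ-refl y))
              (Stalk.+ᴹ-identityʳ x (F x))))
          (<-wellFounded _)
        where
        Degree : Tot → Set ℓ
        Degree G = ∀ x → supp G x → dim x ℤ.+ 1ℤ ≡ j
        go : ∀ G → Degree G → norm (F +ᵀ D G) ≤ norm F → Acc ℕ._<_ (rank (norm (F +ᵀ D G))) →
             ∃ λ G → Degree G × norm (F +ᵀ D G) ≤ norm F ×
               (∀ G′ → Degree G′ → norm (F +ᵀ D G) ≤ norm (F +ᵀ D G +ᵀ D G′))
        go G G-deg ≤F (acc rs) with em
          {∃ λ G′ → Degree G′ × norm (F +ᵀ D G +ᵀ D G′) < norm (F +ᵀ D G)}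
        ... | no none = G , G-deg , ≤F , least
          where
          least : ∀ G′ → Degree G′ → norm (F +ᵀ D G) ≤ norm (F +ᵀ D G +ᵀ D G′)
          least G′ G′-deg with em {norm (F +ᵀ D G) ≤ norm (F +ᵀ D G +ᵀ D G′)}
          ... | yes le = le
          ... | no ¬le = contradiction (G′ , G′-deg , ≰⇒> ¬le) none
        ... | yes (G′ , G′-deg , lt) =
          go (G +ᵀ G′) deg (≤-trans (<⇒≤ smaller) ≤F) (rs (rank-< (F +ᵀ D (G +ᵀ G′)) smaller))
          where
          deg : Degree (G +ᵀ G′)
          deg x s with supp-+ G G′ x s
          ... | inj₁ s₁ = G-deg x s₁
          ... | inj₂ s₂ = G′-deg x s₂
          smaller : norm (F +ᵀ D (G +ᵀ G′)) < norm (F +ᵀ D G)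
          smaller = ≤-<-trans (≤-reflexive (norm-cong λ x → Stalk.≈ᴹ-trans x
            (Stalk.+ᴹ-congˡ x (D-+ G G′ x)) (Stalk.≈ᴹ-sym x (Stalk.+ᴹ-assoc x _ _ _)))) lt

      D-F+DG : ∀ F G → D F ≈ᵀ 0ᵀ → D (F +ᵀ D G) ≈ᵀ 0ᵀ
      D-F+DG F G DF≈0 x = Stalk.≈ᴹ-trans x (D-+ F (D G) x)
        (Stalk.≈ᴹ-trans x (Stalk.+ᴹ-cong x (DF≈0 x) (D∘D≈0 G x)) (Stalk.+ᴹ-identityˡ x _))

      +ᵀ≈0⇒≈- : ∀ F G → F +ᵀ G ≈ᵀ 0ᵀ → F ≈ᵀ -ᵀ G
      +ᵀ≈0⇒≈- F G eq x = inverseˡ-unique (F x) (G x) (eq x)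
        where open GroupProperties (Stalk.+ᴹ-group x) using (inverseˡ-unique)

      Z⇒D≈0 : ∀ {i} {f : 𝒲.C i} {F} → f ⊨ F → 𝒲.Z f → D F ≈ᵀ 0ᵀ
      Z⇒D≈0 f⊨F = proj₁ (≋𝟎⇔ (⊨-δ ≡.refl ≡.refl f⊨F))

      D≈0⇒Z : ∀ {i} {f : 𝒲.C i} {F} → f ⊨ F → D F ≈ᵀ 0ᵀ → 𝒲.Z f
      D≈0⇒Z f⊨F = proj₂ (≋𝟎⇔ (⊨-δ ≡.refl ≡.refl f⊨F))

      -- A cocycle lighter than `c` has a representative of least weight in its class, which is no
      -- heavier. If that representative vanishes, the cocycle was a coboundary.
      ccd-bound : ∀ {k c} →
        (∀ F → (∀ x → supp F x → dim x ≡ + k) → D F ≈ᵀ 0ᵀ → norm F ≤ c →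
          (∀ G → (∀ x → supp G x → dim x ℤ.+ 1ℤ ≡ + k) → norm F ≤ norm (F +ᵀ (-ᵀ D G))) → F ≈ᵀ 0ᵀ) →
        c 𝒲.≤ccd (+ k)
      ccd-bound {k} {c} vanish r (f , f∈Z , f∉B , r≈) with em {c ≤ r}
      ... | yes c≤r = c≤r
      ... | no c≰r = contradiction f∈B f∉B
        where
        F : Tot
        F = tot f
        minimum = minimise (+ k) F
        G : Tot
        G = proj₁ minimum
        G-deg = proj₁ (proj₂ minimum)
        least = proj₂ (proj₂ (proj₂ minimum))
        F′-dim : ∀ x → supp (F +ᵀ D G) x → dim x ≡ + k
        F′-dim x s with supp-+ F (D G) x s
        ... | inj₁ s₁ = proj₂ (⊨-tot f) x s₁
        ... | inj₂ s₂ = let y , (_ , dx) , s₃ = D-support {G} s₂ in ≡.trans dx (G-deg y s₃)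
        F′≈0 : F +ᵀ D G ≈ᵀ 0ᵀ
        F′≈0 = vanish (F +ᵀ D G) F′-dim (D-F+DG F G (Z⇒D≈0 (⊨-tot f) f∈Z))
          (≤-trans (proj₁ (proj₂ (proj₂ minimum)))
            (≤-trans (≤-reflexive (trans (sym (‖‖≈norm (⊨-tot f))) (sym r≈))) (<⇒≤ (≰⇒> c≰r))))
          λ G′ G′-deg → ≤-trans (least (-ᵀ G′) λ x s → G′-deg x (supp-neg G′ x s))
            (≤-reflexive (norm-cong λ x → Stalk.+ᴹ-congˡ x (D-neg G′ x)))
        g : 𝒲.C (+ k ℤ.- 1ℤ)
        g x = Stalk.-ᴹ_ (value x) (G (value x))
        g⊨ : g ⊨ -ᵀ G
        g⊨ = (λ x → Stalk.≈ᴹ-refl (value x)) , λ x s →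
          ≡.trans (≡.sym (i+1-1 (dim x))) (≡.cong (ℤ._- 1ℤ) (G-deg x (supp-neg G x s)))
          where
          i+1-1 : ∀ i → i ℤ.+ 1ℤ ℤ.- 1ℤ ≡ i
          i+1-1 i = ≡.trans (ℤ.+-assoc i 1ℤ -1ℤ) (ℤ.+-identityʳ i)
        k≡k-1+1 : + k ≡ + k ℤ.- 1ℤ ℤ.+ 1ℤ
        k≡k-1+1 = ≡.sym (≡.trans (ℤ.+-assoc (+ k) -1ℤ 1ℤ) (ℤ.+-identityʳ (+ k)))
        f∈B : 𝒲.B f
        f∈B = g , λ x → Stalk.≈ᴹ-trans (value x) (proj₁ (⊨-tot f) x)
          (Stalk.≈ᴹ-trans (value x) (+ᵀ≈0⇒≈- F (D G) F′≈0 (value x))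
          (Stalk.≈ᴹ-trans (value x) (Stalk.≈ᴹ-sym (value x) (D-neg G (value x)))
            (Stalk.≈ᴹ-sym (value x) (proj₁ (⊨-δ k≡k-1+1 k≡k-1+1 g⊨) x))))

      -- Vanishing of light, locally minimal cocycles.

      module Vanishing (n : ℕ) (n+1≤J : + n ℤ.+ 1ℤ ℤ.≤ J) where

        module _ (F : Tot) (F-dim : ∀ x → supp F x → dim x ≡ + n) (DF≈0 : D F ≈ᵀ 0ᵀ)
                 (K ϵ : Carrier) (0<K : 0# < K) (0<ϵ : 0# < ϵ) (Kϵ≤1 : K * ϵ ≤ 1#) where

          open Thresholds (K * ϵ) (*-pos 0<K 0<ϵ) Kϵ≤1 n
          open Heaviness n n+1≤J (supp F) F-dim (K * ϵ) (*-pos 0<K 0<ϵ) Kϵ≤1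

          module _
            (𝒫 : AbstractIntersectionProfile ℓ n) (isProfile : 𝒫 IsProfileFor X)
            (B B′ : Carrier) (0≤B : 0# ≤ B) (0<B′ : 0# < B′)
            (skeleton : ∀ {t l r} v → AbstractIntersectionProfile.Quad 𝒫 t l r (dim v) →
              0ℤ ℤ.≤ dim v → ∃₂ λ α β → 0# ≤ β × α ≤ K * ϵ * θ r ×
              β * θ (dim v) ≤ B * (K * ϵ * (θ r * θ r)) × IsSkeleton v (wᴸ v) t l r α β)
            (skeleton∅ : ∀ {t l r} → AbstractIntersectionProfile.Quad 𝒫 t l r -1ℤ →
              ∃₂ λ α β → 0# ≤ β × α ≤ K * ϵ * θ r ×
              β * θ -1ℤ ≤ B′ * B * (K * ϵ * (θ r * θ r)) × IsSkeleton ∅ w t l r α β)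
            (small : B′ * ((1# + 𝔽) ^ n * ∫ (supp F) w) ≤ θ -1ℤ) where

            open Meetings 𝒫 isProfile B B′ 0≤B 0<B′ skeleton skeleton∅ small

            module _
              -- `q` is the error allowed in local minimality: zero for a representative of least
              -- weight, the parameter of the algorithm for one of its outputs.
              (q : Carrier) (q≤ : q ≤ K * θ 0ℤ) (K< : K * (C * C * (𝕞 * 𝔽 * κ) + 𝔾) < 1#)
              (linkExpansion : ∀ u → 0ℤ ℤ.≤ dim u → dim u ℤ.≤ + n →
                ∀ G → (∀ x → supp G x → u ⊑ x × dim x ≡ + n) → ∀ c →
                (∀ G′ → (∀ x → supp G′ x → u ⊑ x × dim x ℤ.+ 1ℤ ≡ + n) →
                  c ≤ ∫ (supp (G +ᵀ (-ᵀ D G′))) (wᴸ u)) →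
                ϵ * c ≤ ∫ (supp (D G)) (wᴸ u))
              (minimal : ∀ u → 0ℤ ℤ.≤ dim u → dim u ℤ.≤ + n →
                ∀ G′ → (∀ x → supp G′ x → u ⊑ x × dim x ℤ.+ 1ℤ ≡ + n) →
                ∫ (supp F) w ≤ ∫ (supp (F +ᵀ (-ᵀ D G′))) w + q * w u) where

              A : Pred Face ℓ
              A = supp F

              ∫A : Carrier
              ∫A = ∫ A w

              opaque
                part : Face → Tot
                part u x with em {x ⇝* u}
                ... | yes _ = F x
                ... | no  _ = Stalk.0ᴹ x

                part-yes : ∀ {u x} → x ⇝* u → Stalk._≈ᴹ_ x (part u x) (F x)
                part-yes {u} {x} s with em {x ⇝* u}
                ... | yes _ = Stalk.≈ᴹ-refl x
                ... | no ¬s = contradiction s ¬s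

                part-no : ∀ {u x} → ¬ x ⇝* u → Stalk._≈ᴹ_ x (part u x) (Stalk.0ᴹ x)
                part-no {u} {x} ¬s with em {x ⇝* u}
                ... | yes s = contradiction s ¬s
                ... | no _  = Stalk.≈ᴹ-refl x

              supp-part : ∀ {u x} → supp (part u) x → supp F x × x ⇝* u
              supp-part {u} {x} s with em {x ⇝* u}
              ... | yes x⇝u = (λ F≈0 → s (Stalk.≈ᴹ-trans x (part-yes x⇝u) F≈0)) , x⇝u
              ... | no ¬x⇝u = contradiction (part-no ¬x⇝u) s

              supp-D-part⇒Bad : ∀ {u y} → Terminal u → supp (D (part u)) y → u ⊑ y × Bad y
              supp-D-part⇒Bad {u} {y} t y∈ with D-support {part u} y∈
              ... | x , x◁y , x∈ with em {Bad y}
              ... | yes bad = ⊑-trans (⇝*-⊑ (proj₂ (supp-part x∈))) (proj₁ (proj₁ x◁y)) , bad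
              ... | no ¬bad =
                contradiction (Stalk.≈ᴹ-trans y (D-cong {part u} {F} y agree) (DF≈0 y)) y∈
                where
                x∈A = proj₁ (supp-part x∈)
                dy : dim y ≡ + n ℤ.+ 1ℤ
                dy = ≡.trans (proj₂ x◁y) (≡.cong (ℤ._+ 1ℤ) (F-dim x x∈A))
                agree : ∀ x′ → x′ ◁ y → Stalk._≈ᴹ_ x′ (part u x′) (F x′)
                agree x′ x′◁y with em {A x′}
                ... | yes x′∈A =
                  part-yes (BelowGood.same-terminal dy ¬bad x∈A x′∈A (proj₁ (proj₁ x◁y))
                                   (proj₁ (proj₁ x′◁y)) t (proj₂ (supp-part x∈)))
                ... | no x′∉A with em {x′ ⇝* u}
                ... | yes s = part-yes s
                ... | no ¬s = Stalk.≈ᴹ-trans x′ (part-no ¬s) (Stalk.≈ᴹ-sym x′ (¬supp⇒≈0 {F} x′∉A))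

              module _ (u : Face) (terminal : Terminal u) where

                0≤du : 0ℤ ℤ.≤ dim u
                0≤du = Heavy-0≤dim (proj₁ terminal)

                du≤n : dim u ℤ.≤ + n
                du≤n = H-dim≤n n (proj₁ terminal)

                a : Carrier
                a = ∫ (λ x → A x × x ⇝* u) w

                -- Minimality passes from F to its part, as norm F splits and norm is subadditive.
                part-minimal : ∀ G′ → (∀ x → supp G′ x → u ⊑ x × dim x ℤ.+ 1ℤ ≡ + n) →
                               a ≤ ∫ (supp (part u +ᵀ (-ᵀ D G′))) w + q * w u
                part-minimal G′ G′-supp = +-cancelʳ-≤ rest (begin
                  a + rest                      ≈⟨ ∫-split (_⇝* u) ⟨
                  ∫A                            ≤⟨ minimal u 0≤du du≤n G′ G′-supp ⟩
                  ∫ (supp (F +ᵀ (-ᵀ D G′))) w + q * w u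
                    ≤⟨ +-monoˡ-≤ _ (∫-∪ split 0≤w) ⟩
                  ∫ (supp (part u +ᵀ (-ᵀ D G′))) w + rest + q * w u
                    ≈⟨ solve 3 (λ a b c → a :+ b :+ c := a :+ c :+ b)
                      refl (∫ (supp (part u +ᵀ (-ᵀ D G′))) w) rest (q * w u) ⟩
                  ∫ (supp (part u +ᵀ (-ᵀ D G′))) w + q * w u + rest ∎)
                  where
                  open ≤R
                  open Solver using (solve; _:+_; _:=_)
                  rest : Carrier
                  rest = ∫ (λ x → A x × ¬ x ⇝* u) w
                  split : ∀ x → supp (F +ᵀ (-ᵀ D G′)) x →
                          supp (part u +ᵀ (-ᵀ D G′)) x ⊎ (A x × ¬ x ⇝* u)
                  split x x∈ with em {x ⇝* u} | em {A x}
                  ... | yes s | _ =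
                    inj₁ λ eq →
                      x∈ (Stalk.≈ᴹ-trans x (Stalk.+ᴹ-congʳ x (Stalk.≈ᴹ-sym x (part-yes s))) eq)
                  ... | no ¬s | yes x∈A = inj₂ (x∈A , ¬s)
                  ... | no ¬s | no x∉A = inj₁ λ eq → x∈ (Stalk.≈ᴹ-trans x (Stalk.+ᴹ-congʳ x
                        (Stalk.≈ᴹ-trans x (¬supp⇒≈0 {F} x∉A) (Stalk.≈ᴹ-sym x (part-no ¬s)))) eq)

                Cwu : Carrier
                Cwu = C * w u

                0<Cwu : 0# < Cwu
                0<Cwu = *-pos (<-≤-trans 0<1 1≤C) (positive u)

                difference-support : ∀ G′ → (∀ x → supp G′ x → u ⊑ x × dim x ℤ.+ 1ℤ ≡ + n) →
                                     ∀ x → supp (part u +ᵀ (-ᵀ D G′)) x → u ⊑ x × dim x ≡ + n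
                difference-support G′ G′-supp x x∈ with em {supp (part u) x} | em {supp (D G′) x}
                ... | yes s | _ = let x∈A , x⇝u = supp-part s in ⇝*-⊑ x⇝u , F-dim x x∈A
                ... | no _  | yes s = let x′ , (x′⊏x , dx) , s′ = D-support {G′} s
                                          u⊑x′ , dx′ = G′-supp x′ s′
                                      in ⊑-trans u⊑x′ (proj₁ x′⊏x) , ≡.trans dx dx′
                ... | no ¬s | no ¬s′ = contradiction (Stalk.≈ᴹ-trans x
                      (Stalk.+ᴹ-cong x (¬supp⇒≈0 {part u} ¬s)
                        (Stalk.≈ᴹ-trans x (Stalk.-ᴹ‿cong x (¬supp⇒≈0 {D G′} ¬s′)) (ε⁻¹≈ε)))
                      (Stalk.+ᴹ-identityˡ x (Stalk.0ᴹ x))) x∈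
                  where open GroupProperties (Stalk.+ᴹ-group x) using (ε⁻¹≈ε)

                BadAbove : Pred Face ℓ
                BadAbove y = Bad y × u ⊑ y

                -- Local minimality keeps the part far from the coboundaries of the link, so
                -- expansion there makes its coboundary heavy, yet that coboundary lives on bad
                -- faces. The two factors `C` pay for going to link weights and back.
                part-expansion : ϵ * a ≤ C * C * ∫ BadAbove w + ϵ * (q * w u)
                part-expansion = begin
                  ϵ * a
                    ≤⟨ *-monoˡ-≤ (<⇒≤ 0<ϵ) (x-z≤y⇒x≤y+z (≤-reflexive (sym (x*x⁻¹y _ 0<Cwu)))) ⟩
                  ϵ * (Cwu * c + q * w u)
                    ≈⟨ solve 4 (λ e k c b → e :* (k :* c :+ b) := k :* (e :* c) :+ e :* b)
                      refl ϵ Cwu c (q * w u) ⟩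
                  Cwu * (ϵ * c) + ϵ * (q * w u)
                    ≤⟨ +-monoˡ-≤ _ (*-monoˡ-≤ (<⇒≤ 0<Cwu) (linkExpansion u 0≤du du≤n (part u)
                         (λ x x∈ → let x∈A , x⇝u = supp-part x∈ in ⇝*-⊑ x⇝u , F-dim x x∈A) c c≤)) ⟩
                  Cwu * ∫ (supp (D (part u))) (wᴸ u) + ϵ * (q * w u)
                    ≤⟨ +-monoˡ-≤ _ (*-monoˡ-≤ (<⇒≤ 0<Cwu) (∫-mono
                         (λ y y∈ → let u⊑y , bad = supp-D-part⇒Bad terminal y∈ in (bad , u⊑y) , ≤-refl)
                         (λ y (_ , u⊑y) → wᴸ-nonNeg u⊑y))) ⟩
                  Cwu * ∫ BadAbove (wᴸ u) + ϵ * (q * w u)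
                    ≤⟨ +-monoˡ-≤ _ (begin
                      C * w u * ∫ BadAbove (wᴸ u)          ≈⟨ *-assoc C _ _ ⟩
                      C * (w u * ∫ BadAbove (wᴸ u))        ≈⟨ *-congˡ (∫-* (w u) (wᴸ u)) ⟨
                      C * ∫ BadAbove (λ y → w u * wᴸ u y)
                        ≤⟨ *-monoˡ-≤ 0≤C (∫-≤ λ y ((dy , _) , u⊑y) →
                          wz*wᴸ≤C*wx u⊑y (≡.subst (ℤ._≤ J) (≡.sym dy) n+1≤J)) ⟩
                      C * ∫ BadAbove (λ y → C * w y)       ≈⟨ *-congˡ (∫-* C w) ⟩
                      C * (C * ∫ BadAbove w)               ≈⟨ *-assoc C C _ ⟨
                      C * C * ∫ BadAbove w                 ∎) ⟩
                  C * C * ∫ BadAbove w + ϵ * (q * w u) ∎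
                  where
                  open ≤R
                  open Solver using (solve; _:*_; _:+_; _:=_)
                  -- A lower bound for the distance in the link: division by `C * w u` turns `w`
                  -- into `wᴸ u`, after the error `q * w u` has been taken off. It may be negative,
                  -- which the expansion hypothesis permits.
                  c : Carrier
                  c = Cwu ⁻¹ * (a - q * w u)
                  c≤ : ∀ G′ → (∀ x → supp G′ x → u ⊑ x × dim x ℤ.+ 1ℤ ≡ + n) →
                       c ≤ ∫ (supp (part u +ᵀ (-ᵀ D G′))) (wᴸ u)
                  c≤ G′ G′-supp =
                    x≤c*y⇒c⁻¹*x≤y 0<Cwu (x≤y+z⇒x-z≤y (≤-trans (part-minimal G′ G′-supp)
                    (+-monoˡ-≤ _ (≤-trans (∫-≤ λ x x∈ → let u⊑x , dx = difference-support G′ G′-supp x x∈ in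
                        ≤-trans (wx≤C*wz*wᴸ u⊑x (≡.subst (ℤ._≤ J) (≡.sym dx) n≤J))
                          (≤-reflexive (sym (*-assoc _ _ _))))
                      (≤-reflexive (∫-* Cwu (wᴸ u)))))))

              0≤∫A : 0# ≤ ∫A
              0≤∫A = ∫-nonNeg λ x _ → 0≤w x

              -- A terminal face is heavy, hence of dimension at least 0, and `θ` increases with the
              -- dimension. So `q * w u` is at most `K * p u`, and the bound on the heavy p-weight
              -- applies.
              q∫Terminal : q * ∫ Terminal w ≤ K * (𝔾 * ∫A)
              q∫Terminal = begin
                q * ∫ Terminal w           ≤⟨ *-monoʳ-≤ (∫-nonNeg λ x _ → 0≤w x) q≤ ⟩
                K * θ 0ℤ * ∫ Terminal w    ≈⟨ *-assoc K _ _ ⟩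
                K * (θ 0ℤ * ∫ Terminal w)  ≈⟨ *-congˡ (∫-* (θ 0ℤ) w) ⟨
                K * ∫ Terminal (λ u → θ 0ℤ * w u)
                  ≤⟨ *-monoˡ-≤ (<⇒≤ 0<K) (∫-mono (λ u (h , _) → h ,
                       *-monoʳ-≤ (0≤w u) (θ-mono (Heavy-0≤dim h) (H-dim≤n n h))) (λ u _ → 0≤p u)) ⟩
                K * ∫ Heavy p              ≤⟨ *-monoˡ-≤ (<⇒≤ 0<K) ∫Heavy ⟩
                K * (𝔾 * ∫A)               ∎
                where open ≤R

              -- Both terms on the right carry `K * ϵ`: the bad faces through `η`, the error through
              -- `q` and the factor `ϵ` in front of it. Cancelling `ϵ` leaves a contraction by a
              -- multiple of `K`. A bad face lies above at most `𝕞 * 𝔽` terminal faces.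
              ∫A-contracts : ∫A ≤ K * (C * C * (𝕞 * 𝔽 * κ) + 𝔾) * ∫A
              ∫A-contracts = *-cancelˡ-≤ 0<ϵ (begin
                ϵ * ∫A
                  ≤⟨ *-monoˡ-≤ (<⇒≤ 0<ϵ) (∫-cover 0≤w λ x x∈A →
                       let u , x⇝u , t = reach-terminal x (A⇒Heavy x∈A) in u , t , x∈A , x⇝u) ⟩
                ϵ * ∫ Terminal (λ u → ∫ (λ x → A x × x ⇝* u) w)   ≈⟨ ∫-* ϵ _ ⟨
                ∫ Terminal (λ u → ϵ * ∫ (λ x → A x × x ⇝* u) w)   ≤⟨ ∫-≤ part-expansion ⟩
                ∫ Terminal (λ u → C * C * ∫ (λ y → Bad y × u ⊑ y) w + ϵ * (q * w u))
                  ≈⟨ trans (∫-+ _ _) (+-cong (∫-* (C * C) _) (trans (∫-* ϵ _) (*-congˡ (∫-* q w))))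
                    ⟩
                C * C * ∫ Terminal (λ u → ∫ (λ y → Bad y × u ⊑ y) w) + ϵ * (q * ∫ Terminal w)
                  ≤⟨ +-mono-≤ (*-monoˡ-≤ (*-nonNeg 0≤C 0≤C) (≤-trans
                       (∫-double-count 0≤w 0≤𝕞𝔽 (λ u y _ → proj₁) λ y (dy , _) →
                         ≤-trans (∫-⊆ (λ u (_ , _ , u⊑y) → u⊑y) 0≤1ᶠ)
                           (count-below y (ℤ.≤-reflexive dy)))
                       (*-monoˡ-≤ 0≤𝕞𝔽 ∫Bad)))
                     (*-monoˡ-≤ (<⇒≤ 0<ϵ) q∫Terminal) ⟩
                C * C * (𝕞 * 𝔽 * (κ * (K * ϵ * ∫A))) + ϵ * (K * (𝔾 * ∫A))
                  ≈⟨ solve 7 (λ c m k K e a g →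
                    c :* (m :* (k :* (K :* e :* a))) :+ e :* (K :* (g :* a))
                       := e :* (K :* (c :* (m :* k) :+ g) :* a)) refl (C * C) (𝕞 * 𝔽) κ K ϵ ∫A 𝔾 ⟩
                ϵ * (K * (C * C * (𝕞 * 𝔽 * κ) + 𝔾) * ∫A) ∎)
                where
                open ≤R
                open Solver using (solve; _:*_; _:+_; _:=_)
                0≤𝕞𝔽 : 0# ≤ 𝕞 * 𝔽
                0≤𝕞𝔽 = *-nonNeg 0≤𝕞 (0≤fromℕ Φ)

              vanishing : F ≈ᵀ 0ᵀ
              vanishing x = ¬supp⇒≈0 {F} λ x∈A → <⇒≱ (positive∫A x∈A) ∫A≤0
                where
                open ≤R
                positive∫A : A x → 0# < ∫A
                positive∫A x∈A = <-≤-trans (positive x) (∫-point x∈A 0≤w)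
                ∫A≤0 : ∫A ≤ 0#
                ∫A≤0 with total ∫A 0#
                ... | inj₁ ≤0 = ≤0
                ... | inj₂ _ with em {∫A ≈ 0#}
                ... | yes ≈0 = ≤-reflexive ≈0
                ... | no ≉0 = contradiction (*-cancelˡ-≤ (0≤∫A , λ eq → ≉0 (sym eq)) (begin
                  ∫A * 1# ≈⟨ *-identityʳ ∫A ⟩
                  ∫A      ≤⟨ ∫A-contracts ⟩
                  K * (C * C * (𝕞 * 𝔽 * κ) + 𝔾) * ∫A ≈⟨ *-comm _ _ ⟩
                  ∫A * (K * (C * C * (𝕞 * 𝔽 * κ) + 𝔾)) ∎)) (<⇒≱ K<)

      -- Both n = k (for ccd) and n = k + 1 (for the Correction Algorithm) are needed, and the exponents
      -- in the hypotheses (2a) and (2b) are large enough for either.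
      module InDegree (k n : ℕ) (n+1≤J : + n ℤ.+ 1ℤ ℤ.≤ J) (k≤n : k ℕ.≤ n) (n≤k+1 : n ℕ.≤ k ℕ.+ 1) where

        open AbstractIntersectionProfile using (Quad; Quad-range)

        module _ (K ϵ : Carrier) (0<K : 0# < K) (0<ϵ : 0# < ϵ) (Kϵ≤1 : K * ϵ ≤ 1#) where

          0<η : 0# < K * ϵ
          0<η = *-pos 0<K 0<ϵ

          open Thresholds (K * ϵ) 0<η Kϵ≤1 n

          α : ℤ → Carrier
          α r = (K * ϵ) ^ (2 ℕ.^ ℤ.∣ + k ℤ.+ 1ℤ ℤ.- r ∣)

          e : ℤ → ℕ → ℕ
          e r g = 2 ℕ.^ ℤ.∣ + k ℤ.+ 1ℤ ℤ.- r ∣ ℕ.* (2 ℕ.^ g ℕ.∸ 1)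

          +∣n-r∣ : ∀ {m r} → r ℤ.≤ + m → + ℤ.∣ + m ℤ.- r ∣ ≡ + m ℤ.- r
          +∣n-r∣ r≤m = +∣i∣≡i (ℤ.i≤j⇒0≤j-i r≤m)

          module _ {r : ℤ} (r≤n : r ℤ.≤ + n) where

            r≤k+1 : r ℤ.≤ + (k ℕ.+ 1)
            r≤k+1 = ℤ.≤-trans r≤n (ℤ.+≤+ n≤k+1)

            ∣n-r∣≤ : ℤ.∣ + n ℤ.- r ∣ ℕ.≤ ℤ.∣ + (k ℕ.+ 1) ℤ.- r ∣
            ∣n-r∣≤ = ℤ.drop‿+≤+ (≡.subst₂ ℤ._≤_ (≡.sym (+∣n-r∣ r≤n)) (≡.sym (+∣n-r∣ r≤k+1))
              (ℤ.+-monoˡ-≤ (ℤ.- r) (ℤ.+≤+ n≤k+1)))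

            ≤1+∣n-r∣ : ℤ.∣ + (k ℕ.+ 1) ℤ.- r ∣ ℕ.≤ suc ℤ.∣ + n ℤ.- r ∣
            ≤1+∣n-r∣ = ℤ.drop‿+≤+ (≡.subst₂ ℤ._≤_ (≡.sym (+∣n-r∣ r≤k+1))
              (≡.trans (ℤ.+-assoc 1ℤ (+ n) (ℤ.- r)) (≡.cong (ℤ._+_ 1ℤ) (≡.sym (+∣n-r∣ r≤n))))
              (ℤ.+-monoˡ-≤ (ℤ.- r) (ℤ.+≤+ (ℕ.≤-trans (ℕ.≤-reflexive (ℕ.+-comm k 1)) (s≤s k≤n)))))

            -- The given exponent is `2 ^ (k + 1 - r)`, the required one `2 ^ (n - r)`; this is
            -- where `n ≤ k + 1` is needed.
            α≤ : α r ≤ K * ϵ * θ r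
            α≤ = ^-antitone {m = suc (exponent r)} {n =
              2 ℕ.^ ℤ.∣ + k ℤ.+ 1ℤ ℤ.- r ∣} 0<η Kϵ≤1 (begin
              suc (2 ℕ.^ ℤ.∣ + n ℤ.- r ∣ ℕ.∸ 1)  ≡⟨ ≡.sym (proj₂ (2^n-suc ℤ.∣ + n ℤ.- r ∣)) ⟩
              2 ℕ.^ ℤ.∣ + n ℤ.- r ∣              ≤⟨ ℕ.^-monoʳ-≤ 2 ∣n-r∣≤ ⟩
              2 ℕ.^ ℤ.∣ + k ℤ.+ 1ℤ ℤ.- r ∣       ∎)
              where open ℕ.≤-Reasoning

            -- Cleared of the inverse, this compares exponents of `η` as in `threshold-exponent`;
            -- `k ≤ n` enters through `k + 1 - r` being at most `1 + (n - r)`.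
            β≤ : ∀ {c b} g → b ℤ.< r → g ≡ ℤ.∣ (r ℤ.- 1ℤ) ℤ.- b ∣ → 0# ≤ c →
                 c * ((K * ϵ) ^ e r g) ⁻¹ * θ b ≤ c * (K * ϵ * (θ r * θ r))
            β≤ {c} {b} g b<r ≡.refl 0≤c = begin
              c * ((K * ϵ) ^ e r g) ⁻¹ * θ b     ≈⟨ *-assoc c _ _ ⟩
              c * (((K * ϵ) ^ e r g) ⁻¹ * θ b)
                ≤⟨ *-monoˡ-≤ 0≤c (x≤c*y⇒c⁻¹*x≤y (^-pos (e r g) 0<η) θb≤) ⟩
              c * (K * ϵ * (θ r * θ r))          ∎
              where
              open ≤R
              s : ℕ
              s = ℤ.∣ + n ℤ.- r ∣
              rearrange : ∀ m r b → 1ℤ ℤ.+ ((m ℤ.- r) ℤ.+ ((r ℤ.- 1ℤ) ℤ.- b)) ≡ m ℤ.- b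
              rearrange = solve-∀
              b≤r-1 : b ℤ.≤ r ℤ.- 1ℤ
              b≤r-1 = ≡.subst (b ℤ.≤_) (ℤ.+-comm -1ℤ r) (ℤ.i<j⇒i≤pred[j] b<r)
              b≤n : b ℤ.≤ + n
              b≤n = ℤ.≤-trans (ℤ.<⇒≤ b<r) r≤n
              n-b : suc (s ℕ.+ g) ≡ ℤ.∣ + n ℤ.- b ∣
              n-b = ℤ.+-injective (≡.trans
                (≡.cong₂ (λ i j → 1ℤ ℤ.+ (i ℤ.+ j)) (+∣n-r∣ r≤n) (+∣i∣≡i (ℤ.i≤j⇒0≤j-i b≤r-1)))
                (≡.trans (rearrange (+ n) r b) (≡.sym (+∣n-r∣ b≤n))))
              θb≤ : θ b ≤ (K * ϵ) ^ e r g * (K * ϵ * (θ r * θ r))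
              θb≤ = begin
                (K * ϵ) ^ (2 ℕ.^ ℤ.∣ + n ℤ.- b ∣ ℕ.∸ 1)
                  ≤⟨ ^-antitone {m = 1 ℕ.+ (exponent r ℕ.+ exponent r) ℕ.+ e r g} 0<η Kϵ≤1
                       (≡.subst (λ i → 1 ℕ.+ (exponent r ℕ.+ exponent r) ℕ.+ e r g ℕ.≤ 2 ℕ.^ i ℕ.∸
                         1) n-b
                         (threshold-exponent s ℤ.∣ + (k ℕ.+ 1) ℤ.- r ∣ g ≤1+∣n-r∣)) ⟩
                (K * ϵ) ^ (1 ℕ.+ (exponent r ℕ.+ exponent r) ℕ.+ e r g)
                  ≈⟨ ^-homo-* (K * ϵ) (1 ℕ.+ (exponent r ℕ.+ exponent r)) (e r g) ⟩
                (K * ϵ) ^ (1 ℕ.+ (exponent r ℕ.+ exponent r)) * (K * ϵ) ^ e r g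
                  ≈⟨ *-comm _ _ ⟩
                (K * ϵ) ^ e r g * (K * ϵ * (K * ϵ) ^ (exponent r ℕ.+ exponent r))
                  ≈⟨ *-congˡ (*-congˡ (^-homo-* (K * ϵ) (exponent r) (exponent r))) ⟩
                (K * ϵ) ^ e r g * (K * ϵ * (θ r * θ r)) ∎

          module _
            (𝒫 : AbstractIntersectionProfile ℓ n) (isProfile : 𝒫 IsProfileFor X)
            (B B′ : Carrier) (0≤B : 0# ≤ B) (0<B′ : 0# < B′)
            (contraction : K * Constants.contraction B Φ L k n < 1#)
            (cbe : ∀ u → 0ℤ ℤ.≤ dim u → dim u ℤ.≤ + n → ϵ 𝒲.≤cbe[ u ] (+ n ℤ.- dim u ℤ.- 1ℤ))
            (nih : ∀ t l r u → Quad 𝒫 t l r (dim u) → -1ℤ ℤ.< dim u →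
              IsSkeletonExpander (𝒲.NIHᴸ u l r t)
                (α r) (B * ((K * ϵ) ^ e r ℤ.∣ (r ℤ.- 1ℤ) ℤ.- dim u ∣) ⁻¹))
            (nih∅ : ∀ t l r → Quad 𝒫 t l r -1ℤ →
              IsSkeletonExpander (NIH l r t X w) (α r) (B′ * B * ((K * ϵ) ^ e r ℤ.∣ r ∣) ⁻¹)) where

            range : ∀ {t l r b} → Quad 𝒫 t l r b → r ℤ.≤ + n × b ℤ.< r × b ℤ.< l × -1ℤ ℤ.< l
            range q = let t≤ , l<t , r≤l , b<r , -1≤b = Quad-range 𝒫 q
                          b<l = ℤ.<-≤-trans b<r r≤l in
              ℤ.≤-trans r≤l (i<j+1⇒i≤j (ℤ.<-≤-trans l<t t≤)) , b<r , b<l , ℤ.≤-<-trans -1≤b b<l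

            0≤α : ∀ r → 0# ≤ α r
            0≤α r = <⇒≤ (^-pos (2 ℕ.^ ℤ.∣ + k ℤ.+ 1ℤ ℤ.- r ∣) 0<η)
            0≤e : ∀ r g → 0# ≤ ((K * ϵ) ^ e r g) ⁻¹
            0≤e r g = <⇒≤ (⁻¹-pos (^-pos (e r g) 0<η))

            β : ℤ → Carrier → ℕ → Carrier
            β r c g = c * ((K * ϵ) ^ e r g) ⁻¹

            0≤β : ∀ r {c} g → 0# ≤ c → 0# ≤ β r c g
            0≤β r g 0≤c = *-nonNeg 0≤c (0≤e r g)

            skeleton : ∀ {t l r} v → Quad 𝒫 t l r (dim v) → 0ℤ ℤ.≤ dim v → ∃₂ λ α β → 0# ≤ β ×
              α ≤ K * ϵ * θ r × β * θ (dim v) ≤ B * (K * ϵ * (θ r * θ r)) × IsSkeleton v (wᴸ v) t l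
                r α β
            skeleton {t} {l} {r} v quad 0≤dv =
              α r , β r B g , 0≤β r g 0≤B , α≤ (proj₁ (range quad)) ,
                β≤ (proj₁ (range quad)) {B} {dim v} g (proj₁ (proj₂ (range quad))) ≡.refl 0≤B ,
                skeleton-link {t} {l} {r} {α r} {β r B g} v (proj₁ (proj₂ (proj₂ (range quad))))
                  (0≤α r) (0≤β r g 0≤B)
                  (nih t l r v quad (ℤ.<-≤-trans ℤ.-<+ 0≤dv))
              where
              g : ℕ
              g = ℤ.∣ (r ℤ.- 1ℤ) ℤ.- dim v ∣

            r≡r-1+1 : ∀ r → r ≡ (r ℤ.- 1ℤ) ℤ.- -1ℤ
            r≡r-1+1 = solve-∀

            skeleton∅ : ∀ {t l r} → Quad 𝒫 t l r -1ℤ → ∃₂ λ α β → 0# ≤ β ×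
              α ≤ K * ϵ * θ r × β * θ -1ℤ ≤ B′ * B * (K * ϵ * (θ r * θ r)) × IsSkeleton ∅ w t l r α
                β
            skeleton∅ {t} {l} {r} quad =
              α r , β r (B′ * B) ℤ.∣ r ∣ , 0≤β r ℤ.∣ r ∣ 0≤B′B , α≤ (proj₁ (range quad)) ,
                β≤ (proj₁ (range quad)) {B′ * B} { -1ℤ} ℤ.∣ r ∣ (proj₁ (proj₂ (range quad)))
                  (≡.cong ℤ.∣_∣ (r≡r-1+1 r)) 0≤B′B ,
                skeleton-∅ {t} {l} {r} {α r} {β r (B′ * B) ℤ.∣ r ∣}
                  (proj₂ (proj₂ (proj₂ (range quad)))) (0≤α r) (0≤β r ℤ.∣ r ∣ 0≤B′B)
                    (nih∅ t l r quad)
              where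
              0≤B′B : 0# ≤ B′ * B
              0≤B′B = *-nonNeg (<⇒≤ 0<B′) 0≤B

            vanishing : ∀ F → (∀ x → supp F x → dim x ≡ + n) → D F ≈ᵀ 0ᵀ →
              B′ * ((1# + 𝔽) ^ n * norm F) ≤ θ -1ℤ → ∀ q → q ≤ K * θ 0ℤ →
              (∀ u → 0ℤ ℤ.≤ dim u → dim u ℤ.≤ + n →
                ∀ G → (∀ x → supp G x → u ⊑ x × dim x ℤ.+ 1ℤ ≡ + n) →
                norm F ≤ norm (F +ᵀ (-ᵀ D G)) + q * w u) →
              F ≈ᵀ 0ᵀ
            vanishing F F-dim DF≈0 small q q≤ minimal =
              Vanishing.vanishing n n+1≤J F F-dim DF≈0 K ϵ 0<K 0<ϵ Kϵ≤1
                𝒫 isProfile B B′ 0≤B 0<B′ skeleton skeleton∅ small q q≤ contraction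
                (λ u 0≤du du≤n → OnLink.link-expansion u {+ n ℤ.- dim u ℤ.- 1ℤ} {+ n} {ϵ} ≡.refl
                  (<⇒≤ 0<ϵ) (cbe u 0≤du du≤n))
                minimal

      -- The Correction Algorithm.

      module Correction (k : ℕ) (k+1≤J : + k ℤ.+ 1ℤ ℤ.≤ J) (q : Carrier) (0≤q : 0# ≤ q) where

        k≤J : + k ℤ.≤ J
        k≤J = ℤ.≤-trans (ℤ.+≤+ (ℕ.m≤m+n k 1)) k+1≤J

        Step : 𝒲.C (+ k) → 𝒲.C (+ k) → Set ℓ
        Step = 𝒲.CorrectionStep {+ k} q

        defect : 𝒲.C (+ k) → Carrier
        defect f = 𝒲.‖ 𝒲.d f ‖

        defect≈ : ∀ {f F} → f ⊨ F → defect f ≈ norm (D F)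
        defect≈ f⊨F = ‖‖≈norm (⊨-δ ≡.refl ≡.refl f⊨F)

        defect-nonNeg : ∀ f → 0# ≤ defect f
        defect-nonNeg f = ≤-trans (norm-nonNeg (D (tot f))) (≤-reflexive (sym (defect≈ (⊨-tot f))))

        dist≈ : ∀ {f g : 𝒲.C (+ k)} {F G} → f ⊨ F → g ⊨ G → 𝒲.dist f g ≈ norm (F +ᵀ (-ᵀ G))
        dist≈ f⊨F g⊨G = ‖‖≈norm (⊨-⊖ f⊨F g⊨G)

        dist-nonNeg : ∀ f g → 0# ≤ 𝒲.dist {+ k} f g
        dist-nonNeg f g =
          ≤-trans (norm-nonNeg (tot f +ᵀ (-ᵀ tot g)))
            (≤-reflexive (sym (dist≈ (⊨-tot f) (⊨-tot g))))

        -- The correction lives on the k-faces above `u`, whose total weight is at most `C * w u`.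
        step : ∀ {f f′} → Step f f′ → ∃ λ u →
               defect f′ < defect f - q * w u × (∀ f₀ → 𝒲.dist f₀ f′ ≤ 𝒲.dist f₀ f + C * w u)
        step {f} {f′} (u , 0≤du , du≤k , g , decrease , f′≋) =
          u , ≤-<-trans (≤-reflexive defect-f′) decrease , distance
          where
          G F : Tot
          G = OnLink.totᴸ u g
          F = tot f
          g⊨G : 𝒲.extend {+ k} u g ⊨ G
          g⊨G = OnLink.⊨-extend u (OnLink.⊨ᴸ-tot u g)
          f′⊨ : f′ ⊨ F +ᵀ G
          f′⊨ = ⊨-≋ f′≋ (⊨-⊕ (⊨-tot f) g⊨G)
          defect-f′ : defect f′ ≈ 𝒲.‖ 𝒲.d f 𝒲.⊕ 𝒲.d (𝒲.extend {+ k} u g) ‖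
          defect-f′ = trans (defect≈ f′⊨) (trans (norm-cong (D-+ F G))
            (sym (‖‖≈norm (⊨-⊕ (⊨-δ ≡.refl ≡.refl (⊨-tot f)) (⊨-δ ≡.refl ≡.refl g⊨G)))))
          distance : ∀ f₀ → 𝒲.dist f₀ f′ ≤ 𝒲.dist f₀ f + C * w u
          distance f₀ = begin
            𝒲.dist f₀ f′                        ≈⟨ dist≈ (⊨-tot f₀) f′⊨ ⟩
            norm (F₀ +ᵀ (-ᵀ (F +ᵀ G)))
              ≈⟨ norm-cong (λ x → Stalk.≈ᴹ-trans x (Stalk.+ᴹ-congˡ x (⁻¹-∙ x))
                                                     (Stalk.≈ᴹ-sym x (Stalk.+ᴹ-assoc x _ _ _))) ⟩
            norm (F₀ +ᵀ (-ᵀ F) +ᵀ (-ᵀ G))       ≤⟨ norm-+ (F₀ +ᵀ (-ᵀ F)) (-ᵀ G) ⟩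
            norm (F₀ +ᵀ (-ᵀ F)) + norm (-ᵀ G)
              ≤⟨ +-mono-≤ (≤-reflexive (sym (dist≈ (⊨-tot f₀) (⊨-tot f))))
                (norm-dim {j = + k} k≤J λ x s →
                   let s′ = supp-neg G x s in proj₁ (proj₂ (OnLink.⊨ᴸ-tot u g) x s′) , proj₂ g⊨G x s′) ⟩
            𝒲.dist f₀ f + C * w u               ∎
            where
            open ≤R
            F₀ : Tot
            F₀ = tot f₀
            ⁻¹-∙ : ∀ x → Stalk._≈ᴹ_ x ((-ᵀ (F +ᵀ G)) x) (((-ᵀ F) +ᵀ (-ᵀ G)) x)
            ⁻¹-∙ x = Stalk.≈ᴹ-trans x (⁻¹-anti-homo-∙ (F x) (G x)) (Stalk.+ᴹ-comm x _ _)
              where open GroupProperties (Stalk.+ᴹ-group x) using (⁻¹-anti-homo-∙)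

        -- The defect decreases strictly, even for `q` equal to zero, and takes only finitely many
        -- values.
        halts : WellFounded (flip Step)
        halts = Subrelation.wellFounded decreasing
          (On.wellFounded (rank ∘ norm ∘ D ∘ tot) <-wellFounded)
          where
          decreasing : ∀ {f′ f} → Step f f′ → rank (norm (D (tot f′))) ℕ.< rank (norm (D (tot f)))
          decreasing {f′} {f} s = let u , lt , _ = step s in rank-< (D (tot f′)) (<-≤-trans
            (≤-<-trans (≤-reflexive (sym (defect≈ (⊨-tot f′)))) lt)
            (≤-trans (x≤y+z⇒x-z≤y (x≤x+y (*-nonNeg 0≤q (0≤w u))))
              (≤-reflexive (defect≈ (⊨-tot f)))))

        normal-form : WeaklyNormalizing Step
        normal-form = terminating⇒normal-form em Step halts

        -- A step adds at most `C * w u` to the distance and removes more than `q * w u` from the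
        -- defect, so `q` times the distance plus `C` times the defect never increases.
        potential-steps : ∀ {f₀ f f′ b} → Star Step f f′ → q * 𝒲.dist f₀ f + C * defect f ≤ b →
                          q * 𝒲.dist f₀ f′ + C * defect f′ ≤ b
        potential-steps ε h = h
        potential-steps {f₀} {f} {f′} {b} (_◅_ {j = f₁} s ss) h = potential-steps ss (begin
          q * 𝒲.dist f₀ f₁ + C * defect f₁
            ≤⟨ +-mono-≤ (*-monoˡ-≤ 0≤q (distance f₀)) ≤-refl ⟩
          q * (𝒲.dist f₀ f + C * w u) + C * defect f₁
            ≈⟨ solve 5 (λ q d c w e → q :* (d :+ c :* w) :+ c :* e := q :* d :+ c :* (e :+ q :* w))
              refl q (𝒲.dist f₀ f) C (w u) (defect f₁) ⟩
          q * 𝒲.dist f₀ f + C * (defect f₁ + q * w u)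
            ≤⟨ +-monoʳ-≤ _
              (*-monoˡ-≤ 0≤C (≤-trans (+-monoˡ-≤ (q * w u) (<⇒≤ lt)) (≤-reflexive (x-y+y _ _)))) ⟩
          q * 𝒲.dist f₀ f + C * defect f
            ≤⟨ h ⟩
          b ∎)
          where
          open ≤R
          open Solver using (solve; _:*_; _:+_; _:=_)
          u : Face
          u = proj₁ (step s)
          lt : defect f₁ < defect f - q * w u
          lt = proj₁ (proj₂ (step s))
          distance : ∀ f₀ → 𝒲.dist f₀ f₁ ≤ 𝒲.dist f₀ f + C * w u
          distance = proj₂ (proj₂ (step s))

        dist-self : ∀ f → 𝒲.dist {+ k} f f ≈ 0#
        dist-self f =
          trans (dist≈ (⊨-tot f) (⊨-tot f)) (∫-empty λ x s → s (Stalk.-ᴹ‿inverseʳ x (tot f x)))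

        potential : ∀ {f f′} → Star Step f f′ → q * 𝒲.dist f f′ + C * defect f′ ≤ C * defect f
        potential {f} s = potential-steps s (≤-reflexive
          (trans (+-congʳ (trans (*-congˡ (dist-self f)) (zeroʳ q))) (+-identityˡ _)))

        q*dist≤ : ∀ {f f′} → Star Step f f′ → q * 𝒲.dist f f′ ≤ C * defect f
        q*dist≤ {f′ = f′} s = ≤-trans (x≤x+y (*-nonNeg 0≤C (defect-nonNeg f′))) (potential s)

        defect-≤ : ∀ {f f′} → Star Step f f′ → defect f′ ≤ defect f
        defect-≤ {f} {f′} s = *-cancelˡ-≤ (<-≤-trans 0<1 1≤C)
          (≤-trans (x≤y+x (*-nonNeg 0≤q (dist-nonNeg f f′))) (potential s))

        -- Links of faces of dimension k + 1 carry no cochains of degree k.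
        minimal-above : ∀ F u → ¬ dim u ℤ.≤ + k →
          ∀ G → (∀ x → supp G x → u ⊑ x × dim x ℤ.+ 1ℤ ≡ + k ℤ.+ 1ℤ) →
          norm F ≤ norm (F +ᵀ (-ᵀ D G)) + q * w u
        minimal-above F u du≰k G G-supp =
          ≤-trans (≤-reflexive (norm-cong λ x → Stalk.≈ᴹ-sym x (F-DG≈F x)))
            (x≤x+y (*-nonNeg 0≤q (0≤w u)))
          where
          G-empty : ∀ y → ¬ supp G y
          G-empty y s = du≰k (ℤ.≤-trans (dim-mono (proj₁ (G-supp y s)))
            (ℤ.≤-reflexive (+1-injective {dim y} {+ k} (proj₂ (G-supp y s)))))
          F-DG≈F : F +ᵀ (-ᵀ D G) ≈ᵀ F
          F-DG≈F x = Stalk.≈ᴹ-trans x (Stalk.+ᴹ-congˡ x (Stalk.≈ᴹ-trans x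
            (Stalk.-ᴹ‿cong x (D-≈0 {G} x λ y _ → ¬supp⇒≈0 {G} (G-empty y)))
            (GroupProperties.ε⁻¹≈ε (Stalk.+ᴹ-group x)))) (Stalk.+ᴹ-identityʳ x _)

        decrease⇒step : ∀ {f u} → 0ℤ ℤ.≤ dim u → dim u ℤ.≤ + k →
          ∀ G → (∀ x → supp G x → u ⊑ x × dim x ℤ.+ 1ℤ ≡ + k ℤ.+ 1ℤ) →
          ¬ norm (D (tot f)) ≤ norm (D (tot f) +ᵀ (-ᵀ D G)) + q * w u → ∃ λ f′ → Step f f′
        decrease⇒step {f} {u} 0≤du du≤k G G-supp ¬le = f 𝒲.⊕ 𝒲.extend {+ k} u g ,
            u , 0≤du , du≤k , g , decrease , λ x → Stalk.≈ᴹ-refl (value x)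
          where
          g : 𝒲.Link.C u (+ k ℤ.- dim u ℤ.- 1ℤ)
          g = OnLink.restrictᴸ u (-ᵀ G)
          g⊨ : OnLink._⊨ᴸ_ u g (-ᵀ G)
          g⊨ = (λ x → Stalk.≈ᴹ-refl (value (value x))) , λ x s →
            proj₁ (G-supp x (supp-neg G x s)) ,
            ≡.cong (λ i → i ℤ.- dim u ℤ.- 1ℤ)
              (+1-injective {dim x} {+ k} (proj₂ (G-supp x (supp-neg G x s))))
          decrease : 𝒲.‖ 𝒲.d f 𝒲.⊕ 𝒲.d (𝒲.extend {+ k} u g) ‖ < defect f - q * w u
          decrease =
            ≰⇒> λ le → ¬le (≤-trans (≤-reflexive (sym (defect≈ (⊨-tot f)))) (x-z≤y⇒x≤y+z (≤-trans le
            (≤-reflexive (trans (‖‖≈norm (⊨-⊕ (⊨-δ ≡.refl ≡.refl (⊨-tot f))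
                (⊨-δ ≡.refl ≡.refl (OnLink.⊨-extend u {+ k} g⊨))))
              (norm-cong λ x → Stalk.+ᴹ-congˡ x (D-neg G x)))))))

        -- For `dim u` at most `k`, a violation by `G` is precisely one more step of the algorithm,
        -- with the negative of `G` as correction.
        normal-form-minimal : ∀ {f} → IsNormalForm Step f →
          ∀ u → 0ℤ ℤ.≤ dim u → dim u ℤ.≤ + k ℤ.+ 1ℤ →
          ∀ G → (∀ x → supp G x → u ⊑ x × dim x ℤ.+ 1ℤ ≡ + k ℤ.+ 1ℤ) →
          norm (D (tot f)) ≤ norm (D (tot f) +ᵀ (-ᵀ D G)) + q * w u
        normal-form-minimal {f} nf u 0≤du du≤k+1 G G-supp = by-cases em (dim u ℤ.≤? + k)
          where
          by-cases : Dec (norm (D (tot f)) ≤ norm (D (tot f) +ᵀ (-ᵀ D G)) + q * w u) →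
                     Dec (dim u ℤ.≤ + k) →
                     norm (D (tot f)) ≤ norm (D (tot f) +ᵀ (-ᵀ D G)) + q * w u
          by-cases (yes le) _          = le
          by-cases (no _)   (no du≰k)  = minimal-above (D (tot f)) u du≰k G G-supp
          by-cases (no ¬le) (yes du≤k) =
            contradiction (decrease⇒step {f} {u} 0≤du du≤k G G-supp ¬le) nf

      -- Cosystolic expansion, cocycle distance and the algorithm's output.

      module Conclusion (k : ℕ) (J≡ : J ≡ + k ℤ.+ (+ 2)) (B : Carrier) (0<B : 0# < B) where

        open Constants B Φ L k using (K; K′; E; 𝔾; contraction)
        open Constants.Bounds B Φ L k 0<B 1≤Φ 1≤L hiding (1≤C; 0≤C)
        open AbstractIntersectionProfile using (Quad)

        k+1≤J : + k ℤ.+ 1ℤ ℤ.≤ J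
        k+1≤J = ≡.subst (+ k ℤ.+ 1ℤ ℤ.≤_) (≡.sym J≡) (ℤ.+≤+ (ℕ.+-monoʳ-≤ k (s≤s z≤n)))

        k+2≤J : + (k ℕ.+ 1) ℤ.+ 1ℤ ℤ.≤ J
        k+2≤J = ≡.subst (+ (k ℕ.+ 1) ℤ.+ 1ℤ ℤ.≤_) (≡.sym J≡)
          (ℤ.+≤+ (ℕ.≤-reflexive (ℕ.+-assoc k 1 1)))

        module _ (ϵ B′ : Carrier) (0<ϵ : 0# < ϵ) (ϵ≤1 : ϵ ≤ 1#) (1≤B′ : 1# ≤ B′)
          (𝒫 : AbstractIntersectionProfile ℓ k) (isProfile : 𝒫 IsProfileFor X)
          (𝒫′ : AbstractIntersectionProfile ℓ (k ℕ.+ 1)) (isProfile′ : 𝒫′ IsProfileFor X)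
          (cbe : ∀ u → 0ℤ ℤ.≤ dim u → dim u ℤ.≤ + k → ϵ 𝒲.≤cbe[ u ] (+ k ℤ.- dim u ℤ.- 1ℤ))
          (cbe′ : ∀ u → 0ℤ ℤ.≤ dim u → dim u ℤ.≤ + k ℤ.+ 1ℤ → ϵ 𝒲.≤cbe[ u ] (+ k ℤ.- dim u))
          (nih : ∀ t l r b → Quad 𝒫 t l r b ⊎ Quad 𝒫′ t l r b → -1ℤ ℤ.< b → ∀ u → dim u ≡ b →
            IsSkeletonExpander (𝒲.NIHᴸ u l r t)
              ((K * ϵ) ^ (2 ℕ.^ ℤ.∣ + k ℤ.+ 1ℤ ℤ.- r ∣))
              (B * ((K * ϵ) ^ (2 ℕ.^ ℤ.∣ + k ℤ.+ 1ℤ ℤ.- r ∣ ℕ.*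
                               (2 ℕ.^ ℤ.∣ (r ℤ.- 1ℤ) ℤ.- b ∣ ℕ.∸ 1))) ⁻¹))
          (nih∅ : ∀ t l r b → Quad 𝒫 t l r b ⊎ Quad 𝒫′ t l r b → b ≡ -1ℤ →
            IsSkeletonExpander (NIH l r t X w)
              ((K * ϵ) ^ (2 ℕ.^ ℤ.∣ + k ℤ.+ 1ℤ ℤ.- r ∣))
              (B′ * B * ((K * ϵ) ^ (2 ℕ.^ ℤ.∣ + k ℤ.+ 1ℤ ℤ.- r ∣ ℕ.*
                                    (2 ℕ.^ ℤ.∣ r ∣ ℕ.∸ 1))) ⁻¹)) where

          -- `σ` is both `θ -1ℤ` in degree `k` and `θ 0ℤ` in degree `k + 1`; `τ` is `θ -1ℤ` in
          -- degree `k + 1`. The former roles give the bound on ccd and the parameter `q`, the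
          -- latter the bound on cse.
          η σ τ ρ q : Carrier
          η = K * ϵ
          σ = η ^ (2 ℕ.^ (k ℕ.+ 1) ℕ.∸ 1)
          τ = η ^ (2 ℕ.^ (k ℕ.+ 2) ℕ.∸ 1)
          ρ = η ^ (2 ℕ.^ (k ℕ.+ 1))
          q = K * σ

          0<η : 0# < η
          0<η = *-pos 0<K 0<ϵ

          η≤1 : η ≤ 1#
          η≤1 = *-≤1 (<⇒≤ 0<ϵ) K≤1 ϵ≤1

          0<B′ : 0# < B′
          0<B′ = <-≤-trans 0<1 1≤B′

          0<σ : 0# < σ
          0<σ = ^-pos (2 ℕ.^ (k ℕ.+ 1) ℕ.∸ 1) 0<η

          0<τ : 0# < τ
          0<τ = ^-pos (2 ℕ.^ (k ℕ.+ 2) ℕ.∸ 1) 0<η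

          τ≤σ : τ ≤ σ
          τ≤σ = ^-antitone {m = 2 ℕ.^ (k ℕ.+ 1) ℕ.∸ 1} {n = 2 ℕ.^ (k ℕ.+ 2) ℕ.∸ 1} 0<η η≤1
            (ℕ.∸-monoˡ-≤ 1 (ℕ.^-monoʳ-≤ 2 (ℕ.+-monoʳ-≤ k (s≤s z≤n))))

          ρ≤σ : ρ ≤ σ
          ρ≤σ = ^-antitone {m = 2 ℕ.^ (k ℕ.+ 1) ℕ.∸ 1} {n = 2 ℕ.^ (k ℕ.+ 1)} 0<η η≤1 (ℕ.m∸n≤m _ 1)

          0<q : 0# < q
          0<q = *-pos 0<K 0<σ

          open Correction k k+1≤J q (<⇒≤ 0<q)

          -- `K′` is `K` divided by `E`, so it absorbs any constant up to `E` and leaves `K`, while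
          -- `B′` cancels its inverse.
          scale : ∀ {c} x → 0# ≤ x → c ≤ E → B′ * (c * (B′ ⁻¹ * K′ * x)) ≤ K * x
          scale {c} x 0≤x c≤E = begin
            B′ * (c * (B′ ⁻¹ * K′ * x))
              ≈⟨ solve 5 (λ b c i k x → b :* (c :* (i :* k :* x)) := b :* (i :* (k :* c :* x)))
                refl B′ c (B′ ⁻¹) K′ x ⟩
            B′ * (B′ ⁻¹ * (K′ * c * x))   ≈⟨ x*x⁻¹y _ 0<B′ ⟩
            K′ * c * x                    ≤⟨ *-monoʳ-≤ 0≤x (K′*≤K c≤E) ⟩
            K * x                         ∎
            where
            open ≤R
            open Solver using (solve; _:*_; _:=_)

          K*≤ : ∀ {x} → 0# ≤ x → K * x ≤ x
          K*≤ 0≤x = c*x≤x K≤1 0≤x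

          module Degree-k = InDegree k k k+1≤J ℕ.≤-refl (ℕ.m≤m+n k 1)
          module Degree-k+1 = InDegree k (k ℕ.+ 1) k+2≤J (ℕ.m≤m+n k 1) ℕ.≤-refl

          vanishing-k : ∀ F → (∀ x → supp F x → dim x ≡ + k) → D F ≈ᵀ 0ᵀ →
            B′ * (𝔾 k * norm F) ≤ σ →
            (∀ G → (∀ x → supp G x → dim x ℤ.+ 1ℤ ≡ + k) → norm F ≤ norm (F +ᵀ (-ᵀ D G))) → F ≈ᵀ 0ᵀ
          vanishing-k F F-dim DF≈0 small minimal =
            Degree-k.vanishing K ϵ 0<K 0<ϵ η≤1 𝒫 isProfile B B′ (<⇒≤ 0<B) 0<B′ K*contraction₀<1 cbe
              (λ t l r u quad -1<du → nih t l r (dim u) (inj₁ quad) -1<du u ≡.refl)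
              (λ t l r quad → nih∅ t l r -1ℤ (inj₁ quad) ≡.refl)
              F F-dim DF≈0 small 0# 0≤Kθ
              (λ u _ _ G G-supp → ≤-trans (minimal G λ x s → proj₂ (G-supp x s))
                (x≤x+y (≤-reflexive (sym (zeroˡ (w u))))))
            where
            open Thresholds η 0<η η≤1 k
            0≤Kθ : 0# ≤ K * θ 0ℤ
            0≤Kθ = *-nonNeg (<⇒≤ 0<K) (<⇒≤ (0<θ 0ℤ))

          vanishing-k+1 : ∀ F → (∀ x → supp F x → dim x ≡ + k ℤ.+ 1ℤ) → D F ≈ᵀ 0ᵀ →
            B′ * (𝔾 (k ℕ.+ 1) * norm F) ≤ τ →
            (∀ u → 0ℤ ℤ.≤ dim u → dim u ℤ.≤ + k ℤ.+ 1ℤ →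
              ∀ G → (∀ x → supp G x → u ⊑ x × dim x ℤ.+ 1ℤ ≡ + k ℤ.+ 1ℤ) →
              norm F ≤ norm (F +ᵀ (-ᵀ D G)) + q * w u) → F ≈ᵀ 0ᵀ
          vanishing-k+1 F F-dim DF≈0 small minimal =
            Degree-k+1.vanishing K ϵ 0<K 0<ϵ η≤1 𝒫′ isProfile′ B B′ (<⇒≤ 0<B) 0<B′ K*contraction₁<1
              cbe″
              (λ t l r u quad -1<du → nih t l r (dim u) (inj₂ quad) -1<du u ≡.refl)
              (λ t l r quad → nih∅ t l r -1ℤ (inj₂ quad) ≡.refl)
              F F-dim DF≈0 small′ q q≤ minimal
            where
            open Thresholds η 0<η η≤1 (k ℕ.+ 1)
            shift : ∀ i j → i ℤ.- j ≡ i ℤ.+ 1ℤ ℤ.- j ℤ.- 1ℤ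
            shift = solve-∀
            cbe″ : ∀ u → 0ℤ ℤ.≤ dim u → dim u ℤ.≤ + (k ℕ.+ 1) →
              ϵ 𝒲.≤cbe[ u ] (+ (k ℕ.+ 1) ℤ.- dim u ℤ.- 1ℤ)
            cbe″ u 0≤du du≤ =
              ≡.subst (λ i → ϵ 𝒲.≤cbe[ u ] i) (shift (+ k) (dim u)) (cbe′ u 0≤du du≤)
            small′ : B′ * (𝔾 (k ℕ.+ 1) * norm F) ≤ θ -1ℤ
            small′ = ≤-trans small
              (≤-reflexive
                (reflexive (≡.cong (λ m → η ^ (2 ℕ.^ m ℕ.∸ 1)) (≡.sym (ℕ.+-assoc k 1 1)))))
            q≤ : q ≤ K * θ 0ℤ
            q≤ = ≤-reflexive
              (*-congˡ (reflexive
                (≡.cong (λ m → η ^ (2 ℕ.^ m ℕ.∸ 1)) (≡.sym (ℕ.+-identityʳ (k ℕ.+ 1))))))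

          ccd : (B′ ⁻¹ * K′ * σ) 𝒲.≤ccd (+ k)
          ccd = ccd-bound λ F F-dim DF≈0 norm≤ → vanishing-k F F-dim DF≈0 (begin
            B′ * (𝔾 k * norm F)
              ≤⟨ *-monoˡ-≤ (<⇒≤ 0<B′) (*-monoˡ-≤ (≤-trans 0≤1 (1≤𝔾 k)) norm≤) ⟩
            B′ * (𝔾 k * (B′ ⁻¹ * K′ * σ))     ≤⟨ scale σ (<⇒≤ 0<σ) (𝔾≤E (ℕ.m≤m+n k 1)) ⟩
            K * σ                             ≤⟨ K*≤ (<⇒≤ 0<σ) ⟩
            σ                                 ∎)
            where open ≤R

          D-dim : ∀ f x → supp (D (tot {+ k} f)) x → dim x ≡ + k ℤ.+ 1ℤ
          D-dim f = proj₂ (⊨-δ ≡.refl ≡.refl (⊨-tot f))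

          normal-form-cocycle : ∀ {f f′} → B′ * (𝔾 (k ℕ.+ 1) * defect f) ≤ τ →
                                Star Step f f′ → IsNormalForm Step f′ → 𝒲.Z f′
          normal-form-cocycle {f} {f′} small s nf = D≈0⇒Z (⊨-tot f′)
            (vanishing-k+1 (D (tot f′)) (D-dim f′) (D∘D≈0 (tot f′))
              (≤-trans (*-monoˡ-≤ (<⇒≤ 0<B′) (*-monoˡ-≤ (≤-trans 0≤1 (1≤𝔾 (k ℕ.+ 1)))
                (≤-trans (≤-reflexive (sym (defect≈ (⊨-tot f′)))) (defect-≤ s)))) small)
              (normal-form-minimal {f′} nf))

          Distances : 𝒲.C (+ k) → Carrier → Set ℓ
          Distances f r = ∃ λ g → 𝒲.Z g × r ≈ 𝒲.dist f g

          Z-𝟎 : 𝒲.Z {+ k} 𝒲.𝟎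
          Z-𝟎 = D≈0⇒Z ⊨-0 λ x → D-≈0 {0ᵀ} x λ y _ → Stalk.≈ᴹ-refl y

          distTo-glb : ∀ f → LowerBound (Distances f) (𝒲.distTo f 𝒲.Z) ×
                       (∀ c → LowerBound (Distances f) c → c ≤ 𝒲.distTo f 𝒲.Z)
          distTo-glb f = inf-glb (Distances f) (𝒲.dist f 𝒲.𝟎 , 𝒲.𝟎 , Z-𝟎 , refl)
            (0# , λ r (g , _ , r≈) → ≤-trans (dist-nonNeg f g) (≤-reflexive (sym r≈)))

          distTo≤dist : ∀ f {g} → 𝒲.Z g → 𝒲.distTo f 𝒲.Z ≤ 𝒲.dist f g
          distTo≤dist f {g} g∈Z = proj₁ (distTo-glb f) (𝒲.dist f g) (g , g∈Z , refl)

          distTo≤C : ∀ f → 𝒲.distTo f 𝒲.Z ≤ C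
          distTo≤C f = begin
            𝒲.distTo f 𝒲.Z            ≤⟨ distTo≤dist f Z-𝟎 ⟩
            𝒲.dist f 𝒲.𝟎              ≈⟨ dist≈ (⊨-tot f) ⊨-0 ⟩
            norm (tot f +ᵀ (-ᵀ 0ᵀ))
              ≤⟨ norm-dim {j = + k} {∅} k≤J (λ x s → ∅≤ x , proj₂ (⊨-⊖ (⊨-tot f) ⊨-0) x s) ⟩
            C * w ∅                   ≤⟨ *-monoˡ-≤ 0≤C w∅≤1 ⟩
            C * 1#                    ≈⟨ *-identityʳ C ⟩
            C                         ∎
            where open ≤R

          -- Subtracting a cocycle does not change the coboundary, and the coboundary multiplies
          -- norms by at most `C`.
          defect≤C*distTo : ∀ f → defect f ≤ C * 𝒲.distTo f 𝒲.Z
          defect≤C*distTo f = c⁻¹*x≤y⇒x≤c*y (<-≤-trans 0<1 1≤C) (proj₂ (distTo-glb f) _ lower)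
            where
            lower : LowerBound (Distances f) (C ⁻¹ * defect f)
            lower r (z , z∈Z , r≈) = x≤c*y⇒c⁻¹*x≤y (<-≤-trans 0<1 1≤C) (begin
              defect f                            ≈⟨ defect≈ (⊨-tot f) ⟩
              norm (D (tot f))                    ≈⟨ norm-cong D≈ ⟩
              norm (D (tot f +ᵀ (-ᵀ tot z)))
                ≤⟨ norm-D {j = + k} k+1≤J (proj₂ (⊨-⊖ (⊨-tot f) (⊨-tot z))) ⟩
              C * norm (tot f +ᵀ (-ᵀ tot z))      ≈⟨ *-congˡ (dist≈ (⊨-tot f) (⊨-tot z)) ⟨
              C * 𝒲.dist f z                      ≈⟨ *-congˡ r≈ ⟨
              C * r                               ∎)
              where
              open ≤R
              D≈ : D (tot f) ≈ᵀ D (tot f +ᵀ (-ᵀ tot z))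
              D≈ x = ≈ᴹ-sym
                (≈ᴹ-trans (D-+ (tot f) (-ᵀ tot z) x) (≈ᴹ-trans (+ᴹ-congˡ (≈ᴹ-trans (D-neg (tot z) x)
                (≈ᴹ-trans (-ᴹ‿cong (Z⇒D≈0 (⊨-tot z) z∈Z x)) (-ᵀ0 x)))) (+ᴹ-identityʳ _)))
                where
                open Stalk x using (≈ᴹ-sym; ≈ᴹ-trans; +ᴹ-congˡ; -ᴹ‿cong; +ᴹ-identityʳ)
                -ᵀ0 : ∀ x → (-ᵀ 0ᵀ) x ≈ˣ 0ᵀ x
                -ᵀ0 x = ¬supp⇒≈0 { -ᵀ 0ᵀ} λ s → supp-neg 0ᵀ x s (Stalk.≈ᴹ-refl x)

          T : Carrier
          T = B′ ⁻¹ * K′ * τ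

          0≤T : 0# ≤ T
          0≤T = *-nonNeg (*-nonNeg (<⇒≤ (⁻¹-pos 0<B′)) (<⇒≤ 0<K′)) (<⇒≤ 0<τ)

          C≤E : C ≤ E
          C≤E = ≤-trans (x≤c*x 1≤C 0≤C) C*C≤E

          CT≤Kτ : C * T ≤ K * τ
          CT≤Kτ = ≤-trans (x≤c*x 1≤B′ (*-nonNeg 0≤C 0≤T)) (scale τ (<⇒≤ 0<τ) C≤E)

          distTo<T⇒small : ∀ f → 𝒲.distTo f 𝒲.Z < T → B′ * (𝔾 (k ℕ.+ 1) * defect f) ≤ τ
          distTo<T⇒small f dist<T = begin
            B′ * (𝔾 (k ℕ.+ 1) * defect f)
              ≤⟨ *-monoˡ-≤ (<⇒≤ 0<B′) (*-monoˡ-≤ (≤-trans 0≤1 (1≤𝔾 (k ℕ.+ 1)))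
                   (≤-trans (defect≤C*distTo f) (*-monoˡ-≤ 0≤C (<⇒≤ dist<T)))) ⟩
            B′ * (𝔾 (k ℕ.+ 1) * (C * T))
              ≈⟨ *-congˡ (trans (sym (*-assoc _ _ _)) (*-congʳ (*-comm _ _))) ⟩
            B′ * (C * 𝔾 (k ℕ.+ 1) * T)      ≤⟨ scale τ (<⇒≤ 0<τ) C*𝔾≤E ⟩
            K * τ                           ≤⟨ K*≤ (<⇒≤ 0<τ) ⟩
            τ                               ∎
            where open ≤R

          correction : ∀ f → 𝒲.distTo f 𝒲.Z < T → 𝒲.CorrectionReturns {+ k} q f
            (λ f′ → 𝒲.Z f′ × 𝒲.dist f f′ ≤ K′ ⁻¹ * ρ ⁻¹ * 𝒲.distTo f 𝒲.Z)
          correction f dist<T =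
            halts f , λ f′ s nf → normal-form-cocycle (distTo<T⇒small f dist<T) s nf , close f′ s
            where
            open ≤R
            Δ : Carrier
            Δ = 𝒲.distTo f 𝒲.Z
            close : ∀ f′ → Star Step f f′ → 𝒲.dist f f′ ≤ K′ ⁻¹ * ρ ⁻¹ * Δ
            close f′ s = begin
              𝒲.dist f f′             ≤⟨ c*x≤y⇒x≤c⁻¹*y 0<K′ (c*x≤y⇒x≤c⁻¹*y 0<ρ ρK′≤) ⟩
              K′ ⁻¹ * (ρ ⁻¹ * Δ)      ≈⟨ *-assoc _ _ _ ⟨
              K′ ⁻¹ * ρ ⁻¹ * Δ        ∎
              where
              0<ρ : 0# < ρ
              0<ρ = ^-pos (2 ℕ.^ (k ℕ.+ 1)) 0<η
              0≤dist : 0# ≤ 𝒲.dist f f′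
              0≤dist = dist-nonNeg f f′
              ρK′≤ : ρ * (K′ * 𝒲.dist f f′) ≤ Δ
              -- The potential gives `q * dist ≤ C * defect`, which is at most `C * C * Δ`. With
              -- `q = K * σ`, the choice of `E` gives `K′ * (C * C) ≤ K`, and `σ` may be replaced by
              -- the smaller `ρ`.
              ρK′≤ = *-cancelˡ-≤ (*-pos (<-≤-trans 0<1 1≤C) (<-≤-trans 0<1 1≤C)) (begin
                C * C * (ρ * (K′ * 𝒲.dist f f′))
                  ≈⟨ Solver.solve 4 (λ c r k x → c :* (r :* (k :* x)) := k :* c :* (r :* x))
                    refl (C * C) ρ K′ (𝒲.dist f f′) ⟩
                K′ * (C * C) * (ρ * 𝒲.dist f f′)
                  ≤⟨ *-mono-≤ (*-nonNeg (<⇒≤ 0<K′) (*-nonNeg 0≤C 0≤C)) (*-nonNeg (<⇒≤ 0<σ) 0≤dist)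
                       (K′*≤K C*C≤E) (*-monoʳ-≤ 0≤dist ρ≤σ) ⟩
                K * (σ * 𝒲.dist f f′)   ≈⟨ *-assoc _ _ _ ⟨
                q * 𝒲.dist f f′         ≤⟨ q*dist≤ s ⟩
                C * defect f            ≤⟨ *-monoˡ-≤ 0≤C (defect≤C*distTo f) ⟩
                C * (C * Δ)             ≈⟨ *-assoc _ _ _ ⟨
                C * C * Δ               ∎)
                where open Solver using (_:*_; _:=_)

          -- The output is a cocycle, so `q` times the distance to the cocycles is at most `C` times
          -- the defect, and `C * T ≤ K * τ ≤ q`.
          T*distTo≤defect-small : ∀ {f f′} → B′ * (𝔾 (k ℕ.+ 1) * defect f) ≤ τ →
            Star Step f f′ → IsNormalForm Step f′ → T * 𝒲.distTo f 𝒲.Z ≤ defect f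
          T*distTo≤defect-small {f} {f′} small s nf = *-cancelˡ-≤ 0<q (begin
            q * (T * 𝒲.distTo f 𝒲.Z)
              ≤⟨ *-monoˡ-≤ (<⇒≤ 0<q)
                (*-monoˡ-≤ 0≤T (distTo≤dist f (normal-form-cocycle small s nf))) ⟩
            q * (T * 𝒲.dist f f′)
              ≈⟨ Solver.solve 3 (λ a b c → a :* (b :* c) := b :* (a :* c)) refl q T (𝒲.dist f f′) ⟩
            T * (q * 𝒲.dist f f′)    ≤⟨ *-monoˡ-≤ 0≤T (q*dist≤ s) ⟩
            T * (C * defect f)       ≈⟨ trans (sym (*-assoc _ _ _)) (*-congʳ (*-comm T C)) ⟩
            C * T * defect f
              ≤⟨ *-monoʳ-≤ (defect-nonNeg f) (≤-trans CT≤Kτ (*-monoˡ-≤ (<⇒≤ 0<K) τ≤σ)) ⟩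
            q * defect f             ∎)
            where
            open ≤R
            open Solver using (_:*_; _:=_)

          T*distTo≤defect-large : ∀ {f} → τ ≤ B′ * (𝔾 (k ℕ.+ 1) * defect f) →
                                  T * 𝒲.distTo f 𝒲.Z ≤ defect f
          T*distTo≤defect-large {f} large = begin
            T * 𝒲.distTo f 𝒲.Z                 ≤⟨ *-monoˡ-≤ 0≤T (distTo≤C f) ⟩
            T * C                              ≈⟨ *-comm T C ⟩
            C * (B′ ⁻¹ * K′ * τ)               ≤⟨ *-monoˡ-≤ 0≤C (*-monoˡ-≤ 0≤B′⁻¹K′ large) ⟩
            C * (B′ ⁻¹ * K′ * (B′ * (𝔾 (k ℕ.+ 1) * defect f)))
              ≈⟨ Solver.solve 6 (λ c i k b g x →
                c :* (i :* k :* (b :* (g :* x))) := b :* (c :* g :* (i :* k :* x))) refl C (B′ ⁻¹)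
                  K′ B′ (𝔾 (k ℕ.+ 1)) (defect f) ⟩
            B′ * (C * 𝔾 (k ℕ.+ 1) * (B′ ⁻¹ * K′ * defect f))
              ≤⟨ scale (defect f) (defect-nonNeg f) C*𝔾≤E ⟩
            K * defect f                       ≤⟨ K*≤ (defect-nonNeg f) ⟩
            defect f                           ∎
            where
            open ≤R
            open Solver using (_:*_; _:=_)
            0≤B′⁻¹K′ : 0# ≤ B′ ⁻¹ * K′
            0≤B′⁻¹K′ = *-nonNeg (<⇒≤ (⁻¹-pos 0<B′)) (<⇒≤ 0<K′)

          -- A small defect lets the algorithm find a nearby cocycle. A large one exceeds `T` times
          -- `C`, and `C` bounds the distance of any cochain to the zero cocycle.
          T*distTo≤defect : ∀ f → T * 𝒲.distTo f 𝒲.Z ≤ defect f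
          T*distTo≤defect f = by-size (em {B′ * (𝔾 (k ℕ.+ 1) * defect f) ≤ τ})
            where
            by-size : Dec (B′ * (𝔾 (k ℕ.+ 1) * defect f) ≤ τ) → T * 𝒲.distTo f 𝒲.Z ≤ defect f
            by-size (yes small) =
              T*distTo≤defect-small small (proj₂ (proj₂ (normal-form f)))
                (proj₁ (proj₂ (normal-form f)))
            by-size (no large)  = T*distTo≤defect-large (<⇒≤ (≰⇒> large))

          conclusion : (T 𝒲.≤cse (+ k)) × ((B′ ⁻¹ * K′ * σ) 𝒲.≤ccd (+ k)) ×
            (∀ f → 𝒲.distTo f 𝒲.Z < T → 𝒲.CorrectionReturns {+ k} q f
              (λ f′ → 𝒲.Z f′ × 𝒲.dist f f′ ≤ K′ ⁻¹ * ρ ⁻¹ * 𝒲.distTo f 𝒲.Z))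
          -- `T` is itself one of the `μ` in the supremum, hence below every upper bound of them.
          conclusion = (λ s upper → upper T (0≤T , T*distTo≤defect)) , ccd , correction

theorem8p1 :
  ∀ {ℓ} (em : ExcludedMiddle ℓ) (ℝ : Reals ℓ) →
  let open Reals ℝ
      open Theory em ℝ
      open AbstractIntersectionProfile using (Quad)
  in
  ∀ (B : Carrier) (F : ℕ) (L : Carrier) (k : ℕ) →
  0# < B → 1 ℕ.≤ F → 1# ≤ L →
  ∃₂ λ (K K′ : Carrier) →
    (0# < K × K ≤ 1#) ×
    (0# < K′ × K′ ≤ 1#) ×
    (∀ (R : CommutativeRing ℓ ℓ) (d : ℕ) → k ℕ.+ 2 ℕ.≤ d →
     ∀ (X : GradedPoset ℓ) → IsDPoset d X →
     ∀ (w : Weight X) → IsProperWeight X d w →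
     ∀ (orientation : Orientation R X) →
     lowerIrregularity X d ≤ L →
     (∀ i j → -1ℤ ℤ.≤ i → i ℤ.≤ j → j ℤ.≤ + k ℤ.+ (+ 2) → Fmax X -1ℤ i j ℕ.≤ F) →
     ∀ (𝒫 : AbstractIntersectionProfile ℓ k) → 𝒫 IsProfileFor X →
     ∀ (𝒫′ : AbstractIntersectionProfile ℓ (k ℕ.+ 1)) → 𝒫′ IsProfileFor X →
     ∀ (ℱ : Sheaf R X) (ε B′ : Carrier) →
     0# < ε → ε ≤ 1# → 1# ≤ B′ →
     let open GradedPoset X using (dim)
         module 𝒮 = WeightedSheaf d X w orientation ℱ
     in
     -- (1a)
     (∀ u → 0ℤ ℤ.≤ dim u → dim u ℤ.≤ + k →
       ε 𝒮.≤cbe[ u ] (+ k ℤ.- dim u ℤ.- 1ℤ)) →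
     -- (1b)
     (∀ u → 0ℤ ℤ.≤ dim u → dim u ℤ.≤ + k ℤ.+ 1ℤ →
       ε 𝒮.≤cbe[ u ] (+ k ℤ.- dim u)) →
     -- (2a)
     (∀ t l r b → Quad 𝒫 t l r b ⊎ Quad 𝒫′ t l r b → -1ℤ ℤ.< b →
       ∀ u → dim u ≡ b →
       IsSkeletonExpander (𝒮.NIHᴸ u l r t)
         ((K * ε) ^ (2 ℕ.^ ℤ.∣ + k ℤ.+ 1ℤ ℤ.- r ∣))
         (B * ((K * ε) ^ (2 ℕ.^ ℤ.∣ + k ℤ.+ 1ℤ ℤ.- r ∣
                          ℕ.* (2 ℕ.^ ℤ.∣ (r ℤ.- 1ℤ) ℤ.- b ∣ ℕ.∸ 1))) ⁻¹)) →
     -- (2b)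
     (∀ t l r b → Quad 𝒫 t l r b ⊎ Quad 𝒫′ t l r b → b ≡ -1ℤ →
       IsSkeletonExpander (NIH l r t X w)
         ((K * ε) ^ (2 ℕ.^ ℤ.∣ + k ℤ.+ 1ℤ ℤ.- r ∣))
         (B′ * B * ((K * ε) ^ (2 ℕ.^ ℤ.∣ + k ℤ.+ 1ℤ ℤ.- r ∣
                               ℕ.* (2 ℕ.^ ℤ.∣ r ∣ ℕ.∸ 1))) ⁻¹)) →
     (B′ ⁻¹ * K′ * (K * ε) ^ (2 ℕ.^ (k ℕ.+ 2) ℕ.∸ 1)) 𝒮.≤cse (+ k) ×
     (B′ ⁻¹ * K′ * (K * ε) ^ (2 ℕ.^ (k ℕ.+ 1) ℕ.∸ 1)) 𝒮.≤ccd (+ k) ×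
     (∀ (f : 𝒮.C (+ k)) →
       𝒮.distTo f 𝒮.Z < B′ ⁻¹ * K′ * (K * ε) ^ (2 ℕ.^ (k ℕ.+ 2) ℕ.∸ 1) →
       𝒮.CorrectionReturns (K * (K * ε) ^ (2 ℕ.^ (k ℕ.+ 1) ℕ.∸ 1)) f
         (λ f′ → 𝒮.Z f′ ×
           𝒮.dist f f′ ≤ K′ ⁻¹ * ((K * ε) ^ (2 ℕ.^ (k ℕ.+ 1))) ⁻¹ * 𝒮.distTo f 𝒮.Z)))

theorem8p1 em ℝ B F L k 0<B 1≤F 1≤L =
  K , K′ , (0<K , K≤1) , (0<K′ , K′≤1) ,
  λ R d k+2≤d X isDPoset w isProperWeight orientation irregularity Fmax≤F 𝒫 isProfile 𝒫′ isProfile′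
    ℱ ε B′
    0<ε ε≤1 1≤B′ cbe cbe′ nih nih∅ →
  let 𝒮 = setting d X isDPoset w isProperWeight irregularity Fmax≤F in
  conclusion em ℝ 𝒮 orientation ℱ k ≡.refl B 0<B ε B′ 0<ε ε≤1 1≤B′ 𝒫 isProfile 𝒫′ isProfile′ cbe
    cbe′ nih nih∅
  where
  open Expansion.Constants em ℝ B F L k using (K; K′)
  open Expansion.Constants.Bounds em ℝ B F L k 0<B 1≤F 1≤L using (0<K; K≤1; 0<K′; K′≤1)
  open Expansion.InSetting.InSheaf.Conclusion using (conclusion)
  setting : ∀ d X → IsDPoset d X → ∀ w → Theory.IsProperWeight em ℝ X d w →
            Reals._≤_ ℝ (Theory.lowerIrregularity em ℝ X d) L →
            (∀ i j → -1ℤ ℤ.≤ i → i ℤ.≤ j → j ℤ.≤ + k ℤ.+ (+ 2) → Theory.Fmax em ℝ X -1ℤ i j ℕ.≤ F) →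
            Expansion.Setting em ℝ
  setting d X isDPoset w isProperWeight irregularity Fmax≤F = record
    { d = d ; X = X ; isDPoset = isDPoset ; w = w ; isProperWeight = isProperWeight
    ; L = L ; Φ = F ; J = + k ℤ.+ (+ 2) ; irregularity = irregularity
    ; 1≤L = 1≤L ; 1≤Φ = 1≤F ; Fmax≤Φ = Fmax≤F }
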